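{- Let $\varepsilon \leq 1/2$. Let $G$ be a finite simple graph and let $f$ be a demand function for $G$ such that $f(v) \leq 1/(d(v) + 1 - \varepsilon)$ for each $v\in V(G)$ (where $d(v)$ is the degree of $v$), and such that $\sum_{v\in K} f(v) \leq 1$ for every clique $K\subseteq V(G)$. Then $G$ has an $f$-coloring.
   Context: A fractional coloring of a graph $G$ is a function $\phi$ assigning to each $v\in V(G)$ a Lebesgue-measurable subset $\phi(v)\subseteq[0,1]$ such that $\phi(u)\cap\phi(v)=\varnothing$ for every edge $uv\in E(G)$. A demand function for $G$ is a function $f: V(G)\to[0,1]\cap\mathbb{Q}$. An $f$-coloring is a fractional coloring $\phi$ with $\mu(\phi(v))\geq f(v)$ for every $v\in V(G)$, where $\mu$ is Lebesgue measure. -}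

module Defs where

open import Data.Nat using (ℕ)
import Data.Nat.ListAction
open import Data.Bool using (Bool; true; false; if_then_else_)
open import Data.Fin using (Fin)
open import Data.Vec using (Vec; lookup)
open import Data.List using (List; allFin; map; foldr)
open import Data.List.Relation.Unary.All using (All)
open import Data.List.Relation.Unary.AllPairs using (AllPairs)
open import Data.Rational using (ℚ; 0ℚ; 1ℚ; _+_; _-_; _*_; _≤_; _/_)
open import Data.Sum using (_⊎_)
open import Relation.Binary.PropositionalEquality using (_≡_; _≢_)

record SimpleGraph (n : ℕ) : Set where
  field
    adj    : Fin n → Fin n → Bool
    sym    : ∀ i j → adj i j ≡ adj j i
    irrefl : ∀ i → adj i i ≡ false
open SimpleGraph public

Adjacent : ∀ {n} → SimpleGraph n → Fin n → Fin n → Set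
Adjacent G i j = adj G i j ≡ true

degree : ∀ {n} → SimpleGraph n → Fin n → ℕ
degree {n} G v = Data.Nat.ListAction.sum (map (λ u → if adj G v u then 1 else 0) (allFin n))

sumℚ : List ℚ → ℚ
sumℚ = foldr _+_ 0ℚ

VSet : ℕ → Set
VSet n = Vec Bool n

_∈V_ : ∀ {n} → Fin n → VSet n → Set
v ∈V K = lookup K v ≡ true

IsClique : ∀ {n} → SimpleGraph n → VSet n → Set
IsClique G K = ∀ u v → u ∈V K → v ∈V K → u ≢ v → Adjacent G u v

sumOver : ∀ {n} → VSet n → (Fin n → ℚ) → ℚ
sumOver {n} K f = sumℚ (map (λ v → if lookup K v then f v else 0ℚ) (allFin n))

IsDemand : ∀ {n} → (Fin n → ℚ) → Set
IsDemand f = ∀ v → (0ℚ ≤ f v) Data.Product.× (f v ≤ 1ℚ)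
  where import Data.Product

-- Half-open rational subinterval [lo, hi) of [0,1].
record Interval : Set where
  constructor [_,_⟩
  field
    lo hi : ℚ
    0≤lo  : 0ℚ ≤ lo
    lo≤hi : lo ≤ hi
    hi≤1  : hi ≤ 1ℚ
open Interval public

DisjointI : Interval → Interval → Set
DisjointI I J = (hi I ≤ lo J) ⊎ (hi J ≤ lo I)

len : Interval → ℚ
len I = hi I - lo I

-- A measurable subset of [0,1] represented as a finite union of pairwise
-- disjoint half-open rational intervals.
record PSet : Set where
  field
    ivs      : List Interval
    disjoint : AllPairs DisjointI ivs
open PSet public

μ : PSet → ℚ
μ A = sumℚ (map len (ivs A))

DisjointSets : PSet → PSet → Set
DisjointSets A B = All (λ I → All (λ J → DisjointI I J) (ivs B)) (ivs A)

IsFractionalColoring : ∀ {n} → SimpleGraph n → (Fin n → PSet) → Set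
IsFractionalColoring G φ = ∀ u v → Adjacent G u v → DisjointSets (φ u) (φ v)

IsFColoring : ∀ {n} → SimpleGraph n → (Fin n → ℚ) → (Fin n → PSet) → Set
IsFColoring G f φ = IsFractionalColoring G φ Data.Product.× (∀ v → f v ≤ μ (φ v))
  where import Data.Product

{-# OPTIONS --safe #-}
module Submission where

-- Fix the graph and induct on its induced subgraphs S, with the hypothesis weakened: f(v) ≤
-- 1/(d(v) + 1/2) is required for nonsimplicial v only. A simplicial vertex can be coloured
-- last, by the clique condition. If S has no simplicial vertex, f may be raised to
-- 1/(d(v) + 1/2) and the clique condition is automatic. Now average colourings of S - x over all
-- vertices x, where a vertex that becomes simplicial takes its share of what its clique has left:
-- deleting one of the d neighbours of v raises its demand enough to pay for the deletion
-- of v itself. This fails only if the neighbourhood of v is a clique minus one edge yz and y, z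
-- have small degree; such y, z are mates (a vertex has at most one mate), and mates are deleted
-- together. Deleting mates may in turn cut off a clique K attached to y and z only; but then S - K
-- has a colouring with so much room for y and z that their common colours can be kept below
-- half the demand of a vertex of K, and K can be coloured greedily.

open import Defs renaming (sym to adj-sym)

-- Let r = 1/(d + 1/2) be the demand of v. The deletion of one neighbour raises it by 2r/(2d - 1);
-- over d neighbours this makes 2dr/(2d - 1), while the deletion of v loses r. The surplus r/(2d -
-- 1) is the whole budget of the averaging. It is spent where v becomes simplicial, since its share
-- of a clique may fall short of 1/(d - 1/2). One such deletion stays within the budget as long as a
-- nonsimplicial vertex remains next to v. The obstacle is a vertex v made simplicial by two
-- different deletions, of y and of z: two deficits have to fit. They do if z, say, stays
-- nonsimplicial and has large degree when y is deleted: it then takes so little of the clique that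
-- the deficits are at most 1/(2d - 2) and (2d - 3)/(2d - 2) of the budget. For mates the two
-- deletions are turned into one, and uniqueness of mates makes the deleted groups a partition. When
-- a deletion leaves only simplicial vertices around v the deficit has no such bound, hence the
-- separate treatment of K. All of this is done with palettes of L equal colours and integral
-- demands; rationals enter only at the end.

module Integral where

  open import Data.Nat using (ℕ; zero; suc; _+_; _*_; _∸_; _≤_; _<_; z≤n; s≤s; _!; _/_)
  open import Data.Nat.Properties
  open import Data.Nat.DivMod using (m*[n/m]≡n)
  open import Data.Nat.Divisibility using (_∣_; ∣-trans; m∣m*n; m≤n⇒m!∣n!)
  open import Data.Nat.Tactic.RingSolver using (solve-∀)
  open import Data.Fin using (Fin; zero; suc; splitAt; _↑ˡ_; _↑ʳ_)
  open import Data.Fin.Properties using (any?; all?; splitAt-↑ˡ; splitAt-↑ʳ) renaming (_≟_ to _≟F_)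
  open import Data.Bool using (Bool; true; false; if_then_else_; _∧_; not)
  open import Data.Bool.Properties using () renaming (_≟_ to _≟B_)
  open import Data.List using ([]; _∷_; allFin)
  open import Data.List.Membership.Propositional using (_∈_)
  open import Data.List.Membership.Propositional.Properties using (∈-allFin)
  open import Data.List.Relation.Unary.Any using (here; there)
  open import Data.Product using (Σ; ∃; _×_; _,_; proj₁; proj₂)
  open import Data.Sum using (_⊎_; inj₁; inj₂; [_,_]′)
  import Data.Sum as Sum
  open import Data.Empty using (⊥; ⊥-elim)
  open import Relation.Nullary using (¬_; Dec; yes; no; does; contradiction)
  open import Relation.Nullary.Decidable using (_×-dec_; _⊎-dec_; _→-dec_; ¬?; decidable-stable)
  open import Relation.Binary.PropositionalEquality using (_≡_; _≢_; refl; sym; trans; cong; cong₂; subst)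
  open import Algebra.Properties.Semiring.Sum +-*-semiring using (sum; sum-cong-≗; ∑-distrib-+; ∑-comm; *-distribˡ-sum; *-distribʳ-sum; sum-replicate-zero)

  -- Finite sums and counting

  ⟨_⟩ : ∀ {A : Set} → Dec A → ℕ
  ⟨ yes _ ⟩ = 1
  ⟨ no _ ⟩ = 0

  ⟨⟩-yes : ∀ {A : Set} (a? : Dec A) → A → ⟨ a? ⟩ ≡ 1
  ⟨⟩-yes (yes _) _ = refl
  ⟨⟩-yes (no ¬a) a = contradiction a ¬a

  ⟨⟩-no : ∀ {A : Set} (a? : Dec A) → ¬ A → ⟨ a? ⟩ ≡ 0
  ⟨⟩-no (yes a) ¬a = contradiction a ¬a
  ⟨⟩-no (no _) _ = refl

  ⟨⟩≤1 : ∀ {A : Set} (a? : Dec A) → ⟨ a? ⟩ ≤ 1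
  ⟨⟩≤1 (yes _) = ≤-refl
  ⟨⟩≤1 (no _) = z≤n

  ⟨⟩-mono : ∀ {A B : Set} (a? : Dec A) (b? : Dec B) → (A → B) → ⟨ a? ⟩ ≤ ⟨ b? ⟩
  ⟨⟩-mono (no _) b? f = z≤n
  ⟨⟩-mono (yes a) b? f = ≤-reflexive (sym (⟨⟩-yes b? (f a)))

  ⟨⟩-cong : ∀ {A B : Set} (a? : Dec A) (b? : Dec B) → (A → B) → (B → A) → ⟨ a? ⟩ ≡ ⟨ b? ⟩
  ⟨⟩-cong a? b? f g = ≤-antisym (⟨⟩-mono a? b? f) (⟨⟩-mono b? a? g)

  ⟨⟩-disj : ∀ {A B C : Set} (a? : Dec A) (b? : Dec B) (c? : Dec C) →
    (A → C) → (B → C) → (A → B → ⊥) → ⟨ a? ⟩ + ⟨ b? ⟩ ≤ ⟨ c? ⟩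
  ⟨⟩-disj (no _) b? c? f g d = ⟨⟩-mono b? c? g
  ⟨⟩-disj (yes a) (no _) c? f g d = ≤-reflexive (sym (⟨⟩-yes c? (f a)))
  ⟨⟩-disj (yes a) (yes b) c? f g d = ⊥-elim (d a b)

  ⟨⟩-cover : ∀ {A B C : Set} (a? : Dec A) (b? : Dec B) (c? : Dec C) →
    (C → A ⊎ B) → ⟨ c? ⟩ ≤ ⟨ a? ⟩ + ⟨ b? ⟩
  ⟨⟩-cover a? b? (no _) f = z≤n
  ⟨⟩-cover a? b? (yes c) f with f c
  ... | inj₁ a = ≤-trans (≤-reflexive (sym (⟨⟩-yes a? a))) (m≤m+n _ _)
  ... | inj₂ b = ≤-trans (≤-reflexive (sym (⟨⟩-yes b? b))) (m≤n+m _ _)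

  ⟨⟩-case : ∀ {A : Set} (a? : Dec A) {x y : ℕ} → (A → x ≤ y) → ⟨ a? ⟩ * x ≤ ⟨ a? ⟩ * y
  ⟨⟩-case (yes a) f = *-monoʳ-≤ 1 (f a)
  ⟨⟩-case (no _) f = z≤n

  -- Kept abstract so that the summand can be inferred from a sum.
  abstract
    ∑ : ∀ {n} → (Fin n → ℕ) → ℕ
    ∑ = sum

    ∑-mono : ∀ {n} {f g : Fin n → ℕ} → (∀ i → f i ≤ g i) → ∑ f ≤ ∑ g
    ∑-mono {zero} h = z≤n
    ∑-mono {suc n} h = +-mono-≤ (h zero) (∑-mono (λ i → h (suc i)))

    ∑-cong : ∀ {n} {f g : Fin n → ℕ} → (∀ i → f i ≡ g i) → ∑ f ≡ ∑ g
    ∑-cong = sum-cong-≗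

    ∑-zero : ∀ {n} {f : Fin n → ℕ} → (∀ i → f i ≡ 0) → ∑ f ≡ 0
    ∑-zero {n} h = trans (∑-cong h) (sum-replicate-zero n)

    term≤∑ : ∀ {n} (f : Fin n → ℕ) (x : Fin n) → f x ≤ ∑ f
    term≤∑ f zero = m≤m+n _ _
    term≤∑ f (suc x) = ≤-trans (term≤∑ (λ i → f (suc i)) x) (m≤n+m _ _)

    ∑-const : ∀ n c → ∑ {n} (λ _ → c) ≡ n * c
    ∑-const zero c = refl
    ∑-const (suc n) c = cong (c +_) (∑-const n c)

    ∑-+ : ∀ {n} (f g : Fin n → ℕ) → ∑ (λ i → f i + g i) ≡ ∑ f + ∑ g
    ∑-+ = ∑-distrib-+

    ∑-*ˡ : ∀ {n} (c : ℕ) (f : Fin n → ℕ) → ∑ (λ i → c * f i) ≡ c * ∑ f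
    ∑-*ˡ c f = sym (*-distribˡ-sum c f)

    ∑-*ʳ : ∀ {n} (c : ℕ) (f : Fin n → ℕ) → ∑ (λ i → f i * c) ≡ ∑ f * c
    ∑-*ʳ c f = sym (*-distribʳ-sum c f)

    ∑-swap : ∀ {m n} (f : Fin m → Fin n → ℕ) → ∑ (λ i → ∑ (f i)) ≡ ∑ (λ j → ∑ (λ i → f i j))
    ∑-swap = ∑-comm

    ∑-suc : ∀ {n} (f : Fin (suc n) → ℕ) → ∑ f ≡ f zero + ∑ (λ i → f (suc i))
    ∑-suc f = refl

    ∑-nil : (f : Fin 0 → ℕ) → ∑ f ≡ 0
    ∑-nil f = refl

    ∑-point : ∀ {n} (x : Fin n) (f : Fin n → ℕ) → ∑ (λ i → ⟨ i ≟F x ⟩ * f i) ≡ f x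
    ∑-point {n} x f = ≤-antisym (upper x f)
      (≤-trans (≤-reflexive (sym (trans (cong (_* f x) (⟨⟩-yes (x ≟F x) refl)) (*-identityˡ _))))
               (term≤∑ (λ i → ⟨ i ≟F x ⟩ * f i) x))
      where
      upper : ∀ {k} (x : Fin k) (f : Fin k → ℕ) → ∑ (λ i → ⟨ i ≟F x ⟩ * f i) ≤ f x
      upper zero f = ≤-trans (+-mono-≤ (≤-reflexive (+-identityʳ _))
          (≤-reflexive (∑-zero (λ i → cong (_* f (suc i)) (⟨⟩-no (suc i ≟F zero) λ ())))))
        (≤-reflexive (+-identityʳ _))
      upper (suc x) f = +-mono-≤ {0} (≤-reflexive (cong (_* f zero) (⟨⟩-no (zero ≟F suc x) λ ())))
        (≤-trans (∑-mono (λ i → *-monoˡ-≤ (f (suc i))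
            (⟨⟩-mono (suc i ≟F suc x) (i ≟F x) λ { refl → refl })))
          (upper x (λ i → f (suc i))))

  # : ∀ {n} {P : Fin n → Set} → (∀ i → Dec (P i)) → ℕ
  # P? = ∑ (λ i → ⟨ P? i ⟩)

  #-mono : ∀ {n} {P Q : Fin n → Set} (P? : ∀ i → Dec (P i)) (Q? : ∀ i → Dec (Q i)) →
    (∀ i → P i → Q i) → # P? ≤ # Q?
  #-mono P? Q? f = ∑-mono (λ i → ⟨⟩-mono (P? i) (Q? i) (f i))

  #-cong : ∀ {n} {P Q : Fin n → Set} (P? : ∀ i → Dec (P i)) (Q? : ∀ i → Dec (Q i)) →
    (∀ i → P i → Q i) → (∀ i → Q i → P i) → # P? ≡ # Q?
  #-cong P? Q? f g = ≤-antisym (#-mono P? Q? f) (#-mono Q? P? g)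

  #-disj : ∀ {n} {P Q R : Fin n → Set} (P? : ∀ i → Dec (P i)) (Q? : ∀ i → Dec (Q i)) (R? : ∀ i → Dec (R i)) →
    (∀ i → P i → R i) → (∀ i → Q i → R i) → (∀ i → P i → Q i → ⊥) → # P? + # Q? ≤ # R?
  #-disj P? Q? R? f g d = ≤-trans (≤-reflexive (sym (∑-+ _ _)))
    (∑-mono (λ i → ⟨⟩-disj (P? i) (Q? i) (R? i) (f i) (g i) (d i)))

  #-cover : ∀ {n} {P Q R : Fin n → Set} (P? : ∀ i → Dec (P i)) (Q? : ∀ i → Dec (Q i)) (R? : ∀ i → Dec (R i)) →
    (∀ i → R i → P i ⊎ Q i) → # R? ≤ # P? + # Q?
  #-cover P? Q? R? f = ≤-trans (∑-mono (λ i → ⟨⟩-cover (P? i) (Q? i) (R? i) (f i)))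
    (≤-reflexive (∑-+ _ _))

  #-one : ∀ {n} (x : Fin n) → # (λ i → i ≟F x) ≡ 1
  #-one x = trans (∑-cong (λ i → sym (*-identityʳ _))) (∑-point x (λ _ → 1))

  #-pos : ∀ {n} {P : Fin n → Set} (P? : ∀ i → Dec (P i)) (x : Fin n) → P x → 1 ≤ # P?
  #-pos P? x p = ≤-trans (≤-reflexive (sym (#-one x))) (#-mono (_≟F x) P? λ { _ refl → p })

  #-strict : ∀ {n} {P Q : Fin n → Set} (P? : ∀ i → Dec (P i)) (Q? : ∀ i → Dec (Q i)) →
    (∀ i → P i → Q i) → (x : Fin n) → Q x → ¬ P x → # P? < # Q?
  #-strict P? Q? f x q ¬p = ≤-trans (≤-reflexive (cong (_+ # P?) (sym (#-one x))))
    (#-disj (_≟F x) P? Q? (λ { _ refl → q }) f (λ { _ refl p → ¬p p }))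

  #≤n : ∀ {n} {P : Fin n → Set} (P? : ∀ i → Dec (P i)) → # P? ≤ n
  #≤n {n} P? = ≤-trans (∑-mono (λ i → ⟨⟩≤1 (P? i)))
    (≤-reflexive (trans (∑-const n 1) (*-identityʳ n)))

  #-full : ∀ {n} {P Q : Fin n → Set} (P? : ∀ i → Dec (P i)) (Q? : ∀ i → Dec (Q i)) →
    (∀ i → P i → Q i) → # Q? ≤ # P? → ∀ i → Q i → P i
  #-full P? Q? f le i q with P? i
  ... | yes p = p
  ... | no ¬p = contradiction (#-strict P? Q? f i q ¬p) (≤⇒≯ le)

  -- Sets of colours

  β : Bool → ℕ
  β true = 1
  β false = 0

  Colours : ℕ → Set
  Colours L = Fin L → Bool

  ∣_∣ : ∀ {L} → Colours L → ℕ
  ∣ X ∣ = ∑ (λ i → β (X i))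

  infix 4 _⊆_ _⟂_

  _⊆_ _⟂_ : ∀ {L} → Colours L → Colours L → Set
  X ⊆ Y = ∀ i → X i ≡ true → Y i ≡ true
  X ⟂ Y = ∀ i → X i ≡ true → Y i ≡ true → ⊥

  β-mono : ∀ {x y} → (x ≡ true → y ≡ true) → β x ≤ β y
  β-mono {false} f = z≤n
  β-mono {true} f = ≤-reflexive (cong β (sym (f refl)))

  ∣∣-mono : ∀ {L} {X Y : Colours L} → X ⊆ Y → ∣ X ∣ ≤ ∣ Y ∣
  ∣∣-mono s = ∑-mono (λ i → β-mono (s i))

  ∅ : ∀ {L} → Colours L
  ∅ _ = false

  ∣∅∣ : ∀ {L} → ∣ ∅ {L} ∣ ≡ 0
  ∣∅∣ = ∑-zero (λ _ → refl)

  cons : ∀ {L} → Bool → Colours L → Colours (suc L)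
  cons x X zero = x
  cons x X (suc i) = X i

  ∣cons∣ : ∀ {L} x (X : Colours L) → ∣ cons x X ∣ ≡ β x + ∣ X ∣
  ∣cons∣ x X = ∑-suc _

  cons-⊆ˡ : ∀ {L} {x} {X : Colours L} {Y : Colours (suc L)} → (x ≡ true → Y zero ≡ true) → X ⊆ (λ i → Y (suc i)) → cons x X ⊆ Y
  cons-⊆ˡ f g zero = f
  cons-⊆ˡ f g (suc i) = g i

  cons-⊆ʳ : ∀ {L} {x} {X : Colours L} {Y : Colours (suc L)} → (Y zero ≡ true → x ≡ true) → (λ i → Y (suc i)) ⊆ X → Y ⊆ cons x X
  cons-⊆ʳ f g zero = f
  cons-⊆ʳ f g (suc i) = g i

  -- The lower set `X` is there because later colourings have to keep colours already given, or
  -- colours chosen on purpose.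
  between : ∀ {L} (X Y : Colours L) → X ⊆ Y → ∀ m → ∣ X ∣ ≤ m → m ≤ ∣ Y ∣ →
    Σ (Colours L) λ Z → X ⊆ Z × Z ⊆ Y × ∣ Z ∣ ≡ m
  between {zero} X Y s m lo hi = ∅ , (λ ()) , (λ ()) , trans ∣∅∣ (sym (n≤0⇒n≡0 (≤-trans hi (≤-reflexive (∑-nil _)))))
  between {suc L} X Y s m lo hi with X zero in xq | Y zero in yq
  ... | true | false = contradiction (trans (sym (s zero xq)) yq) λ ()
  ... | false | false = let Z , p , q , e = between X′ Y′ s′ m lo′ hi′ in
    cons false Z , cons-⊆ʳ (λ t → trans (sym xq) t) p , cons-⊆ˡ (λ ()) q , trans (∣cons∣ false Z) e
    where
    X′ = λ i → X (suc i)
    Y′ = λ i → Y (suc i)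
    s′ : X′ ⊆ Y′
    s′ i = s (suc i)
    lo′ : ∣ X′ ∣ ≤ m
    lo′ = ≤-trans (≤-reflexive (sym (trans (∑-suc _) (cong (λ b → β b + ∣ X′ ∣) xq)))) lo
    hi′ : m ≤ ∣ Y′ ∣
    hi′ = ≤-trans hi (≤-reflexive (trans (∑-suc _) (cong (λ b → β b + ∣ Y′ ∣) yq)))
  ... | true | true = case m refl
    where
    X′ = λ i → X (suc i)
    Y′ = λ i → Y (suc i)
    lo′ : suc ∣ X′ ∣ ≤ m
    lo′ = ≤-trans (≤-reflexive (sym (trans (∑-suc _) (cong (λ b → β b + ∣ X′ ∣) xq)))) lo
    hi′ : m ≤ suc ∣ Y′ ∣
    hi′ = ≤-trans hi (≤-reflexive (trans (∑-suc _) (cong (λ b → β b + ∣ Y′ ∣) yq)))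
    case : ∀ k → k ≡ m → Σ (Colours (suc L)) λ Z → X ⊆ Z × Z ⊆ Y × ∣ Z ∣ ≡ m
    case zero refl = contradiction lo′ λ ()
    case (suc k) refl with between X′ Y′ (λ i → s (suc i)) k (≤-pred lo′) (≤-pred hi′)
    ... | Z , p , q , e = cons true Z , cons-⊆ʳ (λ _ → refl) p , cons-⊆ˡ (λ _ → yq) q , trans (∣cons∣ true Z) (cong suc e)
  ... | false | true with m ≤? ∣ (λ i → Y (suc i)) ∣
  ...   | yes le = let Z , p , q , e = between (λ i → X (suc i)) (λ i → Y (suc i)) (λ i → s (suc i)) m lo′ le in
    cons false Z , cons-⊆ʳ (λ t → trans (sym xq) t) p , cons-⊆ˡ (λ ()) q , trans (∣cons∣ false Z) e
    where
    lo′ : ∣ (λ i → X (suc i)) ∣ ≤ m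
    lo′ = ≤-trans (≤-reflexive (sym (trans (∑-suc _) (cong (λ b → β b + ∣ (λ i → X (suc i)) ∣) xq)))) lo
  ...   | no gt = cons true Y′ , cons-⊆ʳ (λ _ → refl) (λ i → s (suc i)) , cons-⊆ˡ (λ _ → yq) (λ i t → t) ,
      trans (∣cons∣ true Y′) (≤-antisym (≰⇒> gt) (≤-trans hi (≤-reflexive (trans (∑-suc _) (cong (λ b → β b + ∣ Y′ ∣) yq)))))
    where
    Y′ = λ i → Y (suc i)

  subcolours : ∀ {L} (Y : Colours L) m → m ≤ ∣ Y ∣ → Σ (Colours L) λ Z → Z ⊆ Y × ∣ Z ∣ ≡ m
  subcolours Y m le = let Z , _ , q , e = between ∅ Y (λ _ ()) m (≤-trans (≤-reflexive ∣∅∣) z≤n) le in Z , q , e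

  _⊕_ : ∀ {L K} → Colours L → Colours K → Colours (L + K)
  _⊕_ {L} X Y i = [ X , Y ]′ (splitAt L i)

  ∑-split : ∀ k {l} (f : Fin (k + l) → ℕ) → ∑ f ≡ ∑ (λ i → f (i ↑ˡ l)) + ∑ (λ j → f (k ↑ʳ j))
  ∑-split zero f = sym (cong (_+ ∑ f) (∑-nil _))
  ∑-split (suc k) f = trans (∑-suc f) (trans (cong (f zero +_) (∑-split k (λ i → f (suc i))))
    (trans (sym (+-assoc (f zero) _ _)) (cong (_+ ∑ (λ j → f (suc k ↑ʳ j))) (sym (∑-suc _)))))

  ∣⊕∣ : ∀ {L K} (X : Colours L) (Y : Colours K) → ∣ X ⊕ Y ∣ ≡ ∣ X ∣ + ∣ Y ∣
  ∣⊕∣ {L} {K} X Y = trans (∑-split L _) (cong₂ _+_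
    (∑-cong (λ i → cong (λ s → β ([ X , Y ]′ s)) (splitAt-↑ˡ L i K)))
    (∑-cong (λ j → cong (λ s → β ([ X , Y ]′ s)) (splitAt-↑ʳ L K j))))

  ⊕-⟂ : ∀ {L K} {X X′ : Colours L} {Y Y′ : Colours K} → X ⟂ X′ → Y ⟂ Y′ → (X ⊕ Y) ⟂ (X′ ⊕ Y′)
  ⊕-⟂ {L} p q i with splitAt L i
  ... | inj₁ j = p j
  ... | inj₂ j = q j

  copies : ∀ {L} k → Colours L → Colours (k * L)
  copies zero X = ∅
  copies (suc k) X = X ⊕ copies k X

  ∣copies∣ : ∀ {L} k (X : Colours L) → ∣ copies k X ∣ ≡ k * ∣ X ∣
  ∣copies∣ zero X = ∣∅∣
  ∣copies∣ (suc k) X = trans (∣⊕∣ X (copies k X)) (cong (∣ X ∣ +_) (∣copies∣ k X))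

  copies-⟂ : ∀ {L} k {X Y : Colours L} → X ⟂ Y → copies k X ⟂ copies k Y
  copies-⟂ zero p i ()
  copies-⟂ (suc k) {X} {Y} p = ⊕-⟂ {X = X} {Y} p (copies-⟂ k p)

  -- Greedy extension, concatenation and scaling of colourings

  module Colourings {n : ℕ} (G : SimpleGraph n) where

    Adj : Fin n → Fin n → Set
    Adj = Adjacent G

    Adj? : ∀ u v → Dec (Adj u v)
    Adj? u v = adj G u v ≟B true

    Adj-sym : ∀ {u v} → Adj u v → Adj v u
    Adj-sym {u} {v} a = trans (adj-sym G v u) a

    Adj-irr : ∀ {u} → ¬ Adj u u
    Adj-irr {u} a = contradiction (trans (sym a) (irrefl G u)) λ ()

    Family : ℕ → Set
    Family L = Fin n → Colours L

    Proper : ∀ {L} → Family L → Set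
    Proper φ = ∀ u v → Adj u v → φ u ⟂ φ v

    load : (Fin n → ℕ) → Fin n → ℕ
    load k u = ∑ (λ t → ⟨ Adj? u t ⟩ * k t)

    blocked? : ∀ {L} (φ : Family L) u i → Dec (∃ λ t → Adj u t × φ t i ≡ true)
    blocked? φ u i = any? (λ t → Adj? u t ×-dec (φ t i ≟B true))

    free : ∀ {L} → Family L → Fin n → Colours L
    free φ u i = not (does (blocked? φ u i))

    free-⟂ : ∀ {L} (φ : Family L) u t → Adj u t → free φ u ⟂ φ t
    free-⟂ φ u t a i p q with blocked? φ u i
    ... | yes _ = contradiction p λ ()
    ... | no ¬b = ¬b (t , a , q)

    free-intro : ∀ {L} (φ : Family L) u i → (∀ t → Adj u t → φ t i ≡ true → ⊥) → free φ u i ≡ true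
    free-intro φ u i none with blocked? φ u i
    ... | yes (t , a , q) = ⊥-elim (none t a q)
    ... | no _ = refl

    own-free : ∀ {L} (φ : Family L) → Proper φ → ∀ u → φ u ⊆ free φ u
    own-free φ pr u i p = free-intro φ u i λ t a → pr u t a i p

    ∑-load : ∀ {L} (φ : Family L) u → ∑ (λ i → ∑ (λ t → ⟨ Adj? u t ⟩ * β (φ t i))) ≡ load (λ t → ∣ φ t ∣) u
    ∑-load φ u = trans (∑-swap _) (∑-cong (λ t → ∑-*ˡ ⟨ Adj? u t ⟩ (λ i → β (φ t i))))

    blocked-count : ∀ {L} (φ : Family L) u i → 1 ≤ β (free φ u i) + ∑ (λ t → ⟨ Adj? u t ⟩ * β (φ t i))
    blocked-count φ u i with blocked? φ u i
    ... | no _ = s≤s z≤n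
    ... | yes (t , a , q) = ≤-trans (≤-reflexive (sym (cong₂ _*_ (⟨⟩-yes (Adj? u t) a) (cong β q)))) (term≤∑ _ t)

    free-count : ∀ {L} (φ : Family L) u → L ≤ ∣ free φ u ∣ + load (λ t → ∣ φ t ∣) u
    free-count {L} φ u = begin
      L ≡⟨ sym (trans (∑-const L 1) (*-identityʳ L)) ⟩
      ∑ {L} (λ _ → 1) ≤⟨ ∑-mono (blocked-count φ u) ⟩
      ∑ (λ i → β (free φ u i) + ∑ (λ t → ⟨ Adj? u t ⟩ * β (φ t i))) ≡⟨ ∑-+ _ _ ⟩
      ∣ free φ u ∣ + _ ≡⟨ cong (∣ free φ u ∣ +_) (∑-load φ u) ⟩
      ∣ free φ u ∣ + load (λ t → ∣ φ t ∣) u ∎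
      where open ≤-Reasoning

    -- Colours shared by two neighbours of u block only once.
    free-count₂ : ∀ {L} (φ : Family L) {u y z} → Adj u y → Adj u z → y ≢ z →
      L + ∣ (λ i → φ y i ∧ φ z i) ∣ ≤ ∣ free φ u ∣ + load (λ t → ∣ φ t ∣) u
    free-count₂ {L} φ {u} {y} {z} ay az y≢z = begin
      L + ∣ both ∣ ≡⟨ cong (_+ ∣ both ∣) (sym (trans (∑-const L 1) (*-identityʳ L))) ⟩
      ∑ {L} (λ _ → 1) + ∣ both ∣ ≡⟨ sym (∑-+ _ _) ⟩
      ∑ (λ i → 1 + β (both i)) ≤⟨ ∑-mono step ⟩
      ∑ (λ i → β (free φ u i) + ∑ (λ t → ⟨ Adj? u t ⟩ * β (φ t i))) ≡⟨ ∑-+ _ _ ⟩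
      ∣ free φ u ∣ + _ ≡⟨ cong (∣ free φ u ∣ +_) (∑-load φ u) ⟩
      ∣ free φ u ∣ + load (λ t → ∣ φ t ∣) u ∎
      where
      open ≤-Reasoning
      both = λ i → φ y i ∧ φ z i
      step : ∀ i → 1 + β (both i) ≤ β (free φ u i) + ∑ (λ t → ⟨ Adj? u t ⟩ * β (φ t i))
      step i with φ y i in qy | φ z i in qz
      ... | false | _ = blocked-count φ u i
      ... | true | false = blocked-count φ u i
      ... | true | true = ≤-trans (≤-reflexive (sym (cong₂ _+_ (#-one y) (#-one z))))
        (≤-trans (≤-reflexive (sym (∑-+ _ _))) (≤-trans (∑-mono pt) (m≤n+m _ _)))
        where
        pt : ∀ t → ⟨ t ≟F y ⟩ + ⟨ t ≟F z ⟩ ≤ ⟨ Adj? u t ⟩ * β (φ t i)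
        pt t with t ≟F y | t ≟F z
        ... | yes refl | yes refl = contradiction refl y≢z
        ... | yes refl | no _ = ≤-reflexive (sym (cong₂ _*_ (⟨⟩-yes (Adj? u t) ay) (cong β qy)))
        ... | no _ | yes refl = ≤-reflexive (sym (cong₂ _*_ (⟨⟩-yes (Adj? u t) az) (cong β qz)))
        ... | no _ | no _ = z≤n

    load-mono : ∀ {k k′} → (∀ t → k t ≤ k′ t) → ∀ u → load k u ≤ load k′ u
    load-mono le u = ∑-mono (λ t → *-monoʳ-≤ ⟨ Adj? u t ⟩ (le t))

    recolour : ∀ {L} → Family L → Fin n → Colours L → Family L
    recolour φ u X t = if does (t ≟F u) then X else φ t

    recolour-≡ : ∀ {L} (φ : Family L) u X → recolour φ u X u ≡ X
    recolour-≡ φ u X with u ≟F u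
    ... | yes _ = refl
    ... | no ne = contradiction refl ne

    recolour-≢ : ∀ {L} (φ : Family L) u X {t} → t ≢ u → recolour φ u X t ≡ φ t
    recolour-≢ φ u X {t} ne with t ≟F u
    ... | yes e = contradiction e ne
    ... | no _ = refl

    recolour-proper : ∀ {L} (φ : Family L) u X → Proper φ → (∀ t → Adj u t → X ⟂ φ t) → Proper (recolour φ u X)
    recolour-proper φ u X pr d s t a with s ≟F u | t ≟F u
    ... | yes refl | yes refl = contradiction a Adj-irr
    ... | yes refl | no _ = d t a
    ... | no _ | yes refl = λ i p q → d s (Adj-sym a) i q p
    ... | no _ | no _ = pr s t a

    -- `U` is the set to be filled up and `Done` the part treated so far: a list during the
    -- recursion, all of `U` at its end. `bounded` is kept at every vertex because the room is
    -- computed from `k`, not from the actual sizes.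
    record Saturation {L} (φ : Family L) (k : Fin n → ℕ) (U Done : Fin n → Set) : Set where
      field
        ψ : Family L
        proper : Proper ψ
        bounded : ∀ t → ∣ ψ t ∣ ≤ k t
        extends : ∀ t → φ t ⊆ ψ t
        exact : ∀ t → U t → Done t → ∣ ψ t ∣ ≡ k t
        unchanged : ∀ t → ¬ U t → ψ t ≡ φ t

    -- Whatever the order, the neighbours of `u` block at most `load k u` colours, so at least `k u`
    -- are free, and the colours that `u` already has are among them.
    saturate-list : ∀ {L} (φ : Family L) k {U : Fin n → Set} → (∀ t → Dec (U t)) → Proper φ → (∀ t → ∣ φ t ∣ ≤ k t) →
      (∀ u → U u → k u + load k u ≤ L) → ∀ us → Saturation φ k U (_∈ us)
    saturate-list φ k U? pr bd room [] = record
      { ψ = φ ; proper = pr ; bounded = bd ; extends = λ _ _ p → p ; exact = λ _ _ () ; unchanged = λ _ _ → refl }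
    saturate-list {L} φ k {U} U? pr bd room (u ∷ us) with U? u
    ... | no ¬Uu = record
      { ψ = S.ψ ; proper = S.proper ; bounded = S.bounded ; extends = S.extends
      ; exact = λ { t Ut (here refl) → contradiction Ut ¬Uu ; t Ut (there m) → S.exact t Ut m }
      ; unchanged = S.unchanged }
      where module S = Saturation (saturate-list φ k U? pr bd room us)
    ... | yes Uu = record
      { ψ = χ ; proper = recolour-proper S.ψ u X S.proper disjoint′
      ; bounded = bounded′ ; extends = extends′ ; exact = exact′
      ; unchanged = λ t ¬Ut → trans (recolour-≢ S.ψ u X λ { refl → ¬Ut Uu }) (S.unchanged t ¬Ut) }
      where
      module S = Saturation (saturate-list φ k U? pr bd room us)
      fits : k u ≤ ∣ free S.ψ u ∣
      fits = +-cancelʳ-≤ (load k u) _ _ (≤-trans (room u Uu)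
        (≤-trans (free-count S.ψ u) (+-monoʳ-≤ ∣ free S.ψ u ∣ (load-mono S.bounded u))))
      Z = between (S.ψ u) (free S.ψ u) (own-free S.ψ S.proper u) (k u) (S.bounded u) fits
      X = proj₁ Z
      ∣X∣ : ∣ X ∣ ≡ k u
      ∣X∣ = proj₂ (proj₂ (proj₂ Z))
      χ = recolour S.ψ u X
      disjoint′ : ∀ t → Adj u t → X ⟂ S.ψ t
      disjoint′ t a i p = free-⟂ S.ψ u t a i (proj₁ (proj₂ (proj₂ Z)) i p)
      bounded′ : ∀ t → ∣ χ t ∣ ≤ k t
      bounded′ t with t ≟F u
      ... | yes refl = ≤-reflexive ∣X∣
      ... | no _ = S.bounded t
      extends′ : ∀ t → φ t ⊆ χ t
      extends′ t i p with t ≟F u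
      ... | yes refl = proj₁ (proj₂ Z) i (S.extends t i p)
      ... | no _ = S.extends t i p
      exact′ : ∀ t → U t → t ∈ (u ∷ us) → ∣ χ t ∣ ≡ k t
      exact′ t Ut m with t ≟F u
      exact′ t Ut m | yes refl = ∣X∣
      exact′ t Ut (here e) | no ne = contradiction e ne
      exact′ t Ut (there m) | no ne = S.exact t Ut m

    saturate : ∀ {L} (φ : Family L) k {U : Fin n → Set} → (∀ t → Dec (U t)) → Proper φ → (∀ t → ∣ φ t ∣ ≤ k t) →
      (∀ u → U u → k u + load k u ≤ L) → Saturation φ k U U
    saturate φ k U? pr bd room = record
      { ψ = S.ψ ; proper = S.proper ; bounded = S.bounded ; extends = S.extends
      ; exact = λ t Ut _ → S.exact t Ut (∈-allFin t) ; unchanged = S.unchanged }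
      where module S = Saturation (saturate-list φ k U? pr bd room (allFin n))

    ⊆-proper : ∀ {L} {φ ψ : Family L} → (∀ t → ψ t ⊆ φ t) → Proper φ → Proper ψ
    ⊆-proper s pr u v a i p q = pr u v a i (s u i p) (s v i q)

    trim : ∀ {L} (φ : Family L) (k : Fin n → ℕ) → (∀ t → k t ≤ ∣ φ t ∣) →
      Σ (Family L) λ ψ → (∀ t → ψ t ⊆ φ t) × (∀ t → ∣ ψ t ∣ ≡ k t)
    trim φ k le = (λ t → proj₁ (Z t)) , (λ t → proj₁ (proj₂ (Z t))) , (λ t → proj₂ (proj₂ (Z t)))
      where Z = λ t → subcolours (φ t) (k t) (le t)

    -- Demands h relative to M: vertex v wants the fraction h v / M of the colours.
    record Colourable (M : ℕ) (h : Fin n → ℕ) : Set where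
      field
        c L : ℕ
        L≡ : L ≡ suc c * M
        φ : Family L
        proper : Proper φ
        cnt : ∀ v → ∣ φ v ∣ ≡ suc c * h v

    Colourable-zero : ∀ {M h} → (∀ v → h v ≡ 0) → Colourable M h
    Colourable-zero {M} h0 = record { c = 0 ; L = 1 * M ; L≡ = refl ; φ = λ _ → ∅ ; proper = λ _ _ _ _ ()
      ; cnt = λ v → trans ∣∅∣ (sym (trans (+-identityʳ _) (h0 v))) }

    Colourable-cong : ∀ {M M′ h h′} → M ≡ M′ → (∀ v → h v ≡ h′ v) → Colourable M h → Colourable M′ h′
    Colourable-cong refl e C = record { c = c ; L = L ; L≡ = L≡ ; φ = φ ; proper = proper
      ; cnt = λ v → trans (cnt v) (cong (suc c *_) (e v)) }
      where open Colourable C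

    -- The palettes are put side by side, each copied as often as the multiplier of the other says;
    -- both then have the product of the two multipliers.
    Colourable-+ : ∀ {M M′ h h′} → Colourable M h → Colourable M′ h′ → Colourable (M + M′) (λ v → h v + h′ v)
    Colourable-+ {M} {M′} {h} {h′} C C′ = record
      { c = B.c + A.c * suc B.c
      ; L = suc B.c * A.L + suc A.c * B.L
      ; L≡ = trans (cong₂ (λ x y → suc B.c * x + suc A.c * y) A.L≡ B.L≡) (mix A.c B.c M M′)
      ; φ = λ v → copies (suc B.c) (A.φ v) ⊕ copies (suc A.c) (B.φ v)
      ; proper = λ u v a → ⊕-⟂ {X = copies (suc B.c) (A.φ u)} {copies (suc B.c) (A.φ v)}
          (copies-⟂ (suc B.c) (A.proper u v a)) (copies-⟂ (suc A.c) (B.proper u v a))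
      ; cnt = λ v → trans (∣⊕∣ (copies (suc B.c) (A.φ v)) (copies (suc A.c) (B.φ v)))
          (trans (cong₂ _+_ (trans (∣copies∣ (suc B.c) (A.φ v)) (cong (suc B.c *_) (A.cnt v)))
                            (trans (∣copies∣ (suc A.c) (B.φ v)) (cong (suc A.c *_) (B.cnt v))))
                 (mix A.c B.c (h v) (h′ v))) }
      where
      module A = Colourable C
      module B = Colourable C′
      mix : ∀ a b x y → suc b * (suc a * x) + suc a * (suc b * y) ≡ suc (b + a * suc b) * (x + y)
      mix = solve-∀

    Colourable-* : ∀ {M h} w → Colourable M h → Colourable (w * M) (λ v → w * h v)
    Colourable-* {M} {h} w C = record
      { c = c ; L = w * L ; L≡ = trans (cong (w *_) L≡) (comm w c M)
      ; φ = λ v → copies w (φ v) ; proper = λ u v a → copies-⟂ w (proper u v a)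
      ; cnt = λ v → trans (∣copies∣ w (φ v)) (trans (cong (w *_) (cnt v)) (comm w c (h v))) }
      where
      open Colourable C
      comm : ∀ w c x → w * (suc c * x) ≡ suc c * (w * x)
      comm = solve-∀

    Colourable-∑ : ∀ {k} {M : Fin k → ℕ} {h : Fin k → Fin n → ℕ} → (∀ x → Colourable (M x) (h x)) →
      Colourable (∑ M) (λ v → ∑ (λ x → h x v))
    Colourable-∑ {zero} C = Colourable-zero (λ v → ∑-nil _)
    Colourable-∑ {suc k} C = Colourable-cong (sym (∑-suc _)) (λ v → sym (∑-suc _))
      (Colourable-+ (C zero) (Colourable-∑ (λ x → C (suc x))))

    -- The hypothesis is h′ v / M′ ≤ h v / M multiplied out. In `M′` copies of the palette every
    -- vertex has enough colours, and the excess is dropped.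
    Colourable-scale : ∀ {M M′ h h′} → 1 ≤ M → (∀ v → M * h′ v ≤ M′ * h v) → Colourable M h → Colourable M′ h′
    Colourable-scale {suc m} {M′} {h} {h′} _ le C = record
      { c = m + c * suc m ; L = M′ * L
      ; L≡ = trans (cong (M′ *_) L≡) (e c m M′)
      ; φ = proj₁ T ; proper = ⊆-proper (proj₁ (proj₂ T)) (λ u v a → copies-⟂ M′ (proper u v a))
      ; cnt = proj₂ (proj₂ T) }
      where
      open Colourable C
      e : ∀ c m M′ → M′ * (suc c * suc m) ≡ suc (m + c * suc m) * M′
      e = solve-∀
      T = trim (λ v → copies M′ (φ v)) (λ v → suc (m + c * suc m) * h′ v) λ v → begin
        suc (m + c * suc m) * h′ v ≡⟨ *-assoc (suc c) (suc m) (h′ v) ⟩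
        suc c * (suc m * h′ v) ≤⟨ *-monoʳ-≤ (suc c) (le v) ⟩
        suc c * (M′ * h v) ≡⟨ trans (sym (*-assoc (suc c) M′ _)) (trans (cong (_* h v) (*-comm (suc c) M′)) (*-assoc M′ (suc c) _)) ⟩
        M′ * (suc c * h v) ≡⟨ cong (M′ *_) (sym (cnt v)) ⟩
        M′ * ∣ φ v ∣ ≡⟨ sym (∣copies∣ M′ (φ v)) ⟩
        ∣ copies M′ (φ v) ∣ ∎
        where open ≤-Reasoning

  -- Inequalities between the nominal demands

  ≤-by : ∀ {x y} z → x + z ≡ y → x ≤ y
  ≤-by {x} z e = ≤-trans (m≤m+n x z) (≤-reflexive e)

  demand-mono : ∀ {M d d′ r r′} → suc d * r ≡ M → suc d′ * r′ ≡ M → d ≤ d′ → r′ ≤ r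
  demand-mono {M} {d} {d′} {r} {r′} e e′ le = *-cancelˡ-≤ (suc d) (begin
    suc d * r′ ≤⟨ *-monoˡ-≤ r′ (s≤s le) ⟩
    suc d′ * r′ ≡⟨ trans e′ (sym e) ⟩
    suc d * r ∎)
    where open ≤-Reasoning

  -- In the next lemmas v has degree 2 + δ and nominal demand r, and it is simplicial after a
  -- deletion, its closed neighbourhood then containing a simplicial and u other vertices; m is
  -- the demand of each of the simplicial ones.

  simplicial-share : ∀ {δ a u m r N} → u + a ≡ 2 + δ → (5 + 2 * δ) * r ≡ 2 * N → N ≤ a * m + u * r →
    (1 + 2 * a) * r ≤ 2 * a * m
  simplicial-share {δ} {a} {u} {m} {r} {N} ua e le = +-cancelʳ-≤ (2 * u * r) _ _ (begin
    (1 + 2 * a) * r + 2 * u * r ≡⟨ p a u r ⟩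
    (1 + 2 * (u + a)) * r ≡⟨ cong (λ x → (1 + 2 * x) * r) ua ⟩
    (1 + 2 * (2 + δ)) * r ≡⟨ cong (_* r) (p′ δ) ⟩
    (5 + 2 * δ) * r ≡⟨ e ⟩
    2 * N ≤⟨ *-monoʳ-≤ 2 le ⟩
    2 * (a * m + u * r) ≡⟨ p″ a u m r ⟩
    2 * a * m + 2 * u * r ∎)
    where
    open ≤-Reasoning
    p : ∀ a u r → (1 + 2 * a) * r + 2 * u * r ≡ (1 + 2 * (u + a)) * r
    p = solve-∀
    p′ : ∀ δ → 1 + 2 * (2 + δ) ≡ 5 + 2 * δ
    p′ = solve-∀
    p″ : ∀ a u m r → 2 * (a * m + u * r) ≡ 2 * a * m + 2 * u * r
    p″ = solve-∀

  -- `simplicial-share` says m ≥ (1 + 1/(2a)) r, and u ≥ 1 forces a ≤ 1 + δ. Full compensation for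
  -- the lost neighbour would be (3 + 2δ) m ≥ (5 + 2δ) r; what is missing is at most (1 + 2δ)/(2 +
  -- 2δ) of r.
  gain₁ : ∀ {δ a u m r N} → u + a ≡ 2 + δ → 1 ≤ a → 1 ≤ u → (5 + 2 * δ) * r ≡ 2 * N → N ≤ a * m + u * r →
    (3 + 2 * δ) * r ≤ (2 + 2 * δ) * m
  gain₁ {δ} {suc a} {suc u} {m} {r} {N} ua _ _ e le = begin
    (3 + 2 * δ) * r ≡⟨ cong (λ x → (3 + 2 * x) * r) δ≡ ⟩
    (3 + 2 * (u + a)) * r ≡⟨ p a u r ⟩
    (1 + 2 * suc a) * r + 2 * u * r ≤⟨ +-mono-≤ share (*-monoʳ-≤ (2 * u) r≤m) ⟩
    2 * suc a * m + 2 * u * m ≡⟨ p′ a u m ⟩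
    (2 + 2 * (u + a)) * m ≡⟨ cong (λ x → (2 + 2 * x) * m) (sym δ≡) ⟩
    (2 + 2 * δ) * m ∎
    where
    open ≤-Reasoning
    δ≡ : δ ≡ u + a
    δ≡ = suc-injective (suc-injective (sym (trans (cong suc (sym (+-suc u a))) ua)))
    share : (1 + 2 * suc a) * r ≤ 2 * suc a * m
    share = simplicial-share {δ} {suc a} {suc u} ua e le
    r≤m : r ≤ m
    r≤m = *-cancelˡ-≤ (2 * suc a) (≤-trans (*-monoˡ-≤ r (n≤1+n (2 * suc a))) share)
    p : ∀ a u r → (3 + 2 * (u + a)) * r ≡ (1 + 2 * suc a) * r + 2 * u * r
    p = solve-∀
    p′ : ∀ a u m → 2 * suc a * m + 2 * u * m ≡ (2 + 2 * (u + a)) * m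
    p′ = solve-∀

  -- The deficit left by `gain₁`, rounded up to r.
  gain₁′ : ∀ {δ m r} → (3 + 2 * δ) * r ≤ (2 + 2 * δ) * m → (3 + 2 * δ) * r + 2 * r ≤ (3 + 2 * δ) * m + r
  gain₁′ {δ} {m} {r} le = begin
    (3 + 2 * δ) * r + 2 * r ≡⟨ p δ r ⟩
    (3 + 2 * δ) * r + r + r ≤⟨ +-monoˡ-≤ r (+-mono-≤ le r≤m) ⟩
    (2 + 2 * δ) * m + m + r ≡⟨ p′ δ m r ⟩
    (3 + 2 * δ) * m + r ∎
    where
    open ≤-Reasoning
    r≤m : r ≤ m
    r≤m = *-cancelˡ-≤ (2 + 2 * δ) (≤-trans (*-monoˡ-≤ r (n≤1+n (2 + 2 * δ))) le)
    p : ∀ δ r → (3 + 2 * δ) * r + 2 * r ≡ (3 + 2 * δ) * r + r + r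
    p = solve-∀
    p′ : ∀ δ m r → (2 + 2 * δ) * m + m + r ≡ (3 + 2 * δ) * m + r
    p′ = solve-∀

  -- Two neighbours are lost at once, so the required increment is 4 r, and again a deficit of r is
  -- allowed. The other vertices of the clique take at most p each, hence m ≥ (1 + 1/(2a)) p with a
  -- ≤ 1 + δ.
  gain₂ : ∀ {δ a u m r p N} → u + a ≡ 1 + δ → 1 ≤ a → (5 + 2 * δ) * r ≡ 2 * N → (3 + 2 * δ) * p ≡ 2 * N →
    N ≤ a * m + u * p → (3 + 2 * δ) * r + 4 * r ≤ (3 + 2 * δ) * m + r
  gain₂ {δ} {suc a} {u} {m} {r} {p} {N} ua _ e e′ le = begin
    (3 + 2 * δ) * r + 4 * r ≡⟨ i₁ δ r ⟩
    (6 + 2 * δ) * r + r ≤⟨ +-monoˡ-≤ r main ⟩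
    (3 + 2 * δ) * m + r ∎
    where
    open ≤-Reasoning
    i₁ : ∀ δ r → (3 + 2 * δ) * r + 4 * r ≡ (6 + 2 * δ) * r + r
    i₁ = solve-∀
    i₂ : ∀ a u p → (1 + 2 * a) * p + 2 * u * p ≡ (1 + 2 * (u + a)) * p
    i₂ = solve-∀
    i₃ : ∀ δ → 1 + 2 * (1 + δ) ≡ 3 + 2 * δ
    i₃ = solve-∀
    i₄ : ∀ a u m p → 2 * (a * m + u * p) ≡ 2 * a * m + 2 * u * p
    i₄ = solve-∀
    share : (1 + 2 * suc a) * p ≤ 2 * suc a * m
    share = +-cancelʳ-≤ (2 * u * p) _ _ (begin
      (1 + 2 * suc a) * p + 2 * u * p ≡⟨ i₂ (suc a) u p ⟩
      (1 + 2 * (u + suc a)) * p ≡⟨ cong (λ x → (1 + 2 * x) * p) ua ⟩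
      (1 + 2 * (1 + δ)) * p ≡⟨ cong (_* p) (i₃ δ) ⟩
      (3 + 2 * δ) * p ≡⟨ e′ ⟩
      2 * N ≤⟨ *-monoʳ-≤ 2 le ⟩
      2 * (suc a * m + u * p) ≡⟨ i₄ (suc a) u m p ⟩
      2 * suc a * m + 2 * u * p ∎)
    i₅ : ∀ a u r → 2 * suc a * (6 + 2 * (u + a)) * r + (3 + 2 * u) * r ≡ (1 + 2 * suc a) * ((5 + 2 * (u + a)) * r)
    i₅ = solve-∀
    i₆ : ∀ a δ p → (1 + 2 * suc a) * ((3 + 2 * δ) * p) ≡ (3 + 2 * δ) * ((1 + 2 * suc a) * p)
    i₆ = solve-∀
    i₇ : ∀ a δ m → (3 + 2 * δ) * (2 * suc a * m) ≡ 2 * suc a * ((3 + 2 * δ) * m)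
    i₇ = solve-∀
    δ≡ : δ ≡ u + a
    δ≡ = suc-injective (trans (sym ua) (+-suc u a))
    main : (6 + 2 * δ) * r ≤ (3 + 2 * δ) * m
    main = *-cancelˡ-≤ (2 * suc a) (begin
      2 * suc a * ((6 + 2 * δ) * r) ≡⟨ sym (*-assoc (2 * suc a) (6 + 2 * δ) r) ⟩
      2 * suc a * (6 + 2 * δ) * r ≡⟨ cong (λ x → 2 * suc a * (6 + 2 * x) * r) δ≡ ⟩
      2 * suc a * (6 + 2 * (u + a)) * r ≤⟨ ≤-by ((3 + 2 * u) * r) (i₅ a u r) ⟩
      (1 + 2 * suc a) * ((5 + 2 * (u + a)) * r) ≡⟨ cong (λ x → (1 + 2 * suc a) * ((5 + 2 * x) * r)) (sym δ≡) ⟩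
      (1 + 2 * suc a) * ((5 + 2 * δ) * r) ≡⟨ cong ((1 + 2 * suc a) *_) (trans e (sym e′)) ⟩
      (1 + 2 * suc a) * ((3 + 2 * δ) * p) ≡⟨ i₆ a δ p ⟩
      (3 + 2 * δ) * ((1 + 2 * suc a) * p) ≤⟨ *-monoʳ-≤ (3 + 2 * δ) share ⟩
      (3 + 2 * δ) * (2 * suc a * m) ≡⟨ i₇ a δ m ⟩
      2 * suc a * ((3 + 2 * δ) * m) ∎)

  -- As gain₁, when one of the nonsimplicial vertices has a degree so large that its demand is
  -- at most p.
  gain-large : ∀ {δ a u m r p N} → u + suc a ≡ 2 + δ → 1 ≤ a → (5 + 2 * δ) * r ≡ 2 * N →
    (3 + 2 * (a + δ)) * p ≡ 2 * N → N ≤ a * m + (u * r + p) →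
    (9 + 14 * δ + 4 * (δ * δ)) * r ≤ (2 + 2 * δ) * ((3 + 2 * δ) * m)
  gain-large {δ} {suc b} {u} {m} {r} {p} {N} ua _ e e′ le with δ≡
    where
    δ≡ : δ ≡ u + b
    δ≡ = suc-injective (suc-injective (trans (sym ua) (trans (+-suc u (suc b)) (cong suc (+-suc u b)))))
  ... | refl = *-cancelˡ-≤ (2 * suc b * T) (begin
    2 * suc b * T * ((9 + 14 * (u + b) + 4 * ((u + b) * (u + b))) * r) ≤⟨ ≤-by _ (i₁ b u r) ⟩
    (2 + 2 * (u + b)) * ((3 + 2 * (u + b)) * (c₁ * r)) ≤⟨ *-monoʳ-≤ (2 + 2 * (u + b)) (*-monoʳ-≤ (3 + 2 * (u + b)) share) ⟩
    (2 + 2 * (u + b)) * ((3 + 2 * (u + b)) * (2 * suc b * T * m)) ≡⟨ i₂ b u T m ⟩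
    2 * suc b * T * ((2 + 2 * (u + b)) * ((3 + 2 * (u + b)) * m)) ∎)
    where
    open ≤-Reasoning
    -- `T` is the multiplier 3 + 2(a + δ) of `p`. Since `T * p` and (5 + 2δ) r are both 2N, `p` can
    -- be eliminated from `half`, and `c₁` = T (5 + 2b) - 2 (5 + 2(u + b)) remains.
    T = 5 + 4 * b + 2 * u
    c₁ = 15 + 26 * b + 8 * (b * b) + 6 * u + 4 * (b * u)
    i₁ : ∀ b u r → 2 * suc b * (5 + 4 * b + 2 * u) * ((9 + 14 * (u + b) + 4 * ((u + b) * (u + b))) * r)
      + (4 * b + 4 * (b * b) + 24 * (b * b * u) + 40 * (b * u) + 32 * (b * u * u) + 10 * u + 24 * (u * u) + 8 * (u * u * u)) * r
      ≡ (2 + 2 * (u + b)) * ((3 + 2 * (u + b)) * ((15 + 26 * b + 8 * (b * b) + 6 * u + 4 * (b * u)) * r))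
    i₁ = solve-∀
    i₂ : ∀ b u T m → (2 + 2 * (u + b)) * ((3 + 2 * (u + b)) * (2 * suc b * T * m)) ≡ 2 * suc b * T * ((2 + 2 * (u + b)) * ((3 + 2 * (u + b)) * m))
    i₂ = solve-∀
    j₁ : ∀ b u r → (5 + 2 * b) * r + 2 * u * r ≡ (5 + 2 * (u + b)) * r
    j₁ = solve-∀
    j₂ : ∀ b u m r p → 2 * (suc b * m + (u * r + p)) ≡ (2 * suc b * m + 2 * p) + 2 * u * r
    j₂ = solve-∀
    half : (5 + 2 * b) * r ≤ 2 * suc b * m + 2 * p
    half = +-cancelʳ-≤ (2 * u * r) _ _ (begin
      (5 + 2 * b) * r + 2 * u * r ≡⟨ trans (j₁ b u r) e ⟩
      2 * N ≤⟨ *-monoʳ-≤ 2 le ⟩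
      2 * (suc b * m + (u * r + p)) ≡⟨ j₂ b u m r p ⟩
      (2 * suc b * m + 2 * p) + 2 * u * r ∎)
    j₃ : ∀ b u r → (15 + 26 * b + 8 * (b * b) + 6 * u + 4 * (b * u)) * r + 2 * ((5 + 2 * (u + b)) * r) ≡ (5 + 4 * b + 2 * u) * ((5 + 2 * b) * r)
    j₃ = solve-∀
    j₄ : ∀ b T m p → T * (2 * suc b * m + 2 * p) ≡ 2 * suc b * T * m + 2 * (T * p)
    j₄ = solve-∀
    T≡ : ∀ b u → 5 + 4 * b + 2 * u ≡ 3 + 2 * (suc b + (u + b))
    T≡ = solve-∀
    share : c₁ * r ≤ 2 * suc b * T * m
    share = +-cancelʳ-≤ (2 * ((5 + 2 * (u + b)) * r)) _ _ (begin
      c₁ * r + 2 * ((5 + 2 * (u + b)) * r) ≡⟨ j₃ b u r ⟩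
      T * ((5 + 2 * b) * r) ≤⟨ *-monoʳ-≤ T half ⟩
      T * (2 * suc b * m + 2 * p) ≡⟨ j₄ b T m p ⟩
      2 * suc b * T * m + 2 * (T * p) ≡⟨ cong (λ x → 2 * suc b * T * m + 2 * x) (trans (trans (cong (_* p) (T≡ b u)) e′) (sym e)) ⟩
      2 * suc b * T * m + 2 * ((5 + 2 * (u + b)) * r) ∎)

  private
    -- The order 1 ≤ s ≤ t < D is built into the parameters. With the denominators cleared, the
    -- right side minus the left side then has only nonnegative coefficients.
    overlap-bound′ : ∀ s w e {A B F Y M} → let t = suc s + w ; D = 1 + t + e in
      (2 * (D + suc s) + 1) * A ≡ M → (2 * (D + t) + 1) * B ≡ M → (2 * (suc s + t) + 1) * F ≡ M → (2 * D + 1) * Y ≡ M →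
      2 * A + 2 * B ≤ F + 2 * Y
    overlap-bound′ s w e {A} {B} {F} {Y} {M} ea eb ef ey =
      *-cancelˡ-≤ (Pa * Pb * (Pf * Py)) (begin
        Pa * Pb * (Pf * Py) * (2 * A + 2 * B) ≡⟨ i₁ Pa Pb Pf Py A B ⟩
        2 * (Pb * Pf * Py) * (Pa * A) + 2 * (Pa * Pf * Py) * (Pb * B) ≡⟨ cong₂ (λ x y → 2 * (Pb * Pf * Py) * x + 2 * (Pa * Pf * Py) * y) ea eb ⟩
        2 * (Pb * Pf * Py) * M + 2 * (Pa * Pf * Py) * M ≤⟨ ≤-by _ (poly s w e M) ⟩
        Pa * Pb * Py * M + 2 * (Pa * Pb * Pf) * M ≡⟨ cong₂ (λ x y → Pa * Pb * Py * x + 2 * (Pa * Pb * Pf) * y) (sym ef) (sym ey) ⟩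
        Pa * Pb * Py * (Pf * F) + 2 * (Pa * Pb * Pf) * (Py * Y) ≡⟨ i₂ Pa Pb Pf Py F Y ⟩
        Pa * Pb * (Pf * Py) * (F + 2 * Y) ∎)
      where
      open ≤-Reasoning
      t = suc s + w
      D = 1 + t + e
      Pa = 2 * (D + suc s) + 1
      Pb = 2 * (D + t) + 1
      Pf = 2 * (suc s + t) + 1
      Py = 2 * D + 1
      i₁ : ∀ Pa Pb Pf Py A B → Pa * Pb * (Pf * Py) * (2 * A + 2 * B) ≡ 2 * (Pb * Pf * Py) * (Pa * A) + 2 * (Pa * Pf * Py) * (Pb * B)
      i₁ = solve-∀
      i₂ : ∀ Pa Pb Pf Py F Y → Pa * Pb * Py * (Pf * F) + 2 * (Pa * Pb * Pf) * (Py * Y) ≡ Pa * Pb * (Pf * Py) * (F + 2 * Y)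
      i₂ = solve-∀
      poly : ∀ s w e M → let t = suc s + w ; D = 1 + t + e ; Pa = 2 * (D + suc s) + 1 ; Pb = 2 * (D + t) + 1 ; Pf = 2 * (suc s + t) + 1 ; Py = 2 * D + 1 in
        2 * (Pb * Pf * Py) * M + 2 * (Pa * Pf * Py) * M
        + (35 + 38 * e + 36 * (e * e) + 8 * (e * e * e) + 8 * (e * e * s) + 16 * (e * e * w) + 8 * (e * s) + 8 * (e * s * w) + 40 * (e * w)
           + 8 * (e * w * w) + 90 * s + 96 * (s * s) + 32 * (s * s * s) + 48 * (s * s * w) + 100 * (s * w) + 16 * (s * w * w) + 64 * w + 20 * (w * w)) * M
        ≡ Pa * Pb * Py * M + 2 * (Pa * Pb * Pf) * M
      poly = solve-∀

  -- 1/(D+s+½) + 1/(D+t+½) ≤ ½ · 1/(s+t+½) + 1/(D+½), scaled by M / 2.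
  overlap-bound : ∀ {s t D A B F Y M} → 1 ≤ s → 1 ≤ t → s < D → t < D →
    (2 * (D + s) + 1) * A ≡ M → (2 * (D + t) + 1) * B ≡ M → (2 * (s + t) + 1) * F ≡ M → (2 * D + 1) * Y ≡ M →
    2 * A + 2 * B ≤ F + 2 * Y
  overlap-bound {suc s} {suc t} {D} {A} {B} {F} {Y} {M} _ _ s< t< ea eb ef ey with ≤-total s t
  ... | inj₁ s≤t with m≤n⇒∃[o]m+o≡n s≤t | m≤n⇒∃[o]m+o≡n t<
  ...   | w , refl | e , refl = overlap-bound′ s w e {A} {B} {F} {Y} ea eb ef ey
  overlap-bound {suc s} {suc t} {D} {A} {B} {F} {Y} {M} _ _ s< t< ea eb ef ey | inj₂ t≤s
    with m≤n⇒∃[o]m+o≡n t≤s | m≤n⇒∃[o]m+o≡n s<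
  ... | w , refl | e , refl = ≤-trans (≤-reflexive (+-comm (2 * A) (2 * B)))
    (overlap-bound′ t w e {B} {A} {F} {Y} eb ea (trans (cong (λ x → (2 * x + 1) * F) (+-comm (suc t) (suc t + w))) ef) ey)

  suc∣! : ∀ {k n} → suc k ≤ n → suc k ∣ n !
  suc∣! {k} le = ∣-trans (m∣m*n (k !)) (m≤n⇒m!∣n! le)

  -- A common denominator and the nominal demands

  module Nominal (n : ℕ) where

    abstract
      -- `N₀` is divisible by every odd number 2d + 1 < 2n, the denominators of the bounds 1/(d +
      -- 1/2), and `Q` by every possible number of simplicial vertices that share the rest of a
      -- clique. In the unit `Q * N₀` all demands are integers.
      N₀ Q : ℕ
      N₀ = (2 * n) !
      Q = n !

      -- ρ₀ D / N₀ = 2 / (2D - 1), the bound 1/(d + 1/2) in terms of the closed degree D = d + 1.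
      ρ₀ share : ℕ → ℕ
      ρ₀ zero = 0
      ρ₀ (suc d) = 2 * (N₀ / suc (2 * d))
      share zero = 0
      share (suc a) = Q / suc a

      share-spec : ∀ {a} → 1 ≤ a → a ≤ n → a * share a ≡ Q
      share-spec {suc a} _ le = m*[n/m]≡n (suc∣! le)

      ρ₀-spec : ∀ {d} → suc d ≤ n → suc (2 * d) * ρ₀ (suc d) ≡ 2 * N₀
      ρ₀-spec {d} le = trans (e (suc (2 * d)) (N₀ / suc (2 * d)))
        (cong (2 *_) (m*[n/m]≡n (suc∣! (≤-trans (≤-trans (n≤1+n _) (≤-reflexive (e′ d))) (*-monoʳ-≤ 2 le)))))
        where
        e : ∀ x y → x * (2 * y) ≡ 2 * (x * y)
        e = solve-∀
        e′ : ∀ d → suc (suc (2 * d)) ≡ 2 * suc d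
        e′ = solve-∀

      1≤Q*N₀ : 1 ≤ Q * N₀
      1≤Q*N₀ = *-mono-≤ (1≤n! n) (1≤n! (2 * n))

    N : ℕ
    N = Q * N₀

    ρ : ℕ → ℕ
    ρ D = Q * ρ₀ D

    ρ-spec : ∀ {d} → suc d ≤ n → suc (2 * d) * ρ (suc d) ≡ 2 * N
    ρ-spec {d} le = trans (e (suc (2 * d)) Q _) (trans (cong (Q *_) (ρ₀-spec le)) (e Q 2 N₀))
      where
      e : ∀ x y z → x * (y * z) ≡ y * (x * z)
      e = solve-∀

    ρ₀-anti : ∀ {d d′} → suc d ≤ suc d′ → suc d′ ≤ n → ρ₀ (suc d′) ≤ ρ₀ (suc d)
    ρ₀-anti le le′ = demand-mono (ρ₀-spec (≤-trans le le′)) (ρ₀-spec le′) (*-monoʳ-≤ 2 (≤-pred le))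

    ρ₀-le : ∀ {x y} → x < y → y ≤ n → ρ₀ y ≤ ρ₀ (suc x)
    ρ₀-le {x} {suc y} lt le = ρ₀-anti lt le

    ρ-anti : ∀ {D D′} → 1 ≤ D → D ≤ D′ → D′ ≤ n → ρ D′ ≤ ρ D
    ρ-anti {suc d} {suc d′} _ le le′ = *-monoʳ-≤ Q (ρ₀-anti le le′)

  -- Induced subgraphs, valid demands and the induction

  module Graphs {n : ℕ} (G : SimpleGraph n) where

    open Colourings G public
    open Nominal n public

    -- Closed adjacency spares the case of equal vertices: neighbourhoods become closed, and a
    -- clique is a set on which `E` is total.
    E : Fin n → Fin n → Set
    E u v = u ≡ v ⊎ Adj u v

    E? : ∀ u v → Dec (E u v)
    E? u v = (u ≟F v) ⊎-dec Adj? u v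

    E-refl : ∀ {u} → E u u
    E-refl = inj₁ refl

    E-sym : ∀ {u v} → E u v → E v u
    E-sym (inj₁ e) = inj₁ (sym e)
    E-sym (inj₂ a) = inj₂ (Adj-sym a)

    record Sub : Set₁ where
      no-eta-equality
      field
        In : Fin n → Set
        in? : ∀ v → Dec (In v)
    open Sub public

    size : Sub → ℕ
    size S = # (in? S)

    near? : ∀ S v u → Dec (In S u × E v u)
    near? S v u = in? S u ×-dec E? v u

    -- The closed degree of v in S.
    D : Sub → Fin n → ℕ
    D S v = # (near? S v)

    Simplicial : Sub → Fin n → Set
    Simplicial S v = ∀ u w → In S u → In S w → E v u → E v w → E u w

    Simplicial? : ∀ S v → Dec (Simplicial S v)
    Simplicial? S v = all? λ u → all? λ w → in? S u →-dec in? S w →-dec E? v u →-dec E? v w →-dec E? u w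

    ¬Simplicial : ∀ S v → ¬ Simplicial S v →
      ∃ λ y → ∃ λ z → In S y × In S z × E v y × E v z × ¬ E y z
    ¬Simplicial S v ¬s with any? (λ y → any? λ z → in? S y ×-dec in? S z ×-dec E? v y ×-dec E? v z ×-dec ¬? (E? y z))
    ... | yes p = p
    ... | no ¬p = contradiction (λ u w Su Sw vu vw → decidable-stable (E? u w) λ ¬uw → ¬p (u , w , Su , Sw , vu , vw , ¬uw)) ¬s

    _⊑_ : Sub → Sub → Set
    S ⊑ T = ∀ v → In S v → In T v

    Simplicial-⊑ : ∀ {S T v} → S ⊑ T → Simplicial T v → Simplicial S v
    Simplicial-⊑ s p u w Su Sw = p u w (s u Su) (s w Sw)

    D-⊑ : ∀ {S T} → S ⊑ T → ∀ v → D S v ≤ D T v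
    D-⊑ {S} {T} s v = #-mono (near? S v) (near? T v) λ u (Su , e) → s u Su , e

    1≤D : ∀ {S v} → In S v → 1 ≤ D S v
    1≤D {S} {v} Sv = #-pos (near? S v) v (Sv , E-refl)

    D≤n : ∀ S v → D S v ≤ n
    D≤n S v = #≤n (near? S v)

    Clique : Sub → Set
    Clique K = ∀ u w → In K u → In K w → E u w

    total : Sub → (Fin n → ℕ) → ℕ
    total K h = ∑ (λ v → ⟨ in? K v ⟩ * h v)

    -- With the closed degree D = d + 1, the bound h v / M ≤ 1/(d + 1/2) reads (2D - 1) h v ≤ 2M;
    -- `nonsimplicial` is this without subtraction.
    record Valid (S : Sub) (M : ℕ) (h : Fin n → ℕ) : Set₁ where
      field
        outside : ∀ v → ¬ In S v → h v ≡ 0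
        nonsimplicial : ∀ v → In S v → ¬ Simplicial S v → 2 * (D S v * h v) ≤ 2 * M + h v
        cliques : ∀ K → K ⊑ S → Clique K → total K h ≤ M

    nominal : Sub → Fin n → ℕ
    nominal S v = ⟨ in? S v ⟩ * ρ (D S v)

    nominal-in : ∀ {S v} → In S v → nominal S v ≡ ρ (D S v)
    nominal-in {S} {v} Sv = trans (cong (_* ρ (D S v)) (⟨⟩-yes (in? S v) Sv)) (*-identityˡ _)

    ρ-spec′ : ∀ {S v} → In S v → 2 * (D S v * ρ (D S v)) ≡ 2 * N + ρ (D S v)
    ρ-spec′ {S} {v} Sv with D S v | 1≤D {S} Sv | D≤n S v
    ... | suc d | _ | le = trans (e d (ρ (suc d))) (cong (_+ ρ (suc d)) (ρ-spec le))
      where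
      e : ∀ d r → 2 * (suc d * r) ≡ suc (2 * d) * r + r
      e = solve-∀

    without : Sub → Fin n → Sub
    without S v = record { In = λ t → In S t × t ≢ v ; in? = λ t → in? S t ×-dec ¬? (t ≟F v) }

    size-without : ∀ S v → In S v → size (without S v) < size S
    size-without S v Sv = #-strict (in? (without S v)) (in? S) (λ _ → proj₁) v Sv (λ p → proj₂ p refl)

    -- A simplicial vertex can be coloured last.
    simplicial-step : ∀ {S M h v} → In S v → Simplicial S v → Valid S M h →
      (∀ h′ → Valid (without S v) M h′ → Colourable M h′) → Colourable M h
    simplicial-step {S} {M} {h} {v} Sv simp val IH = record
      { c = c ; L = L ; L≡ = L≡ ; φ = Sat.ψ ; proper = Sat.proper ; cnt = cnt′ }
      where
      open Valid val
      S′ = without S v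
      h′ : Fin n → ℕ
      h′ t = ⟨ ¬? (t ≟F v) ⟩ * h t
      h′≤h : ∀ t → h′ t ≤ h t
      h′≤h t = ≤-trans (*-monoˡ-≤ (h t) (⟨⟩≤1 (¬? (t ≟F v)))) (≤-reflexive (*-identityˡ _))
      h′≡h : ∀ t → t ≢ v → h′ t ≡ h t
      h′≡h t ne = trans (cong (_* h t) (⟨⟩-yes (¬? (t ≟F v)) ne)) (*-identityˡ _)
      C = IH h′ record
        { outside = λ t ¬St → case t ¬St (t ≟F v)
        ; nonsimplicial = λ t (St , ne) ¬s → subst (λ x → 2 * (D S′ t * x) ≤ 2 * M + x) (sym (h′≡h t ne))
            (≤-trans (*-monoʳ-≤ 2 (*-monoˡ-≤ (h t) (D-⊑ {S′} {S} (λ _ → proj₁) t)))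
              (nonsimplicial t St (λ s → ¬s (Simplicial-⊑ {S′} {S} (λ _ → proj₁) s))))
        ; cliques = λ K K⊑ cl → ≤-trans (∑-mono λ t → *-monoʳ-≤ ⟨ in? K t ⟩ (h′≤h t)) (cliques K (λ t Kt → proj₁ (K⊑ t Kt)) cl) }
        where
        case : ∀ t → ¬ In S′ t → Dec (t ≡ v) → h′ t ≡ 0
        case t ¬St (yes e) = cong (_* h t) (⟨⟩-no (¬? (t ≟F v)) (λ ne → ne e))
        case t ¬St (no ne) = trans (h′≡h t ne) (outside t λ St → ¬St (St , ne))
      open Colourable C using (c; L; L≡; φ; proper; cnt)
      k : Fin n → ℕ
      k t = suc c * h t
      K : Sub
      K = record { In = λ t → In S t × E v t ; in? = near? S v }
      nbhd : h v + load h v ≤ M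
      nbhd = begin
        h v + load h v ≡⟨ cong (_+ load h v) (sym (∑-point v h)) ⟩
        ∑ (λ t → ⟨ t ≟F v ⟩ * h t) + load h v ≡⟨ sym (∑-+ _ _) ⟩
        ∑ (λ t → ⟨ t ≟F v ⟩ * h t + ⟨ Adj? v t ⟩ * h t) ≤⟨ ∑-mono pt ⟩
        total K h ≤⟨ cliques K (λ _ → proj₁) (λ u w (Su , vu) (Sw , vw) → simp u w Su Sw vu vw) ⟩
        M ∎
        where
        open ≤-Reasoning
        pt : ∀ t → ⟨ t ≟F v ⟩ * h t + ⟨ Adj? v t ⟩ * h t ≤ ⟨ near? S v t ⟩ * h t
        pt t with in? S t
        ... | no ¬St = ≤-trans (≤-reflexive (trans (sym (*-distribʳ-+ (h t) ⟨ t ≟F v ⟩ ⟨ Adj? v t ⟩))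
              (trans (cong ((⟨ t ≟F v ⟩ + ⟨ Adj? v t ⟩) *_) (outside t ¬St)) (*-zeroʳ (⟨ t ≟F v ⟩ + ⟨ Adj? v t ⟩))))) z≤n
        ... | yes St = ≤-trans (≤-reflexive (sym (*-distribʳ-+ (h t) ⟨ t ≟F v ⟩ ⟨ Adj? v t ⟩)))
              (*-monoˡ-≤ (h t) (⟨⟩-disj (t ≟F v) (Adj? v t) (yes St ×-dec E? v t) (λ { refl → St , E-refl }) (λ a → St , inj₂ a)
                λ { refl a → Adj-irr a }))
      room : ∀ u → u ≡ v → k u + load k u ≤ L
      room u refl = begin
        suc c * h u + ∑ (λ t → ⟨ Adj? u t ⟩ * (suc c * h t)) ≡⟨ cong (suc c * h u +_) (trans (∑-cong (λ t → x*yz ⟨ Adj? u t ⟩ (suc c) (h t))) (∑-*ˡ (suc c) _)) ⟩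
        suc c * h u + suc c * load h u ≡⟨ sym (*-distribˡ-+ (suc c) (h u) _) ⟩
        suc c * (h u + load h u) ≤⟨ *-monoʳ-≤ (suc c) nbhd ⟩
        suc c * M ≡⟨ sym L≡ ⟩
        L ∎
        where
        open ≤-Reasoning
        x*yz : ∀ x y z → x * (y * z) ≡ y * (x * z)
        x*yz = solve-∀
      module Sat = Saturation (saturate φ k (_≟F v) proper (λ t → ≤-trans (≤-reflexive (cnt t)) (*-monoʳ-≤ (suc c) (h′≤h t))) room)
      cnt′ : ∀ t → ∣ Sat.ψ t ∣ ≡ suc c * h t
      cnt′ t = go (t ≟F v)
        where
        go : Dec (t ≡ v) → ∣ Sat.ψ t ∣ ≡ suc c * h t
        go (yes refl) = Sat.exact t refl refl
        go (no ne) = trans (cong ∣_∣ (Sat.unchanged t ne)) (trans (cnt t) (cong (suc c *_) (h′≡h t ne)))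

    NonSimplicial : Sub → Set
    NonSimplicial S = ∀ v → In S v → ¬ Simplicial S v

    Hypothesis : Sub → Set₁
    Hypothesis S = ∀ S′ → size S′ < size S → ∀ h → Valid S′ N h → Colourable N h

    -- Without simplicial vertices the degree bound holds everywhere, so h / M lies below the
    -- nominal fraction and a nominal colouring only has to be trimmed.
    from-nominal : ∀ {S M h} → NonSimplicial S → Valid S M h → Colourable N (nominal S) → Colourable M h
    from-nominal {S} {M} {h} ns val = Colourable-scale 1≤Q*N₀ le
      where
      open Valid val
      le : ∀ v → N * h v ≤ M * nominal S v
      le v with in? S v
      ... | no ¬Sv = ≤-trans (≤-reflexive (trans (cong (N *_) (outside v ¬Sv)) (*-zeroʳ N))) z≤n
      ... | yes Sv with D S v | 1≤D {S} Sv | D≤n S v | nonsimplicial v Sv (ns v Sv)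
      ...   | suc d | _ | D≤ | bd = *-cancelˡ-≤ (suc (2 * d)) (begin
        suc (2 * d) * (N * h v) ≡⟨ e₁ d N (h v) ⟩
        N * (suc (2 * d) * h v) ≤⟨ *-monoʳ-≤ N (+-cancelʳ-≤ (h v) _ _ (≤-trans (≤-reflexive (e₂ d (h v))) bd)) ⟩
        N * (2 * M) ≡⟨ e₃ N M ⟩
        M * (2 * N) ≡⟨ cong (M *_) (sym (ρ-spec D≤)) ⟩
        M * (suc (2 * d) * ρ (suc d)) ≡⟨ e₄ M (suc (2 * d)) (ρ (suc d)) ⟩
        suc (2 * d) * (M * (1 * ρ (suc d))) ∎)
        where
        open ≤-Reasoning
        e₁ : ∀ d N x → suc (2 * d) * (N * x) ≡ N * (suc (2 * d) * x)
        e₁ = solve-∀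
        e₂ : ∀ d x → suc (2 * d) * x + x ≡ 2 * (suc d * x)
        e₂ = solve-∀
        e₃ : ∀ N M → N * (2 * M) ≡ M * (2 * N)
        e₃ = solve-∀
        e₄ : ∀ M x y → M * (x * y) ≡ x * (M * (1 * y))
        e₄ = solve-∀

    main-induction : (∀ S v → In S v → NonSimplicial S → Hypothesis S → Colourable N (nominal S)) →
      ∀ k S → size S ≤ k → ∀ {M h} → Valid S M h → Colourable M h
    main-induction core k S le {M} {h} val with any? (λ v → in? S v ×-dec Simplicial? S v)
    main-induction core zero S le val | yes (v , Sv , _) = contradiction (≤-trans (#-pos (in? S) v Sv) le) λ ()
    main-induction core (suc k) S le val | yes (v , Sv , simp) = simplicial-step Sv simp val
      λ h′ → main-induction core k (without S v) (≤-pred (≤-trans (size-without S v Sv) le))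
    main-induction core k S le val | no ¬s with any? (in? S)
    ... | no ¬v = Colourable-zero λ v → Valid.outside val v λ Sv → ¬v (v , Sv)
    main-induction core zero S le val | no ¬s | yes (v , Sv) = contradiction (≤-trans (#-pos (in? S) v Sv) le) λ ()
    main-induction core (suc k) S le val | no ¬s | yes (v , Sv) = from-nominal {S} ns val
      (core S v Sv ns λ S′ lt h → main-induction core k S′ (≤-pred (≤-trans lt le)))
      where
      ns : NonSimplicial S
      ns u Su simp = ¬s (u , Su , simp)

  #-split : ∀ {n} {P R : Fin n → Set} (P? : ∀ i → Dec (P i)) (R? : ∀ i → Dec (R i)) →
    # P? ≡ # (λ i → P? i ×-dec R? i) + # (λ i → P? i ×-dec ¬? (R? i))
  #-split P? R? = ≤-antisym
    (#-cover (λ i → P? i ×-dec R? i) (λ i → P? i ×-dec ¬? (R? i)) P? case)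
    (#-disj (λ i → P? i ×-dec R? i) (λ i → P? i ×-dec ¬? (R? i)) P? (λ _ → proj₁) (λ _ → proj₁) λ _ p q → proj₂ q (proj₂ p))
    where
    case : ∀ i → _ → _
    case i p with R? i
    ... | yes r = inj₁ (p , r)
    ... | no ¬r = inj₂ (p , ¬r)

  -- The demands given to the vertices of a proper subset X

  module Demands {n : ℕ} (G : SimpleGraph n) where

    open Graphs G public

    simp? : ∀ X v t → Dec ((In X t × E v t) × Simplicial X t)
    simp? X v t = near? X v t ×-dec Simplicial? X t

    other? : ∀ X v t → Dec ((In X t × E v t) × ¬ Simplicial X t)
    other? X v t = near? X v t ×-dec ¬? (Simplicial? X t)

    -- At a simplicial v, `simps` counts v too. `rest` is measured in the unit `N₀`: the factor `Q`
    -- is kept back for the division in `share`.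
    simps others rest : Sub → Fin n → ℕ
    simps X v = # (simp? X v)
    others X v = # (other? X v)
    rest X v = ∑ (λ t → ⟨ other? X v t ⟩ * ρ₀ (D X t))

    -- A nonsimplicial vertex gets its nominal demand, and the simplicial vertices of a maximal
    -- clique share equally what is left of it.
    demand′ : ∀ X v → Dec (In X v) → Dec (Simplicial X v) → ℕ
    demand′ X v (no _) _ = 0
    demand′ X v (yes _) (yes _) = share (simps X v) * (N₀ ∸ rest X v)
    demand′ X v (yes _) (no _) = ρ (D X v)

    abstract
      demand : Sub → Fin n → ℕ
      demand X v = demand′ X v (in? X v) (Simplicial? X v)

      demand-out : ∀ X v → ¬ In X v → demand X v ≡ 0
      demand-out X v ¬Xv with in? X v
      ... | yes Xv = contradiction Xv ¬Xv
      ... | no _ = refl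

      demand-simp : ∀ X v → In X v → Simplicial X v → demand X v ≡ share (simps X v) * (N₀ ∸ rest X v)
      demand-simp X v Xv s with in? X v | Simplicial? X v
      ... | no ¬Xv | _ = contradiction Xv ¬Xv
      ... | yes _ | no ¬s = contradiction s ¬s
      ... | yes _ | yes _ = refl

      demand-other : ∀ X v → In X v → ¬ Simplicial X v → demand X v ≡ ρ (D X v)
      demand-other X v Xv ¬s with in? X v | Simplicial? X v
      ... | no ¬Xv | _ = contradiction Xv ¬Xv
      ... | yes _ | no _ = refl
      ... | yes _ | yes s = contradiction s ¬s

    module _ {X : Sub} {v : Fin n} (Xv : In X v) (s : Simplicial X v) where

      D-split : D X v ≡ simps X v + others X v
      D-split = #-split (near? X v) (Simplicial? X)

      1≤simps : 1 ≤ simps X v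
      1≤simps = #-pos (simp? X v) v ((Xv , E-refl) , s)

      -- The closed neighbourhood of v is a clique, so that of t contains it; of two nonadjacent
      -- vertices near t, at least one is not near v.
      D-other : ∀ {t} → In X t → E v t → ¬ Simplicial X t → D X v < D X t
      D-other {t} Xt vt ¬s with ¬Simplicial X t ¬s
      ... | y , z , Xy , Xz , ty , tz , ¬yz = go (E? v y) (E? v z)
        where
        lt : ∀ w → In X w → E t w → ¬ E v w → D X v < D X t
        lt w Xw tw ¬vw = #-strict (near? X v) (near? X t) (λ u (Xu , vu) → Xu , s t u Xt Xu vt vu) w (Xw , tw) (λ p → ¬vw (proj₂ p))
        go : Dec (E v y) → Dec (E v z) → D X v < D X t
        go (yes vy) (yes vz) = contradiction (s y z Xy Xz vy vz) ¬yz
        go (no ¬vy) _ = lt y Xy ty ¬vy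
        go (yes _) (no ¬vz) = lt z Xz tz ¬vz

      rest≤ : rest X v ≤ others X v * ρ₀ (suc (D X v))
      rest≤ = ≤-trans (∑-mono λ t → ⟨⟩-case (other? X v t) λ ((Xt , vt) , ¬s) → ρ₀-le (D-other Xt vt ¬s) (D≤n X t))
        (≤-reflexive (∑-*ʳ (ρ₀ (suc (D X v))) _))

      -- This makes the truncated subtraction in `demand′` exact. There are at most D other
      -- vertices, all of closed degree above D, and together they take at most 2D/(2D + 1) of the
      -- unit.
      rest≤N₀ : rest X v ≤ N₀
      rest≤N₀ with any? (other? X v)
      ... | no ¬o = ≤-trans (≤-reflexive (∑-zero λ t → cong (_* ρ₀ (D X t)) (⟨⟩-no (other? X v t) λ o → ¬o (t , o)))) z≤n
      ... | yes (t , (Xt , vt) , ¬s) = *-cancelˡ-≤ 2 (begin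
        2 * rest X v ≤⟨ *-monoʳ-≤ 2 rest≤ ⟩
        2 * (others X v * ρ₀ (suc (D X v))) ≤⟨ *-monoʳ-≤ 2 (*-monoˡ-≤ (ρ₀ (suc (D X v))) (≤-trans (m≤n+m _ (simps X v)) (≤-reflexive (sym D-split)))) ⟩
        2 * (D X v * ρ₀ (suc (D X v))) ≤⟨ ≤-by (ρ₀ (suc (D X v))) (e (D X v) (ρ₀ (suc (D X v)))) ⟩
        suc (2 * D X v) * ρ₀ (suc (D X v)) ≡⟨ ρ₀-spec (≤-trans (D-other Xt vt ¬s) (D≤n X t)) ⟩
        2 * N₀ ∎)
        where
        open ≤-Reasoning
        e : ∀ x r → 2 * (x * r) + r ≡ suc (2 * x) * r
        e = solve-∀

      demand-sum : simps X v * demand X v + Q * rest X v ≡ N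
      demand-sum rewrite demand-simp X v Xv s = trans
        (cong (_+ Q * rest X v) (trans (sym (*-assoc (simps X v) (share (simps X v)) _))
          (cong (_* (N₀ ∸ rest X v)) (share-spec 1≤simps (#≤n (simp? X v))))))
        (trans (sym (*-distribˡ-+ Q (N₀ ∸ rest X v) (rest X v))) (cong (Q *_) (m∸n+n≡m rest≤N₀)))

      demand-lower : N ≤ simps X v * demand X v + others X v * ρ (suc (D X v))
      demand-lower = ≤-trans (≤-reflexive (sym demand-sum)) (+-monoʳ-≤ (simps X v * demand X v)
        (≤-trans (*-monoʳ-≤ Q rest≤) (≤-reflexive (e Q (others X v) _))))
        where
        e : ∀ x y z → x * (y * z) ≡ y * (x * z)
        e = solve-∀

      demand-lower′ : ∀ {z u} → In X z → E v z → ¬ Simplicial X z → others X v ≡ suc u →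
        N ≤ simps X v * demand X v + (u * ρ (suc (D X v)) + ρ (D X z))
      demand-lower′ {z} {u} Xz vz ¬sz o≡ = ≤-trans (≤-reflexive (sym demand-sum)) (+-monoʳ-≤ (simps X v * demand X v)
        (≤-trans (*-monoʳ-≤ Q rest≤′) (≤-reflexive (e Q u (ρ₀ (suc (D X v))) (ρ₀ (D X z))))))
        where
        e : ∀ q u x y → q * (u * x + y) ≡ u * (q * x) + q * y
        e = solve-∀
        r? = λ t → other? X v t ×-dec ¬? (t ≟F z)
        count : # r? ≤ u
        count = ≤-pred (≤-trans (#-strict r? (other? X v) (λ _ → proj₁) z ((Xz , vz) , ¬sz) (λ p → proj₂ p refl)) (≤-reflexive o≡))
        pt : ∀ t → ⟨ other? X v t ⟩ * ρ₀ (D X t) ≤ ⟨ r? t ⟩ * ρ₀ (suc (D X v)) + ⟨ t ≟F z ⟩ * ρ₀ (D X t)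
        pt t = go (other? X v t) (t ≟F z)
          where
          go : ∀ (o? : Dec ((In X t × E v t) × ¬ Simplicial X t)) (e? : Dec (t ≡ z)) → ⟨ o? ⟩ * ρ₀ (D X t) ≤ ⟨ o? ×-dec ¬? e? ⟩ * ρ₀ (suc (D X v)) + ⟨ e? ⟩ * ρ₀ (D X t)
          go (no _) e? = z≤n
          go (yes _) (yes _) = ≤-refl
          go (yes ((Xt , vt) , ¬s)) (no _) = ≤-trans (*-monoʳ-≤ 1 (ρ₀-le (D-other Xt vt ¬s) (D≤n X t))) (m≤m+n _ _)
        rest≤′ : rest X v ≤ u * ρ₀ (suc (D X v)) + ρ₀ (D X z)
        rest≤′ = begin
          rest X v ≤⟨ ∑-mono pt ⟩
          ∑ (λ t → ⟨ r? t ⟩ * ρ₀ (suc (D X v)) + ⟨ t ≟F z ⟩ * ρ₀ (D X t)) ≡⟨ ∑-+ _ _ ⟩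
          ∑ (λ t → ⟨ r? t ⟩ * ρ₀ (suc (D X v))) + ∑ (λ t → ⟨ t ≟F z ⟩ * ρ₀ (D X t)) ≡⟨ cong₂ _+_ (∑-*ʳ _ _) (∑-point z _) ⟩
          # r? * ρ₀ (suc (D X v)) + ρ₀ (D X z) ≤⟨ +-monoˡ-≤ _ (*-monoˡ-≤ _ count) ⟩
          u * ρ₀ (suc (D X v)) + ρ₀ (D X z) ∎
          where open ≤-Reasoning

      -- Adjacent simplicial vertices have the same closed neighbourhood, hence the same counts.
      demand-twin : ∀ {t} → In X t → E v t → Simplicial X t → demand X t ≡ demand X v
      demand-twin {t} Xt vt st = trans (demand-simp X t Xt st) (trans
        (cong₂ (λ a b → share a * (N₀ ∸ b))
          (#-cong (simp? X t) (simp? X v) (λ u → λ { ((Xu , tu) , p) → (Xu , to Xu tu) , p }) (λ u → λ { ((Xu , vu) , p) → (Xu , from Xu vu) , p }))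
          (∑-cong (λ u → cong (_* ρ₀ (D X u)) (⟨⟩-cong (other? X t u) (other? X v u)
            (λ { ((Xu , tu) , p) → (Xu , to Xu tu) , p }) (λ { ((Xu , vu) , p) → (Xu , from Xu vu) , p })))))
        (sym (demand-simp X v Xv s)))
        where
        to : ∀ {u} → In X u → E t u → E v u
        to {u} Xu tu = st v u Xv Xu (E-sym vt) tu
        from : ∀ {u} → In X u → E v u → E t u
        from {u} Xu vu = s t u Xt Xu vt vu

      clique-with-simplicial : ∀ K → K ⊑ X → Clique K → In K v → total K (demand X) ≤ N
      clique-with-simplicial K K⊑ cl Kv = begin
        total K (demand X) ≤⟨ ∑-mono pt ⟩
        ∑ (λ t → ⟨ simp? X v t ⟩ * demand X v + Q * (⟨ other? X v t ⟩ * ρ₀ (D X t))) ≡⟨ ∑-+ _ _ ⟩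
        ∑ (λ t → ⟨ simp? X v t ⟩ * demand X v) + ∑ (λ t → Q * (⟨ other? X v t ⟩ * ρ₀ (D X t))) ≡⟨ cong₂ _+_ (∑-*ʳ _ _) (∑-*ˡ Q _) ⟩
        simps X v * demand X v + Q * rest X v ≡⟨ demand-sum ⟩
        N ∎
        where
        open ≤-Reasoning
        e : ∀ x y → x * y ≡ x * (1 * y)
        e = solve-∀
        pt : ∀ t → ⟨ in? K t ⟩ * demand X t ≤ ⟨ simp? X v t ⟩ * demand X v + Q * (⟨ other? X v t ⟩ * ρ₀ (D X t))
        pt t = go (in? K t) (Simplicial? X t)
          where
          go : (k? : Dec (In K t)) → Dec (Simplicial X t) → ⟨ k? ⟩ * demand X t ≤ ⟨ simp? X v t ⟩ * demand X v + Q * (⟨ other? X v t ⟩ * ρ₀ (D X t))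
          go (no _) _ = z≤n
          go (yes Kt) (yes st) = ≤-trans (≤-reflexive (cong₂ _*_ {1} (sym (⟨⟩-yes (simp? X v t) ((K⊑ t Kt , cl v t Kv Kt) , st))) (demand-twin (K⊑ t Kt) (cl v t Kv Kt) st))) (m≤m+n _ _)
          go (yes Kt) (no ¬st) = ≤-trans (≤-reflexive (trans (*-identityˡ _) (trans (demand-other X t (K⊑ t Kt) ¬st)
            (trans (e Q (ρ₀ (D X t))) (cong (λ x → Q * (x * ρ₀ (D X t))) (sym (⟨⟩-yes (other? X v t) ((K⊑ t Kt , cl v t Kv Kt) , ¬st))))))))
            (m≤n+m _ (⟨ simp? X v t ⟩ * demand X v))

    κρ≤N : ∀ κ → suc κ ≤ n → κ * ρ (suc κ) ≤ N
    κρ≤N κ le = *-cancelˡ-≤ 2 (≤-trans (≤-by (ρ (suc κ)) (e κ (ρ (suc κ)))) (≤-reflexive (ρ-spec le)))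
      where
      e : ∀ κ r → 2 * (κ * r) + r ≡ suc (2 * κ) * r
      e = solve-∀

    D-clique : ∀ {X} K → K ⊑ X → Clique K → ∀ {v} → In K v → ¬ Simplicial X v → size K < D X v
    D-clique {X} K K⊑ cl {v} Kv ¬s with ¬Simplicial X v ¬s
    ... | y , z , Xy , Xz , vy , vz , ¬yz = go (in? K y) (in? K z)
      where
      lt : ∀ w → In X w → E v w → ¬ In K w → size K < D X v
      lt w Xw vw ¬Kw = #-strict (in? K) (near? X v) (λ u Ku → K⊑ u Ku , cl v u Kv Ku) w (Xw , vw) ¬Kw
      go : Dec (In K y) → Dec (In K z) → size K < D X v
      go (yes Ky) (yes Kz) = contradiction (cl y z Ky Kz) ¬yz
      go (no ¬Ky) _ = lt y Xy vy ¬Ky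
      go (yes _) (no ¬Kz) = lt z Xz vz ¬Kz

    -- A clique with a simplicial vertex lies in the closed neighbourhood of that vertex, where the
    -- demands add up to `N` by `demand-sum`. In any other clique all closed degrees exceed its size
    -- κ, so its total is at most κ/(κ + 1/2) of `N`.
    demand-valid : ∀ X → Valid X N (demand X)
    demand-valid X = record
      { outside = demand-out X
      ; nonsimplicial = λ v Xv ¬s → ≤-reflexive (trans (cong (λ x → 2 * (D X v * x)) (demand-other X v Xv ¬s))
          (trans (ρ-spec′ {X} Xv) (cong (2 * N +_) (sym (demand-other X v Xv ¬s)))))
      ; cliques = cliques′ }
      where
      cliques′ : ∀ K → K ⊑ X → Clique K → total K (demand X) ≤ N
      cliques′ K K⊑ cl with any? (λ v → in? K v ×-dec Simplicial? X v)
      ... | yes (v , Kv , s) = clique-with-simplicial {X} (K⊑ v Kv) s K K⊑ cl Kv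
      ... | no ¬s with any? (in? K)
      ...   | no ¬K = ≤-trans (≤-reflexive (∑-zero λ v → cong (_* demand X v) (⟨⟩-no (in? K v) λ Kv → ¬K (v , Kv)))) z≤n
      ...   | yes (w , Kw) = begin
        total K (demand X) ≤⟨ ∑-mono (λ v → ⟨⟩-case (in? K v) λ Kv → ≤-trans (≤-reflexive (demand-other X v (K⊑ v Kv) (λ s → ¬s (v , Kv , s))))
          (ρ-anti (s≤s z≤n) (D-clique {X} K K⊑ cl Kv (λ s → ¬s (v , Kv , s))) (D≤n X v))) ⟩
        ∑ (λ v → ⟨ in? K v ⟩ * ρ (suc (size K))) ≡⟨ ∑-*ʳ _ _ ⟩
        size K * ρ (suc (size K)) ≤⟨ κρ≤N (size K) (≤-trans (D-clique {X} K K⊑ cl Kw (λ s → ¬s (w , Kw , s))) (D≤n X w)) ⟩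
        N ∎
        where open ≤-Reasoning

  -- Averaging over the deletion of vertices and of mated pairs

  module Averaging {n : ℕ} (G : SimpleGraph n) where

    open Demands G

    module Matching (S : Sub) (μ : Fin n → Fin n) (μ-invol : ∀ x → μ (μ x) ≡ x)
      (μ-In : ∀ x → In S x → In S (μ x)) (μ-apart : ∀ x → μ x ≢ x → ¬ E x (μ x)) where

      Mem : Fin n → Fin n → Set
      Mem x t = t ≡ x ⊎ t ≡ μ x

      mem? : ∀ x t → Dec (Mem x t)
      mem? x t = (t ≟F x) ⊎-dec (t ≟F μ x)

      Mem-sym : ∀ {x t} → Mem x t → Mem t x
      Mem-sym (inj₁ e) = inj₁ (sym e)
      Mem-sym {x} (inj₂ e) = inj₂ (trans (sym (μ-invol x)) (cong μ (sym e)))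

      cut : Fin n → Sub
      cut x = record { In = λ t → In S t × ¬ Mem x t ; in? = λ t → in? S t ×-dec ¬? (mem? x t) }

      size-cut : ∀ x → In S x → size (cut x) < size S
      size-cut x Sx = #-strict (in? (cut x)) (in? S) (λ _ → proj₁) x Sx (λ p → proj₂ p (inj₁ refl))

      -- Each vertex lies in deleted groups of total weight 2.
      w : Fin n → ℕ
      w x = ⟨ in? S x ⟩ * (1 + ⟨ μ x ≟F x ⟩)

      w-single : ∀ {x} → In S x → μ x ≡ x → w x ≡ 2
      w-single {x} Sx e = cong₂ (λ a b → a * (1 + b)) (⟨⟩-yes (in? S x) Sx) (⟨⟩-yes (μ x ≟F x) e)

      w-pair : ∀ {x} → In S x → μ x ≢ x → w x ≡ 1
      w-pair {x} Sx e = cong₂ (λ a b → a * (1 + b)) (⟨⟩-yes (in? S x) Sx) (⟨⟩-no (μ x ≟F x) e)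

      ∑w-mem : ∀ {y} → In S y → ∑ (λ x → ⟨ mem? x y ⟩ * w x) ≡ 2
      ∑w-mem {y} Sy with μ y ≟F y
      ... | yes e = trans (∑-cong (λ x → cong (_* w x) (⟨⟩-cong (mem? x y) (x ≟F y)
              (λ m → single (Mem-sym m)) (λ { refl → inj₁ refl }))))
            (trans (∑-point y w) (w-single Sy e))
        where
        single : ∀ {x} → Mem y x → x ≡ y
        single (inj₁ p) = p
        single (inj₂ p) = trans p e
      ... | no ne = trans (∑-cong (λ x → trans (cong (_* w x) (two x)) (*-distribʳ-+ (w x) ⟨ x ≟F y ⟩ ⟨ x ≟F μ y ⟩)))
            (trans (∑-+ _ _) (cong₂ _+_ (trans (∑-point y w) (w-pair Sy ne))
              (trans (∑-point (μ y) w) (w-pair (μ-In y Sy) λ e → ne (trans (sym e) (μ-invol y))))))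
        where
        two : ∀ x → ⟨ mem? x y ⟩ ≡ ⟨ x ≟F y ⟩ + ⟨ x ≟F μ y ⟩
        two x = ≤-antisym
          (⟨⟩-cover (x ≟F y) (x ≟F μ y) (mem? x y) Mem-sym)
          (⟨⟩-disj (x ≟F y) (x ≟F μ y) (mem? x y) (λ e → Mem-sym (inj₁ e)) (λ e → Mem-sym (inj₂ e)) λ p q → ne (trans (sym q) p))

      ∑w-mem′ : ∀ {y} e → In S y → ∑ (λ x → w x * (⟨ mem? x y ⟩ * e)) ≡ 2 * e
      ∑w-mem′ {y} e Sy = trans (∑-cong (λ x → p (w x) ⟨ mem? x y ⟩ e)) (trans (∑-*ʳ e _) (cong (_* e) (∑w-mem Sy)))
        where
        p : ∀ a b c → a * (b * c) ≡ b * a * c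
        p = solve-∀

      nbr? : ∀ v y → Dec ((In S y × E v y) × y ≢ v)
      nbr? v y = near? S v y ×-dec ¬? (y ≟F v)

      hits : Fin n → Fin n → ℕ
      hits v x = ∑ (λ y → ⟨ nbr? v y ⟩ * ⟨ mem? x y ⟩)

      module _ {v : Fin n} (Sv : In S v) where

        #nbr : suc (# (nbr? v)) ≡ D S v
        #nbr = trans (+-comm 1 _) (trans (cong (# (nbr? v) +_) (sym (#-one v))) (≤-antisym
          (#-disj (nbr? v) (_≟F v) (near? S v) (λ _ → proj₁) (λ { _ refl → Sv , E-refl }) (λ _ p q → proj₂ p q))
          (#-cover (nbr? v) (_≟F v) (near? S v) case)))
          where
          case : ∀ i → In S i × E v i → ((In S i × E v i) × i ≢ v) ⊎ i ≡ v
          case i p with i ≟F v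
          ... | yes e = inj₂ e
          ... | no ne = inj₁ (p , ne)

        ∑-hits : ∑ (λ x → w x * hits v x) ≡ 2 * # (nbr? v)
        ∑-hits = begin-equality
          ∑ (λ x → w x * hits v x) ≡⟨ ∑-cong (λ x → sym (∑-*ˡ (w x) _)) ⟩
          ∑ (λ x → ∑ (λ y → w x * (⟨ nbr? v y ⟩ * ⟨ mem? x y ⟩))) ≡⟨ ∑-swap _ ⟩
          ∑ (λ y → ∑ (λ x → w x * (⟨ nbr? v y ⟩ * ⟨ mem? x y ⟩))) ≡⟨ ∑-cong inner ⟩
          ∑ (λ y → 2 * ⟨ nbr? v y ⟩) ≡⟨ ∑-*ˡ 2 _ ⟩
          2 * # (nbr? v) ∎
          where
          open ≤-Reasoning
          inner : ∀ y → ∑ (λ x → w x * (⟨ nbr? v y ⟩ * ⟨ mem? x y ⟩)) ≡ 2 * ⟨ nbr? v y ⟩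
          inner y with nbr? v y
          ... | no _ = ∑-zero (λ x → *-zeroʳ (w x))
          ... | yes ((Sy , _) , _) = trans (∑-cong (λ x → cong (w x *_) (trans (*-identityˡ _) (sym (*-identityʳ _))))) (∑w-mem′ 1 Sy)

        -- A vertex is not adjacent to its mate, so no deletion counts both as a loss of v and as a
        -- gain from a lost neighbour.
        hits-own : ∀ {x} → Mem x v → hits v x ≡ 0
        hits-own {x} m = ∑-zero pt
          where
          pt : ∀ y → ⟨ nbr? v y ⟩ * ⟨ mem? x y ⟩ ≡ 0
          pt y with nbr? v y | mem? x y
          ... | no _ | _ = refl
          ... | yes _ | no _ = refl
          ... | yes ((_ , vy) , y≢v) | yes m′ = ⊥-elim (absurd m m′)
            where
            apart : y ≡ μ v → ⊥
            apart refl = μ-apart v y≢v vy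
            absurd : Mem x v → Mem x y → ⊥
            absurd (inj₁ refl) (inj₁ e) = y≢v e
            absurd (inj₁ refl) (inj₂ e) = apart e
            absurd (inj₂ p) (inj₂ q) = y≢v (trans q (sym p))
            absurd (inj₂ p) (inj₁ refl) = apart (trans (sym (μ-invol y)) (cong μ (sym p)))

        D-cut : ∀ {x} → ¬ Mem x v → D (cut x) v + hits v x ≡ D S v
        D-cut {x} ¬m = trans (sym (∑-+ _ _)) (∑-cong pt)
          where
          pt : ∀ y → ⟨ near? (cut x) v y ⟩ + ⟨ nbr? v y ⟩ * ⟨ mem? x y ⟩ ≡ ⟨ near? S v y ⟩
          pt y with mem? x y
          ... | yes m = trans (cong₂ _+_ (⟨⟩-no ((in? S y ×-dec ¬? (yes m)) ×-dec E? v y) λ p → proj₂ (proj₁ p) m) (*-identityʳ _))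
                (⟨⟩-cong (nbr? v y) (near? S v y) proj₁ λ p → p , λ { refl → ¬m m })
          ... | no ¬m′ = trans (cong₂ _+_ (⟨⟩-cong ((in? S y ×-dec ¬? (no ¬m′)) ×-dec E? v y) (near? S v y) (λ { ((a , _) , b) → a , b }) (λ { (a , b) → (a , ¬m′) , b }))
                (*-zeroʳ ⟨ nbr? v y ⟩)) (+-identityʳ _)

        hits≤2 : ∀ x → hits v x ≤ 2
        hits≤2 x = ≤-trans (∑-mono λ y → ≤-trans (*-monoˡ-≤ ⟨ mem? x y ⟩ (⟨⟩≤1 (nbr? v y))) (≤-reflexive (*-identityˡ _)))
          (≤-trans (#-cover (_≟F x) (_≟F μ x) (mem? x) (λ _ m → m)) (≤-reflexive (cong₂ _+_ (#-one x) (#-one (μ x)))))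

        -- The group weights make the increments over all deletions add up to those of
        -- deleting each neighbour once, whence the single condition on the deficits e.
        average : ∀ {δ} → D S v ≡ 3 + δ → (s : ℕ) (e : Fin n → ℕ) → let r = ρ (D S v) ; q = 3 + 2 * δ in
          (∀ x → In S x → ¬ Mem x v → suc s * (q * r + 2 * r * hits v x) ≤ suc s * (q * demand (cut x) v) + e x) →
          ∑ (λ x → w x * e x) ≤ 2 * (suc s * r) →
          ∑ w * r ≤ ∑ (λ x → w x * demand (cut x) v)
        average {δ} D≡ s e per-x total-e = *-cancelˡ-≤ (suc s * q) (+-cancelʳ-≤ (2 * (suc s * r) + 2 * (suc s * (q * r))) _ _ (begin
          suc s * q * (∑ w * r) + (2 * (suc s * r) + 2 * (suc s * (q * r))) ≡⟨ i₁ δ s r (∑ w) ⟩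
          ∑ w * (suc s * (q * r)) + 2 * (2 + δ) * (suc s * (2 * r)) ≡⟨ cong₂ _+_ (sym (∑-*ʳ _ _)) (trans (cong (_* (suc s * (2 * r))) (sym deg)) (sym (∑-*ʳ _ _))) ⟩
          ∑ (λ x → w x * (suc s * (q * r))) + ∑ (λ x → w x * hits v x * (suc s * (2 * r))) ≡⟨ sym (∑-+ _ _) ⟩
          ∑ (λ x → w x * (suc s * (q * r)) + w x * hits v x * (suc s * (2 * r))) ≤⟨ ∑-mono pt ⟩
          ∑ (λ x → suc s * q * (w x * m x) + w x * e x + w x * (⟨ mem? x v ⟩ * (suc s * (q * r)))) ≡⟨ ∑-+ _ _ ⟩
          ∑ (λ x → suc s * q * (w x * m x) + w x * e x) + ∑ (λ x → w x * (⟨ mem? x v ⟩ * (suc s * (q * r)))) ≡⟨ cong₂ _+_ (∑-+ _ _) (∑w-mem′ _ Sv) ⟩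
          (∑ (λ x → suc s * q * (w x * m x)) + ∑ (λ x → w x * e x)) + 2 * (suc s * (q * r)) ≡⟨ cong (λ y → (y + ∑ (λ x → w x * e x)) + 2 * (suc s * (q * r))) (∑-*ˡ (suc s * q) (λ x → w x * m x)) ⟩
          (suc s * q * ∑ (λ x → w x * m x) + ∑ (λ x → w x * e x)) + 2 * (suc s * (q * r)) ≤⟨ +-monoˡ-≤ (2 * (suc s * (q * r))) (+-monoʳ-≤ (suc s * q * ∑ (λ x → w x * m x)) total-e) ⟩
          (suc s * q * ∑ (λ x → w x * m x) + 2 * (suc s * r)) + 2 * (suc s * (q * r)) ≡⟨ +-assoc (suc s * q * ∑ (λ x → w x * m x)) (2 * (suc s * r)) (2 * (suc s * (q * r))) ⟩
          suc s * q * ∑ (λ x → w x * m x) + (2 * (suc s * r) + 2 * (suc s * (q * r))) ∎))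
          where
          open ≤-Reasoning
          r = ρ (D S v)
          q = 3 + 2 * δ
          m = λ x → demand (cut x) v
          -- The balance: 2 + δ neighbours, each deleted with weight 2, call for 4 (2 + δ) r; the
          -- deletion of v, also of weight 2, costs 2 (3 + 2δ) r. The difference 2 r bounds the
          -- deficits in `total-e`. The factor `suc s` clears their denominators.
          i₁ : ∀ δ s r W → suc s * (3 + 2 * δ) * (W * r) + (2 * (suc s * r) + 2 * (suc s * ((3 + 2 * δ) * r)))
            ≡ W * (suc s * ((3 + 2 * δ) * r)) + 2 * (2 + δ) * (suc s * (2 * r))
          i₁ = solve-∀
          deg : ∑ (λ x → w x * hits v x) ≡ 2 * (2 + δ)
          deg = trans ∑-hits (cong (2 *_) (suc-injective (trans #nbr D≡)))
          i₂ : ∀ a b c d r → a * (b * (c * r)) + a * d * (b * (2 * r)) ≡ a * (b * (c * r + 2 * r * d))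
          i₂ = solve-∀
          i₃ : ∀ a b c d y → a * (b * (c * d) + y) ≡ b * c * (a * d) + a * y
          i₃ = solve-∀
          pt : ∀ x → w x * (suc s * (q * r)) + w x * hits v x * (suc s * (2 * r)) ≤
            suc s * q * (w x * m x) + w x * e x + w x * (⟨ mem? x v ⟩ * (suc s * (q * r)))
          pt x = go (in? S x) (mem? x v)
            where
            go : (s? : Dec (In S x)) (m? : Dec (Mem x v)) → let w′ = ⟨ s? ⟩ * (1 + ⟨ μ x ≟F x ⟩) in
              w′ * (suc s * (q * r)) + w′ * hits v x * (suc s * (2 * r)) ≤ suc s * q * (w′ * m x) + w′ * e x + w′ * (⟨ m? ⟩ * (suc s * (q * r)))
            go (no _) _ = z≤n
            go (yes Sx) (yes mem) = ≤-trans (≤-reflexive (trans (cong (λ y → w′ * (suc s * (q * r)) + y * (suc s * (2 * r))) (trans (cong (w′ *_) (hits-own mem)) (*-zeroʳ w′)))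
                    (+-identityʳ _))) (≤-trans (*-monoʳ-≤ w′ (≤-reflexive (sym (*-identityˡ (suc s * (q * r)))))) (m≤n+m (w′ * (1 * (suc s * (q * r)))) (suc s * q * (w′ * m x) + w′ * e x)))
              where w′ = 1 * (1 + ⟨ μ x ≟F x ⟩)
            go (yes Sx) (no ¬mem) = ≤-trans (≤-reflexive (i₂ w′ (suc s) q (hits v x) r)) (≤-trans (*-monoʳ-≤ w′ (per-x x Sx ¬mem))
                    (≤-trans (≤-reflexive (i₃ w′ (suc s) q (m x) (e x))) (m≤m+n (suc s * q * (w′ * m x) + w′ * e x) _)))
              where w′ = 1 * (1 + ⟨ μ x ≟F x ⟩)

        nonsimplicial-D : ¬ Simplicial S v → ∃ λ δ → D S v ≡ 3 + δ
        nonsimplicial-D ¬s with ¬Simplicial S v ¬s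
        ... | y , z , Sy , Sz , vy , vz , ¬yz with m≤n⇒∃[o]m+o≡n three
          where
          three : 3 ≤ D S v
          three = ≤-trans (≤-reflexive (sym (cong₂ _+_ (#-one v) (cong₂ _+_ (#-one y) (#-one z)))))
            (≤-trans (+-monoʳ-≤ (# (_≟F v)) (#-disj (_≟F y) (_≟F z) (λ t → (t ≟F y) ⊎-dec (t ≟F z)) (λ _ → inj₁) (λ _ → inj₂) λ { _ refl refl → ¬yz E-refl }))
            (#-disj (_≟F v) (λ t → (t ≟F y) ⊎-dec (t ≟F z)) (near? S v) (λ { _ refl → Sv , E-refl })
              (λ { _ (inj₁ refl) → Sy , vy ; _ (inj₂ refl) → Sz , vz })
              (λ { _ refl (inj₁ refl) → ¬yz vz ; _ refl (inj₂ refl) → ¬yz (E-sym vy) })))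
        ...   | δ , e = δ , sym e

        module _ {δ} (D≡ : D S v ≡ 3 + δ) {x} (¬m : ¬ Mem x v) where

          private
            r = ρ (D S v)
            X = cut x
            Xv : In X v
            Xv = Sv , ¬m

          r-spec : (5 + 2 * δ) * r ≡ 2 * N
          r-spec = trans (cong₂ _*_ (i δ) (cong ρ D≡)) (ρ-spec {2 + δ} (≤-trans (≤-reflexive (sym D≡)) (D≤n S v)))
            where
            i : ∀ δ → 5 + 2 * δ ≡ suc (2 * (2 + δ))
            i = solve-∀

          D-cut′ : ∀ {j k} → hits v x ≡ j → j + k ≡ 3 + δ → D X v ≡ k
          D-cut′ {j} {k} h≡ e = +-cancelˡ-≡ j _ _ (trans (+-comm j _) (trans (cong (D X v +_) (sym h≡)) (trans (D-cut ¬m) (trans D≡ (sym e)))))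

          -- The function 1/(d + 1/2) is convex: one lost neighbour gives the required increment
          -- exactly, two give at least twice as much.
          nonsimplicial-gain : ¬ Simplicial X v →
            (3 + 2 * δ) * r + 2 * r * hits v x ≤ (3 + 2 * δ) * demand X v
          nonsimplicial-gain ¬s = subst (λ y → (3 + 2 * δ) * r + 2 * r * hits v x ≤ (3 + 2 * δ) * y) (sym (demand-other X v Xv ¬s)) (go (hits v x) refl (hits≤2 x))
            where
            go : ∀ j → hits v x ≡ j → j ≤ 2 → (3 + 2 * δ) * r + 2 * r * hits v x ≤ (3 + 2 * δ) * ρ (D X v)
            go zero h≡ _ = ≤-reflexive (trans (cong (λ j → (3 + 2 * δ) * r + 2 * r * j) h≡)
              (trans (trans (cong ((3 + 2 * δ) * r +_) (*-zeroʳ (2 * r))) (+-identityʳ _)) (cong (λ y → (3 + 2 * δ) * ρ y) (trans D≡ (sym (D-cut′ h≡ refl))))))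
            go (suc zero) h≡ _ = ≤-reflexive (trans (cong (λ j → (3 + 2 * δ) * r + 2 * r * j) h≡) (trans (i₁ δ r) (trans r-spec
              (sym (trans (cong₂ _*_ (i₂ δ) (cong ρ (D-cut′ h≡ refl))) (ρ-spec (≤-trans (n≤1+n _) (≤-trans (≤-reflexive (sym D≡)) (D≤n S v)))))))))
              where
              i₁ : ∀ δ r → (3 + 2 * δ) * r + 2 * r * 1 ≡ (5 + 2 * δ) * r
              i₁ = solve-∀
              i₂ : ∀ δ → 3 + 2 * δ ≡ suc (2 * (1 + δ))
              i₂ = solve-∀
            go (suc (suc zero)) h≡ _ = begin
              (3 + 2 * δ) * r + 2 * r * hits v x ≡⟨ cong (λ j → (3 + 2 * δ) * r + 2 * r * j) h≡ ⟩
              (3 + 2 * δ) * r + 2 * r * 2 ≡⟨ i₁ δ r ⟩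
              (5 + 2 * δ) * r + 2 * r ≤⟨ +-mono-≤ (≤-reflexive (trans r-spec (sym spec))) (*-monoʳ-≤ 2 r≤) ⟩
              suc (2 * δ) * ρ (D X v) + 2 * ρ (D X v) ≡⟨ i₂ δ (ρ (D X v)) ⟩
              (3 + 2 * δ) * ρ (D X v) ∎
              where
              open ≤-Reasoning
              i₁ : ∀ δ r → (3 + 2 * δ) * r + 2 * r * 2 ≡ (5 + 2 * δ) * r + 2 * r
              i₁ = solve-∀
              i₂ : ∀ δ r → suc (2 * δ) * r + 2 * r ≡ (3 + 2 * δ) * r
              i₂ = solve-∀
              Dx : D X v ≡ 1 + δ
              Dx = D-cut′ h≡ refl
              spec : suc (2 * δ) * ρ (D X v) ≡ 2 * N
              spec = trans (cong (λ y → suc (2 * δ) * ρ y) Dx) (ρ-spec (≤-trans (≤-trans (n≤1+n _) (n≤1+n _)) (≤-trans (≤-reflexive (sym D≡)) (D≤n S v))))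
              r≤ : r ≤ ρ (D X v)
              r≤ = ρ-anti (1≤D {X} Xv) (≤-trans (m≤m+n (D X v) (hits v x)) (≤-reflexive (D-cut ¬m))) (D≤n S v)
            go (suc (suc (suc _))) _ (s≤s (s≤s ()))

          module _ (s : Simplicial X v) where

            simplicial-gain₁ : hits v x ≡ 1 → 1 ≤ others X v → (3 + 2 * δ) * r ≤ (2 + 2 * δ) * demand X v
            simplicial-gain₁ h≡ 1≤o = gain₁ {a = simps X v} {u = others X v}
              (trans (+-comm (others X v) _) (trans (sym (D-split {X} Xv s)) Dx)) (1≤simps {X} Xv s) 1≤o r-spec
              (subst (λ y → N ≤ simps X v * demand X v + others X v * ρ y) (trans (cong suc Dx) (sym D≡)) (demand-lower {X} Xv s))
              where
              Dx : D X v ≡ 2 + δ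
              Dx = D-cut′ h≡ refl

            simplicial-gain₂ : hits v x ≡ 2 → (3 + 2 * δ) * r + 4 * r ≤ (3 + 2 * δ) * demand X v + r
            simplicial-gain₂ h≡ = gain₂ {a = simps X v} {u = others X v} {p = ρ (2 + δ)}
              (trans (+-comm (others X v) _) (trans (sym (D-split {X} Xv s)) Dx)) (1≤simps {X} Xv s) r-spec
              (trans (cong (_* ρ (2 + δ)) (i δ)) (ρ-spec (≤-trans (n≤1+n _) (≤-trans (≤-reflexive (sym D≡)) (D≤n S v)))))
              (subst (λ y → N ≤ simps X v * demand X v + others X v * ρ y) (cong suc Dx) (demand-lower {X} Xv s))
              where
              Dx : D X v ≡ 1 + δ
              Dx = D-cut′ h≡ refl
              i : ∀ δ → 3 + 2 * δ ≡ suc (2 * (1 + δ))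
              i = solve-∀

            simplicial-gain-large : hits v x ≡ 1 → ∀ {z} → In X z → E v z → ¬ Simplicial X z → simps X v + D X v ≤ D X z →
              (9 + 14 * δ + 4 * (δ * δ)) * r ≤ (2 + 2 * δ) * ((3 + 2 * δ) * demand X v)
            simplicial-gain-large h≡ {z} Xz vz ¬sz large with others X v in o≡ | #-pos (other? X v) z ((Xz , vz) , ¬sz)
            ... | suc u | _ = gain-large {a = simps X v} {u = u} {m = demand X v} {r = r} {p = ρ (simps X v + D X v)}
              (trans (+-suc u _) (trans (cong suc (+-comm u _)) (trans (sym (+-suc _ u)) (trans (cong (simps X v +_) (sym o≡)) (trans (sym (D-split {X} Xv s)) Dx)))))
              (1≤simps {X} Xv s) r-spec
              (trans (cong₂ (λ y z → (3 + 2 * y) * ρ z) (refl {x = simps X v + δ}) (trans (cong (simps X v +_) Dx) (sym (i (simps X v) δ))))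
                (trans (cong (_* ρ (suc (suc (simps X v + δ)))) (i′ (simps X v) δ)) (ρ-spec
                  (≤-trans (≤-reflexive (trans (i (simps X v) δ) (cong (simps X v +_) (sym Dx)))) (≤-trans large (D≤n X z))))))
              (≤-trans (subst (λ y → N ≤ simps X v * demand X v + (u * ρ y + ρ (D X z))) (trans (cong suc Dx) (sym D≡)) (demand-lower′ {X} Xv s Xz vz ¬sz o≡))
                (+-monoʳ-≤ (simps X v * demand X v) (+-monoʳ-≤ (u * r) (ρ-anti (≤-trans (1≤simps {X} Xv s) (m≤m+n _ _)) large (D≤n X z)))))
              where
              Dx : D X v ≡ 2 + δ
              Dx = D-cut′ h≡ refl
              i : ∀ a δ → suc (suc (a + δ)) ≡ a + (2 + δ)
              i = solve-∀
              i′ : ∀ a δ → 3 + 2 * (a + δ) ≡ suc (2 * suc (a + δ))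
              i′ = solve-∀

      from-average : ∀ v₀ → In S v₀ → Hypothesis S →
        (∀ v → In S v → ∑ w * ρ (D S v) ≤ ∑ (λ x → w x * demand (cut x) v)) → Colourable N (nominal S)
      from-average v₀ Sv₀ IH bound = Colourable-scale 1≤WN le (Colourable-∑ col)
        where
        col : ∀ x → Colourable (w x * N) (λ v → w x * demand (cut x) v)
        col x with in? S x
        ... | no _ = Colourable-zero (λ _ → refl)
        ... | yes Sx = Colourable-* (1 * (1 + ⟨ μ x ≟F x ⟩)) (IH (cut x) (size-cut x Sx) (demand (cut x)) (demand-valid (cut x)))
        1≤w : 1 ≤ w v₀
        1≤w = *-mono-≤ (≤-reflexive (sym (⟨⟩-yes (in? S v₀) Sv₀))) (s≤s z≤n)
        1≤WN : 1 ≤ ∑ (λ x → w x * N)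
        1≤WN = ≤-trans (*-mono-≤ 1≤w 1≤Q*N₀) (term≤∑ (λ x → w x * N) v₀)
        le : ∀ v → ∑ (λ x → w x * N) * nominal S v ≤ N * ∑ (λ x → w x * demand (cut x) v)
        le v = go (in? S v)
          where
          i : ∀ a b c → a * b * (1 * c) ≡ b * (a * c)
          i = solve-∀
          go : (s? : Dec (In S v)) → ∑ (λ x → w x * N) * (⟨ s? ⟩ * ρ (D S v)) ≤ N * ∑ (λ x → w x * demand (cut x) v)
          go (no _) = ≤-trans (≤-reflexive (*-zeroʳ (∑ (λ x → w x * N)))) z≤n
          go (yes Sv) = ≤-trans (≤-reflexive (trans (cong (_* (1 * ρ (D S v))) (∑-*ʳ N w)) (i (∑ w) N (ρ (D S v))))) (*-monoʳ-≤ N (bound v Sv))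

  -- Overlaps of colour sets

  _∩_ _∖_ : ∀ {L} → Colours L → Colours L → Colours L
  (X ∩ Y) i = X i ∧ Y i
  (X ∖ Y) i = X i ∧ not (Y i)

  ∣∖∣ : ∀ {L} (X Y : Colours L) → ∣ X ∖ Y ∣ + ∣ X ∩ Y ∣ ≡ ∣ X ∣
  ∣∖∣ X Y = trans (sym (∑-+ _ _)) (∑-cong pt)
    where
    pt : ∀ i → β (X i ∧ not (Y i)) + β (X i ∧ Y i) ≡ β (X i)
    pt i with X i | Y i
    ... | false | _ = refl
    ... | true | false = refl
    ... | true | true = refl

  ∖-⊆ : ∀ {L} (X Y : Colours L) → (X ∖ Y) ⊆ X
  ∖-⊆ X Y i p with X i
  ... | true = refl
  ... | false = p

  ∖-∌ : ∀ {L} (X Y : Colours L) → (X ∖ Y) ⟂ Y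
  ∖-∌ X Y i p q with X i | Y i
  ∖-∌ X Y i () q | true | true
  ∖-∌ X Y i () q | false | _
  ∖-∌ X Y i p () | true | false

  ∖-intro : ∀ {L} (X Y : Colours L) i → X i ≡ true → (Y i ≡ true → ⊥) → (X ∖ Y) i ≡ true
  ∖-intro X Y i p q with Y i
  ... | true = ⊥-elim (q refl)
  ... | false rewrite p = refl

  ∩-intro : ∀ {L} (X Y : Colours L) i → X i ≡ true → Y i ≡ true → (X ∩ Y) i ≡ true
  ∩-intro X Y i p q rewrite p | q = refl

  ∩-comm : ∀ {L} (X Y : Colours L) → ∣ X ∩ Y ∣ ≡ ∣ Y ∩ X ∣
  ∩-comm X Y = ∑-cong pt
    where
    pt : ∀ i → β (X i ∧ Y i) ≡ β (Y i ∧ X i)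
    pt i with X i | Y i
    ... | false | false = refl
    ... | false | true = refl
    ... | true | false = refl
    ... | true | true = refl

  -- Shrink Y and Z to prescribed sizes with as little overlap as the size of Y forces.
  shrink : ∀ {L} (Y Z : Colours L) {a b} → a ≤ ∣ Y ∣ → b ≤ ∣ Z ∣ →
    Σ (Colours L) λ Y′ → Σ (Colours L) λ Z′ → Y′ ⊆ Y × Z′ ⊆ Z × ∣ Y′ ∣ ≡ a × ∣ Z′ ∣ ≡ b ×
      (∣ Y′ ∩ Z′ ∣ ≡ 0 ⊎ ∣ Y′ ∩ Z′ ∣ + ∣ Y ∣ ≤ a + b)
  shrink Y Z {a} {b} a≤ b≤ with subcolours Z b b≤
  -- Colours outside `Z′` are used first: if there are `a` of them the overlap is empty, otherwise
  -- all are used and only the remainder is shared.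
  ... | Z′ , Z′⊆ , ∣Z′∣ with ≤-total a ∣ Y ∖ Z′ ∣
  ...   | inj₁ small with subcolours (Y ∖ Z′) a small
  ...     | Y′ , Y′⊆ , ∣Y′∣ = Y′ , Z′ , (λ i p → ∖-⊆ Y Z′ i (Y′⊆ i p)) , Z′⊆ , ∣Y′∣ , ∣Z′∣ , inj₁ (∑-zero none)
    where
    none : ∀ i → β (Y′ i ∧ Z′ i) ≡ 0
    none i with Y′ i in p | Z′ i in q
    ... | false | _ = refl
    ... | true | false = refl
    ... | true | true = ⊥-elim (∖-∌ Y Z′ i (Y′⊆ i p) q)
  shrink Y Z {a} {b} a≤ b≤ | Z′ , Z′⊆ , ∣Z′∣ | inj₂ big with between (Y ∖ Z′) Y (∖-⊆ Y Z′) a big a≤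
  ... | Y′ , ⊆Y′ , Y′⊆ , ∣Y′∣ = Y′ , Z′ , Y′⊆ , Z′⊆ , ∣Y′∣ , ∣Z′∣ , inj₂ (begin
    ∣ Y′ ∩ Z′ ∣ + ∣ Y ∣ ≡⟨ cong (∣ Y′ ∩ Z′ ∣ +_) (sym (∣∖∣ Y Z′)) ⟩
    ∣ Y′ ∩ Z′ ∣ + (∣ Y ∖ Z′ ∣ + ∣ Y ∩ Z′ ∣) ≤⟨ +-monoʳ-≤ ∣ Y′ ∩ Z′ ∣ (+-mono-≤ (∣∣-mono sub) (∣∣-mono sub′)) ⟩
    ∣ Y′ ∩ Z′ ∣ + (∣ Y′ ∖ Z′ ∣ + ∣ Z′ ∣) ≡⟨ sym (+-assoc ∣ Y′ ∩ Z′ ∣ _ _) ⟩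
    ∣ Y′ ∩ Z′ ∣ + ∣ Y′ ∖ Z′ ∣ + ∣ Z′ ∣ ≡⟨ cong₂ _+_ (trans (+-comm ∣ Y′ ∩ Z′ ∣ _) (trans (∣∖∣ Y′ Z′) ∣Y′∣)) ∣Z′∣ ⟩
    a + b ∎)
    where
    open ≤-Reasoning
    sub : (Y ∖ Z′) ⊆ (Y′ ∖ Z′)
    sub i p = ∖-intro Y′ Z′ i (⊆Y′ i p) (∖-∌ Y Z′ i p)
    sub′ : (Y ∩ Z′) ⊆ Z′
    sub′ i p with Y i | Z′ i
    ... | true | true = refl
    ... | true | false = p
    ... | false | true = refl
    ... | false | false = p

  ∣∣-nonempty : ∀ {L} (X : Colours L) → ∣ X ∣ ≡ 0 → ∀ i → X i ≡ true → ⊥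
  ∣∣-nonempty X e i p = contradiction (≤-trans (≤-reflexive (sym (cong β p))) (≤-trans (term≤∑ (λ i → β (X i)) i) (≤-reflexive e))) λ ()

  -- Cliques attached through two nonadjacent vertices

  module Components {n : ℕ} (G : SimpleGraph n) where

    open Demands G

    E⇒Adj : ∀ {u v} → E u v → u ≢ v → Adj u v
    E⇒Adj (inj₁ e) ne = contradiction e ne
    E⇒Adj (inj₂ a) _ = a

    load-bound : ∀ k u own (B : Fin n → ℕ) → own ≤ B u → (∀ t → Adj u t → k t ≤ B t) → own + load k u ≤ ∑ B
    load-bound k u own B ob bd = begin
      own + load k u ≡⟨ cong (_+ load k u) (sym (∑-point u (λ _ → own))) ⟩
      ∑ (λ t → ⟨ t ≟F u ⟩ * own) + load k u ≡⟨ sym (∑-+ _ _) ⟩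
      ∑ (λ t → ⟨ t ≟F u ⟩ * own + ⟨ Adj? u t ⟩ * k t) ≤⟨ ∑-mono (λ t → pt t (t ≟F u) (Adj? u t)) ⟩
      ∑ B ∎
      where
      open ≤-Reasoning
      pt : ∀ t (e? : Dec (t ≡ u)) (a? : Dec (Adj u t)) → ⟨ e? ⟩ * own + ⟨ a? ⟩ * k t ≤ B t
      pt t (yes refl) (yes a) = contradiction a Adj-irr
      pt t (yes refl) (no _) = ≤-trans (≤-reflexive (trans (+-identityʳ _) (*-identityˡ own))) ob
      pt t (no _) (yes a) = ≤-trans (≤-reflexive (*-identityˡ (k t))) (bd t a)
      pt t (no _) (no _) = z≤n

    -- A clique K of S attached to the rest of S only through two nonadjacent vertices y and z.
    record Attached (S K : Sub) (y z p o : Fin n) : Set where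
      no-eta-equality
      field
        K⊑S : K ⊑ S
        K-clique : Clique K
        Sy : In S y
        Sz : In S z
        ¬yz : ¬ E y z
        ¬Ky : ¬ In K y
        ¬Kz : ¬ In K z
        closed : ∀ t u → In K t → In S u → E t u → In K u ⊎ (u ≡ y ⊎ u ≡ z)
        Kp : In K p
        py : E p y
        ¬pz : ¬ E p z
        Ko : In K o
        oz : E o z
        ¬oy : ¬ E o y

    -- Colour S without K, where y and z may demand more than in S; this extra room is used to
    -- keep the colours common to y and z scarce, and then K can be coloured greedily.
    module Reduction (S : Sub) (ns : NonSimplicial S) (IH : Hypothesis S)
      (K : Sub) {y z p o : Fin n} (attached-clique : Attached S K y z p o) where

      open Attached attached-clique

      S′ : Sub
      S′ = record { In = λ t → In S t × ¬ In K t ; in? = λ t → in? S t ×-dec ¬? (in? K t) }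

      at : Fin n → ℕ
      at x = # (λ t → in? K t ×-dec E? x t)

      κ = size K
      -- A bound for the nominal demands in `K`, whose vertices are nonsimplicial and so have closed
      -- degree above `κ`. It is attained at `p` and `o`, and (κ + 1/2) F = N.
      F = ρ (suc κ)

      size-S′ : size S′ < size S
      size-S′ = #-strict (in? S′) (in? S) (λ _ → proj₁) p (K⊑S p Kp) (λ q → proj₂ q Kp)

      S′y : In S′ y
      S′y = Sy , ¬Ky
      S′z : In S′ z
      S′z = Sz , ¬Kz

      D-S′ : ∀ x → D S x ≡ D S′ x + at x
      D-S′ x = ≤-antisym
        (#-cover (near? S′ x) (λ t → in? K t ×-dec E? x t) (near? S x) case)
        (#-disj (near? S′ x) (λ t → in? K t ×-dec E? x t) (near? S x) (λ _ q → proj₁ (proj₁ q) , proj₂ q) (λ t q → K⊑S t (proj₁ q) , proj₂ q)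
          (λ _ q q′ → proj₂ (proj₁ q) (proj₁ q′)))
        where
        case : ∀ t → In S t × E x t → ((In S t × ¬ In K t) × E x t) ⊎ (In K t × E x t)
        case t (St , xt) with in? K t
        ... | yes Kt = inj₂ (Kt , xt)
        ... | no ¬Kt = inj₁ ((St , ¬Kt) , xt)

      D-S′-other : ∀ {x} → In S′ x → x ≢ y → x ≢ z → D S′ x ≡ D S x
      D-S′-other {x} (Sx , ¬Kx) x≢y x≢z = sym (trans (D-S′ x) (trans (cong (D S′ x +_) (∑-zero none)) (+-identityʳ _)))
        where
        none : ∀ t → ⟨ in? K t ×-dec E? x t ⟩ ≡ 0
        none t = ⟨⟩-no (in? K t ×-dec E? x t) λ (Kt , xt) → go (closed t x Kt Sx (E-sym xt))
          where
          go : ¬ (In K x ⊎ (x ≡ y ⊎ x ≡ z))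
          go (inj₁ Kx) = ¬Kx Kx
          go (inj₂ (inj₁ e)) = x≢y e
          go (inj₂ (inj₂ e)) = x≢z e

      -- Otherwise the closed neighbourhood of t would lie in the clique `K` and t would be
      -- simplicial in `S`.
      attached : ∀ t → In K t → E y t ⊎ E z t
      attached t Kt with ¬Simplicial S t (ns t (K⊑S t Kt))
      ... | u , w , Su , Sw , tu , tw , ¬uw with closed t u Kt Su tu | closed t w Kt Sw tw
      ...   | inj₂ (inj₁ refl) | _ = inj₁ (E-sym tu)
      ...   | inj₂ (inj₂ refl) | _ = inj₂ (E-sym tu)
      ...   | inj₁ _ | inj₂ (inj₁ refl) = inj₁ (E-sym tw)
      ...   | inj₁ _ | inj₂ (inj₂ refl) = inj₂ (E-sym tw)
      ...   | inj₁ Ku | inj₁ Kw = contradiction (K-clique u w Ku Kw) ¬uw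

      κ≤ : κ ≤ at y + at z
      κ≤ = #-cover (λ t → in? K t ×-dec E? y t) (λ t → in? K t ×-dec E? z t) (in? K) case
        where
        case : ∀ t → In K t → (In K t × E y t) ⊎ (In K t × E z t)
        case t Kt with attached t Kt
        ... | inj₁ e = inj₁ (Kt , e)
        ... | inj₂ e = inj₂ (Kt , e)

      1≤at-y : 1 ≤ at y
      1≤at-y = #-pos (λ t → in? K t ×-dec E? y t) p (Kp , E-sym py)

      1≤at-z : 1 ≤ at z
      1≤at-z = #-pos (λ t → in? K t ×-dec E? z t) o (Ko , E-sym oz)

      D-pure : ∀ {x u} → In K x → In S u → ¬ In K u → E x u → (∀ w → In S w → E x w → In K w ⊎ w ≡ u) → D S x ≡ suc κ
      D-pure {x} {u} Kx Su ¬Ku xu only = trans (≤-antisym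
          (#-cover (in? K) (_≟F u) (near? S x) (λ w (Sw , xw) → only w Sw xw))
          (#-disj (in? K) (_≟F u) (near? S x) (λ w Kw → K⊑S w Kw , K-clique x w Kx Kw) (λ { _ refl → Su , xu }) (λ { _ Ku refl → ¬Ku Ku })))
        (trans (cong (κ +_) (#-one u)) (+-comm κ 1))

      D-p : D S p ≡ suc κ
      D-p = D-pure Kp Sy ¬Ky py λ w Sw pw → case (closed p w Kp Sw pw) pw
        where
        case : ∀ {w} → In K w ⊎ (w ≡ y ⊎ w ≡ z) → E p w → In K w ⊎ w ≡ y
        case (inj₁ Kw) _ = inj₁ Kw
        case (inj₂ (inj₁ e)) _ = inj₂ e
        case (inj₂ (inj₂ refl)) pw = contradiction pw ¬pz

      D-o : D S o ≡ suc κ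
      D-o = D-pure Ko Sz ¬Kz oz λ w Sw ow → case (closed o w Ko Sw ow) ow
        where
        case : ∀ {w} → In K w ⊎ (w ≡ y ⊎ w ≡ z) → E o w → In K w ⊎ w ≡ z
        case (inj₁ Kw) _ = inj₁ Kw
        case (inj₂ (inj₂ e)) _ = inj₂ e
        case (inj₂ (inj₁ refl)) ow = contradiction ow ¬oy

      κ<n : suc κ ≤ n
      κ<n = ≤-trans (≤-reflexive (sym D-p)) (D≤n S p)

      nominal-K : ∀ {t} → In K t → nominal S t ≤ F
      nominal-K {t} Kt = ≤-trans (≤-reflexive (nominal-in {S} (K⊑S t Kt)))
        (ρ-anti (s≤s z≤n) (D-clique {S} K K⊑S K-clique Kt (ns t (K⊑S t Kt))) (D≤n S t))

      p≢o : p ≢ o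
      p≢o refl = ¬oy py

      module _ (yy : 2 + at y ≤ D S′ y) (yz : 2 + at y ≤ D S′ z) (zy : 2 + at z ≤ D S′ y) (zz : 2 + at z ≤ D S′ z) where

        nominal-y : nominal S y ≤ F
        nominal-y = ≤-trans (≤-reflexive (nominal-in {S} Sy)) (ρ-anti (s≤s z≤n) (begin
          suc κ ≤⟨ s≤s κ≤ ⟩
          suc (at y + at z) ≡⟨ +-comm (suc (at y)) (at z) ⟩
          at z + suc (at y) ≡⟨ +-suc (at z) (at y) ⟩
          suc (at z) + at y ≤⟨ +-monoˡ-≤ (at y) (≤-trans (n≤1+n _) zy) ⟩
          D S′ y + at y ≡⟨ sym (D-S′ y) ⟩
          D S y ∎) (D≤n S y))
          where open ≤-Reasoning

        nominal-z : nominal S z ≤ F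
        nominal-z = ≤-trans (≤-reflexive (nominal-in {S} Sz)) (ρ-anti (s≤s z≤n) (begin
          suc κ ≤⟨ s≤s κ≤ ⟩
          suc (at y) + at z ≤⟨ +-monoˡ-≤ (at z) (≤-trans (n≤1+n _) yz) ⟩
          D S′ z + at z ≡⟨ sym (D-S′ z) ⟩
          D S z ∎) (D≤n S z))
          where open ≤-Reasoning

        clique-plain : ∀ (Q′ : Sub) → Q′ ⊑ S′ → (∀ u → In Q′ u → size Q′ < D S′ u) → total Q′ (nominal S′) ≤ N
        clique-plain Q′ Q⊑ big with any? (in? Q′)
        ... | no ¬q = ≤-trans (≤-reflexive (∑-zero λ u → cong (_* nominal S′ u) (⟨⟩-no (in? Q′ u) λ Qu → ¬q (u , Qu)))) z≤n
        ... | yes (x , Qx) = begin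
          total Q′ (nominal S′) ≤⟨ ∑-mono (λ u → ⟨⟩-case (in? Q′ u) λ Qu → ≤-trans (≤-reflexive (nominal-in {S′} (Q⊑ u Qu)))
            (ρ-anti (s≤s z≤n) (big u Qu) (D≤n S′ u))) ⟩
          ∑ (λ u → ⟨ in? Q′ u ⟩ * ρ (suc (size Q′))) ≡⟨ ∑-*ʳ _ _ ⟩
          size Q′ * ρ (suc (size Q′)) ≤⟨ κρ≤N (size Q′) (≤-trans (big x Qx) (D≤n S′ x)) ⟩
          N ∎
          where open ≤-Reasoning

        -- Only a clique that fills the closed neighbourhood of x escapes `clique-plain`. If its
        -- size is 3 + e, its other 2 + e members demand at most `B` each, and A ≤ 3/2 B bounds the
        -- total by (2 + e + 3/2) B = N. The ratio A/B = (7 + 2e)/(5 + 2e) is the reason for asking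
        -- closed degree at least 3: for closed degree 2 it would be 5/3.
        clique-except : ∀ (Q′ : Sub) → Q′ ⊑ S′ → Clique Q′ → ∀ x → 3 ≤ D S′ x → suc (D S′ x) ≤ D S x →
          (∀ u → In Q′ u → u ≢ x → size Q′ < D S′ u) → total Q′ (nominal S′) ≤ N
        clique-except Q′ Q⊑ cl x 3≤ lt big with in? Q′ x | size Q′ <? D S′ x
        ... | no ¬Qx | _ = clique-plain Q′ Q⊑ λ u Qu → big u Qu λ { refl → ¬Qx Qu }
        ... | yes Qx | yes gt = clique-plain Q′ Q⊑ λ u Qu → all u Qu (u ≟F x)
          where
          all : ∀ u → In Q′ u → Dec (u ≡ x) → size Q′ < D S′ u
          all u Qu (yes refl) = gt
          all u Qu (no ne) = big u Qu ne
        ... | yes Qx | no ¬gt with ≤-antisym (#-mono (in? Q′) (near? S′ x) (λ u Qu → Q⊑ u Qu , cl x u Qx Qu)) (≮⇒≥ ¬gt) | m≤n⇒∃[o]m+o≡n 3≤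
        ...   | q≡ | e , D≡ = begin
          total Q′ (nominal S′) ≤⟨ ∑-mono (λ u → pt u (in? Q′ u) (u ≟F x)) ⟩
          ∑ (λ u → ⟨ r? u ⟩ * B + ⟨ u ≟F x ⟩ * A) ≡⟨ trans (∑-+ _ _) (cong₂ _+_ (∑-*ʳ B _) (∑-point x _)) ⟩
          # r? * B + A ≤⟨ *-cancelˡ-≤ 2 twice ⟩
          N ∎
          where
          open ≤-Reasoning
          A = ρ (3 + e)
          B = ρ (4 + e)
          r? = λ u → in? Q′ u ×-dec ¬? (u ≟F x)
          pt : ∀ u (q? : Dec (In Q′ u)) (e? : Dec (u ≡ x)) → ⟨ q? ⟩ * nominal S′ u ≤ ⟨ q? ×-dec ¬? e? ⟩ * B + ⟨ e? ⟩ * A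
          pt u (no _) _ = z≤n
          pt u (yes Qu) (yes refl) = *-monoʳ-≤ 1 (≤-reflexive (trans (nominal-in {S′} (Q⊑ u Qu)) (cong ρ (sym D≡))))
          pt u (yes Qu) (no ne) = ≤-trans (*-monoʳ-≤ 1 (≤-trans (≤-reflexive (nominal-in {S′} (Q⊑ u Qu)))
            (ρ-anti (s≤s z≤n) (≤-trans (s≤s (≤-reflexive (trans D≡ (sym q≡)))) (big u Qu ne)) (D≤n S′ u)))) (m≤m+n _ _)
          4+e≤n : 4 + e ≤ n
          4+e≤n = ≤-trans (≤-trans (s≤s (≤-reflexive D≡)) lt) (D≤n S x)
          rcount : # r? ≤ 2 + e
          rcount = ≤-pred (≤-trans (#-strict r? (in? Q′) (λ _ → proj₁) x Qx (λ q → proj₂ q refl)) (≤-reflexive (trans q≡ (sym D≡))))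
          specA : (5 + 2 * e) * A ≡ 2 * N
          specA = trans (cong (_* A) (i e)) (ρ-spec (≤-trans (n≤1+n _) 4+e≤n))
            where
            i : ∀ e → 5 + 2 * e ≡ suc (2 * (2 + e))
            i = solve-∀
          specB : (7 + 2 * e) * B ≡ 2 * N
          specB = trans (cong (_* B) (i e)) (ρ-spec 4+e≤n)
            where
            i : ∀ e → 7 + 2 * e ≡ suc (2 * (3 + e))
            i = solve-∀
          2A≤3B : 2 * A ≤ 3 * B
          2A≤3B = *-cancelˡ-≤ (5 + 2 * e) (begin
            (5 + 2 * e) * (2 * A) ≡⟨ i₁ (5 + 2 * e) A ⟩
            2 * ((5 + 2 * e) * A) ≡⟨ cong (2 *_) (trans specA (sym specB)) ⟩
            2 * ((7 + 2 * e) * B) ≤⟨ ≤-by ((1 + 2 * e) * B) (i₂ e B) ⟩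
            (5 + 2 * e) * (3 * B) ∎)
            where
            i₁ : ∀ x A → x * (2 * A) ≡ 2 * (x * A)
            i₁ = solve-∀
            i₂ : ∀ e B → 2 * ((7 + 2 * e) * B) + (1 + 2 * e) * B ≡ (5 + 2 * e) * (3 * B)
            i₂ = solve-∀
          twice : 2 * (# r? * B + A) ≤ 2 * N
          twice = begin
            2 * (# r? * B + A) ≤⟨ *-monoʳ-≤ 2 (+-monoˡ-≤ A (*-monoˡ-≤ B rcount)) ⟩
            2 * ((2 + e) * B + A) ≡⟨ *-distribˡ-+ 2 ((2 + e) * B) A ⟩
            2 * ((2 + e) * B) + 2 * A ≤⟨ +-monoʳ-≤ (2 * ((2 + e) * B)) 2A≤3B ⟩
            2 * ((2 + e) * B) + 3 * B ≡⟨ i e B ⟩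
            (7 + 2 * e) * B ≡⟨ specB ⟩
            2 * N ∎
            where
            i : ∀ e B → 2 * ((2 + e) * B) + 3 * B ≡ (7 + 2 * e) * B
            i = solve-∀

        -- Only y or z can be simplicial in S′.
        S′-valid : Valid S′ N (nominal S′)
        S′-valid = record
          { outside = λ v ¬v → cong (_* ρ (D S′ v)) (⟨⟩-no (in? S′ v) ¬v)
          ; nonsimplicial = λ v S′v _ → ≤-reflexive (trans (cong (λ x → 2 * (D S′ v * x)) (nominal-in {S′} S′v))
              (trans (ρ-spec′ {S′} S′v) (cong (2 * N +_) (sym (nominal-in {S′} S′v)))))
          ; cliques = λ Q′ Q⊑ cl → go Q′ Q⊑ cl (in? Q′ y) }
          where
          grow : ∀ x → 1 ≤ at x → suc (D S′ x) ≤ D S x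
          grow x 1≤ = ≤-trans (≤-reflexive (+-comm 1 _)) (≤-trans (+-monoʳ-≤ (D S′ x) 1≤) (≤-reflexive (sym (D-S′ x))))
          plain : ∀ Q′ → Q′ ⊑ S′ → Clique Q′ → ∀ u → In Q′ u → u ≢ y → u ≢ z → size Q′ < D S′ u
          plain Q′ Q⊑ cl u Qu u≢y u≢z = ≤-trans
            (D-clique {S} Q′ (λ t Qt → proj₁ (Q⊑ t Qt)) cl Qu (ns u (proj₁ (Q⊑ u Qu))))
            (≤-reflexive (sym (D-S′-other (Q⊑ u Qu) u≢y u≢z)))
          go : ∀ Q′ → Q′ ⊑ S′ → Clique Q′ → Dec (In Q′ y) → total Q′ (nominal S′) ≤ N
          go Q′ Q⊑ cl (yes Qy) = clique-except Q′ Q⊑ cl y (≤-trans (+-monoʳ-≤ 2 1≤at-y) yy) (grow y 1≤at-y)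
            λ u Qu u≢y → plain Q′ Q⊑ cl u Qu u≢y λ { refl → ¬yz (cl y z Qy Qu) }
          go Q′ Q⊑ cl (no ¬Qy) = clique-except Q′ Q⊑ cl z (≤-trans (+-monoʳ-≤ 2 1≤at-z) zz) (grow z 1≤at-z)
            λ u Qu u≢z → plain Q′ Q⊑ cl u Qu (λ { refl → ¬Qy Qu }) u≢z

        -- `overlap-bound` with Δ the smaller of the closed degrees of y and z in `S′` and s, t
        -- their numbers of neighbours in `K`. Larger degrees and a smaller κ only help, by
        -- monotonicity of ρ.
        scarce : ∀ {Δ s t Dy Dz} → 1 ≤ s → 1 ≤ t → 2 + s ≤ Δ → 2 + t ≤ Δ → Δ + s ≤ Dy → Δ + t ≤ Dz → Dy ≤ n → Dz ≤ n → κ ≤ s + t →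
          2 * ρ Dy + 2 * ρ Dz ≤ F + 2 * ρ Δ
        scarce {suc Δ} {s} {t} {Dy} {Dz} 1≤s 1≤t s< t< yle zle y≤n z≤n′ κ≤′ = begin
          2 * ρ Dy + 2 * ρ Dz ≤⟨ +-mono-≤ (*-monoʳ-≤ 2 (ρ-anti (s≤s z≤n) yle y≤n)) (*-monoʳ-≤ 2 (ρ-anti (s≤s z≤n) zle z≤n′)) ⟩
          2 * ρ (suc (Δ + s)) + 2 * ρ (suc (Δ + t)) ≤⟨ overlap-bound 1≤s 1≤t (≤-pred s<) (≤-pred t<)
            (spec (Δ + s) (≤-trans yle y≤n)) (spec (Δ + t) (≤-trans zle z≤n′)) (spec (s + t) st≤n) (spec Δ (≤-trans (s≤s (m≤m+n Δ s)) (≤-trans yle y≤n))) ⟩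
          ρ (suc (s + t)) + 2 * ρ (suc Δ) ≤⟨ +-monoˡ-≤ _ (ρ-anti (s≤s z≤n) (s≤s κ≤′) st≤n) ⟩
          F + 2 * ρ (suc Δ) ∎
          where
          open ≤-Reasoning
          spec : ∀ d → suc d ≤ n → (2 * d + 1) * ρ (suc d) ≡ 2 * N
          spec d le = trans (cong (_* ρ (suc d)) (+-comm (2 * d) 1)) (ρ-spec le)
          st≤n : suc (s + t) ≤ n
          st≤n = ≤-trans (s≤s (≤-trans (≤-reflexive (+-comm s t)) (+-monoˡ-≤ s (≤-trans (n≤1+n t) (≤-pred t<))))) (≤-trans yle y≤n)

        open Colourable (IH S′ size-S′ (nominal S′) S′-valid)

        C cF : ℕ
        C = suc c
        cF = C * F

        k : Fin n → ℕ
        k t = C * nominal S t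

        κcF≤L : κ * cF ≤ L
        κcF≤L = ≤-trans (≤-reflexive (i κ C F)) (≤-trans (*-monoʳ-≤ C (κρ≤N κ κ<n)) (≤-reflexive (sym L≡)))
          where
          i : ∀ κ C F → κ * (C * F) ≡ C * (κ * F)
          i = solve-∀

        k-K : ∀ {t} → In K t → k t ≤ cF
        k-K Kt = *-monoʳ-≤ C (nominal-K Kt)
        k-y : k y ≤ cF
        k-y = *-monoʳ-≤ C nominal-y
        k-z : k z ≤ cF
        k-z = *-monoʳ-≤ C nominal-z
        k-out : ∀ {t} → ¬ In S t → k t ≡ 0
        k-out {t} ¬St = trans (cong (C *_) (cong (_* ρ (D S t)) (⟨⟩-no (in? S t) ¬St))) (*-zeroʳ C)

        y≢z : y ≢ z
        y≢z refl = ¬yz E-refl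

        enough : ∀ {x} → In S x → In S′ x → k x ≤ ∣ φ x ∣
        enough {x} Sx S′x = ≤-trans (*-monoʳ-≤ C (≤-trans (≤-reflexive (nominal-in {S} Sx)) (≤-trans
            (ρ-anti (1≤D {S′} S′x) (≤-trans (m≤m+n _ _) (≤-reflexive (sym (D-S′ x)))) (D≤n S x)) (≤-reflexive (sym (nominal-in {S′} S′x))))))
          (≤-reflexive (sym (cnt x)))

        record Trimmed : Set where
          field
            Y Z : Colours L
            Y⊆ : Y ⊆ φ y
            Z⊆ : Z ⊆ φ z
            ∣Y∣ : ∣ Y ∣ ≡ k y
            ∣Z∣ : ∣ Z ∣ ≡ k z
            small : 2 * ∣ Y ∩ Z ∣ ≤ cF

        small-overlap : ∀ {x x′ v} → In S′ x → v + ∣ φ x ∣ ≤ k x + k x′ →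
          2 * nominal S x + 2 * nominal S x′ ≤ F + 2 * ρ (D S′ x) → 2 * v ≤ cF
        small-overlap {x} {x′} {v} S′x le bd = +-cancelʳ-≤ (C * (2 * ρ (D S′ x))) _ _ (begin
          2 * v + C * (2 * ρ (D S′ x)) ≡⟨ cong (λ w → 2 * v + C * (2 * w)) (sym (nominal-in {S′} S′x)) ⟩
          2 * v + C * (2 * nominal S′ x) ≡⟨ cong (2 * v +_) (trans (i₁ C (nominal S′ x)) (cong (2 *_) (sym (cnt x)))) ⟩
          2 * v + 2 * ∣ φ x ∣ ≡⟨ sym (*-distribˡ-+ 2 v ∣ φ x ∣) ⟩
          2 * (v + ∣ φ x ∣) ≤⟨ *-monoʳ-≤ 2 le ⟩
          2 * (C * nominal S x + C * nominal S x′) ≡⟨ i₂ C (nominal S x) (nominal S x′) ⟩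
          C * (2 * nominal S x + 2 * nominal S x′) ≤⟨ *-monoʳ-≤ C bd ⟩
          C * (F + 2 * ρ (D S′ x)) ≡⟨ *-distribˡ-+ C F _ ⟩
          cF + C * (2 * ρ (D S′ x)) ∎)
          where
          open ≤-Reasoning
          i₁ : ∀ C x → C * (2 * x) ≡ 2 * (C * x)
          i₁ = solve-∀
          i₂ : ∀ C x y → 2 * (C * x + C * y) ≡ C * (2 * x + 2 * y)
          i₂ = solve-∀

        trimmed-y : D S′ y ≤ D S′ z → Trimmed
        trimmed-y le = build (shrink (φ y) (φ z) (enough Sy S′y) (enough Sz S′z))
          where
          scarce-y : 2 * nominal S y + 2 * nominal S z ≤ F + 2 * ρ (D S′ y)
          scarce-y = ≤-trans (≤-reflexive (cong₂ (λ a b → 2 * a + 2 * b) (nominal-in {S} Sy) (nominal-in {S} Sz)))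
            (scarce 1≤at-y 1≤at-z yy zy (≤-reflexive (sym (D-S′ y))) (≤-trans (+-monoˡ-≤ (at z) le) (≤-reflexive (sym (D-S′ z)))) (D≤n S y) (D≤n S z) κ≤)
          go : ∀ {v} → v ≡ 0 ⊎ v + ∣ φ y ∣ ≤ k y + k z → 2 * v ≤ cF
          go (inj₁ e) = ≤-trans (≤-reflexive (cong (2 *_) e)) z≤n
          go (inj₂ le′) = small-overlap S′y le′ scarce-y
          build : _ → Trimmed
          build (Y , Z , Y⊆ , Z⊆ , ∣Y∣ , ∣Z∣ , ov) = record { Y = Y ; Z = Z ; Y⊆ = Y⊆ ; Z⊆ = Z⊆ ; ∣Y∣ = ∣Y∣ ; ∣Z∣ = ∣Z∣ ; small = go ov }

        trimmed-z : D S′ z ≤ D S′ y → Trimmed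
        trimmed-z le = build (shrink (φ z) (φ y) (enough Sz S′z) (enough Sy S′y))
          where
          scarce-z : 2 * nominal S z + 2 * nominal S y ≤ F + 2 * ρ (D S′ z)
          scarce-z = ≤-trans (≤-reflexive (cong₂ (λ a b → 2 * a + 2 * b) (nominal-in {S} Sz) (nominal-in {S} Sy)))
            (scarce 1≤at-z 1≤at-y zz yz (≤-reflexive (sym (D-S′ z))) (≤-trans (+-monoˡ-≤ (at y) le) (≤-reflexive (sym (D-S′ y)))) (D≤n S z) (D≤n S y)
              (≤-trans κ≤ (≤-reflexive (+-comm (at y) (at z)))))
          go : ∀ {v} → v ≡ 0 ⊎ v + ∣ φ z ∣ ≤ k z + k y → 2 * v ≤ cF
          go (inj₁ e) = ≤-trans (≤-reflexive (cong (2 *_) e)) z≤n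
          go (inj₂ le′) = small-overlap S′z le′ scarce-z
          build : _ → Trimmed
          build (Z , Y , Z⊆ , Y⊆ , ∣Z∣ , ∣Y∣ , ov) = record { Y = Y ; Z = Z ; Y⊆ = Y⊆ ; Z⊆ = Z⊆ ; ∣Y∣ = ∣Y∣ ; ∣Z∣ = ∣Z∣
            ; small = ≤-trans (≤-reflexive (cong (2 *_) (∩-comm Y Z))) (go ov) }

        abstract
          trimmed : Trimmed
          trimmed = [ trimmed-y , trimmed-z ]′ (≤-total (D S′ y) (D S′ z))

        open Trimmed trimmed

        φ₁ : Family L
        φ₁ = recolour (recolour φ y Y) z Z

        φ₁-z : φ₁ z ≡ Z
        φ₁-z = recolour-≡ (recolour φ y Y) z Z
        φ₁-y : φ₁ y ≡ Y
        φ₁-y = trans (recolour-≢ (recolour φ y Y) z Z y≢z) (recolour-≡ φ y Y)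
        φ₁-other : ∀ {t} → t ≢ y → t ≢ z → φ₁ t ≡ φ t
        φ₁-other ty tz = trans (recolour-≢ (recolour φ y Y) z Z tz) (recolour-≢ φ y Y ty)

        φ₁-proper : Proper φ₁
        φ₁-proper = ⊆-proper sub proper
          where
          sub : ∀ t → φ₁ t ⊆ φ t
          sub t = go (t ≟F y) (t ≟F z)
            where
            go : Dec (t ≡ y) → Dec (t ≡ z) → φ₁ t ⊆ φ t
            go (yes refl) _ i q = Y⊆ i (trans (cong (λ f → f i) (sym φ₁-y)) q)
            go (no _) (yes refl) i q = Z⊆ i (trans (cong (λ f → f i) (sym φ₁-z)) q)
            go (no ty) (no tz) i q = trans (cong (λ f → f i) (sym (φ₁-other ty tz))) q

        gate : ∀ {P : Set} → Dec P → ℕ → ℕ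
        gate P? x = ⟨ P? ⟩ * x

        gate-yes : ∀ {P : Set} (P? : Dec P) {x} → P → gate P? x ≡ x
        gate-yes P? {x} q = trans (cong (_* x) (⟨⟩-yes P? q)) (*-identityˡ x)
        gate-no : ∀ {P : Set} (P? : Dec P) {x} → ¬ P → gate P? x ≡ 0
        gate-no P? {x} q = cong (_* x) (⟨⟩-no P? q)
        gate≤ : ∀ {P : Set} (P? : Dec P) {x} → gate P? x ≤ x
        gate≤ P? {x} = ≤-trans (*-monoˡ-≤ x (⟨⟩≤1 P?)) (≤-reflexive (*-identityˡ x))

        card₁ : ∀ t → ∣ φ₁ t ∣ ≡ gate (¬? (in? K t)) (k t)
        card₁ t = split (t ≟F y) (t ≟F z)
          where
          out : ¬ In S′ t → C * nominal S′ t ≡ 0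
          out ¬S′ = trans (cong (C *_) (cong (_* ρ (D S′ t)) (⟨⟩-no (in? S′ t) ¬S′))) (*-zeroʳ C)
          go : t ≢ y → t ≢ z → Dec (In S t) → Dec (In K t) → C * nominal S′ t ≡ gate (¬? (in? K t)) (k t)
          go _ _ _ (yes Kt) = trans (out λ q → proj₂ q Kt) (sym (gate-no (¬? (in? K t)) λ ¬Kt → ¬Kt Kt))
          go _ _ (no ¬St) (no ¬Kt) = trans (out λ q → ¬St (proj₁ q)) (sym (trans (gate-yes (¬? (in? K t)) ¬Kt) (k-out ¬St)))
          go ty tz (yes St) (no ¬Kt) = trans (cong (C *_) (trans (nominal-in {S′} (St , ¬Kt)) (trans (cong ρ (D-S′-other (St , ¬Kt) ty tz)) (sym (nominal-in {S} St)))))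
            (sym (gate-yes (¬? (in? K t)) ¬Kt))
          split : Dec (t ≡ y) → Dec (t ≡ z) → ∣ φ₁ t ∣ ≡ gate (¬? (in? K t)) (k t)
          split (yes refl) _ = trans (cong ∣_∣ φ₁-y) (trans ∣Y∣ (sym (gate-yes (¬? (in? K t)) ¬Ky)))
          split (no _) (yes refl) = trans (cong ∣_∣ φ₁-z) (trans ∣Z∣ (sym (gate-yes (¬? (in? K t)) ¬Kz)))
          split (no ty) (no tz) = trans (cong ∣_∣ (φ₁-other ty tz)) (trans (cnt t) (go ty tz (in? S t) (in? K t)))

        -- A bound on what the neighbours of a vertex u of K use, if in K only vertices of P do.
        module Around {P : Fin n → Set} (P? : ∀ t → Dec (P t)) (k′ : Fin n → ℕ) (k′≤ : ∀ t → k′ t ≤ k t)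
          (k′-K : ∀ t → In K t → ¬ P t → k′ t ≡ 0) {u} (Ku : In K u) (a b : ℕ) (a-ok : E u y → k y ≤ a) (b-ok : E u z → k z ≤ b) where

          B : Fin n → ℕ
          B t = ⟨ t ≟F y ⟩ * a + ⟨ t ≟F z ⟩ * b + ⟨ P? t ⟩ * cF

          B-sum : ∑ B ≡ a + b + # P? * cF
          B-sum = trans (∑-+ _ _) (cong₂ _+_ (trans (∑-+ _ _) (cong₂ _+_ (∑-point y (λ _ → a)) (∑-point z (λ _ → b)))) (∑-*ʳ cF _))

          B-ok : ∀ t → Adj u t → k′ t ≤ B t
          B-ok t ut = go (in? S t)
            where
            on-K : In K t → Dec (P t) → k′ t ≤ B t
            on-K Kt (yes Pt) = ≤-trans (k′≤ t) (≤-trans (k-K Kt) (≤-trans (≤-reflexive (sym (gate-yes (P? t) Pt))) (m≤n+m _ (⟨ t ≟F y ⟩ * a + ⟨ t ≟F z ⟩ * b))))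
            on-K Kt (no ¬Pt) = ≤-trans (≤-reflexive (k′-K t Kt ¬Pt)) z≤n
            go : Dec (In S t) → k′ t ≤ B t
            go (no ¬St) = ≤-trans (k′≤ t) (≤-trans (≤-reflexive (k-out ¬St)) z≤n)
            go (yes St) with closed u t Ku St (inj₂ ut)
            ... | inj₁ Kt = on-K Kt (P? t)
            ... | inj₂ (inj₁ refl) = ≤-trans (k′≤ y) (≤-trans (a-ok (inj₂ ut)) (≤-trans (≤-reflexive (sym (gate-yes (t ≟F t) refl))) (≤-trans (m≤m+n _ _) (m≤m+n _ _))))
            ... | inj₂ (inj₂ refl) = ≤-trans (k′≤ z) (≤-trans (b-ok (inj₂ ut)) (≤-trans (≤-reflexive (sym (gate-yes (t ≟F t) refl))) (≤-trans (m≤n+m _ (⟨ t ≟F y ⟩ * a)) (m≤m+n _ _))))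

          around : ∀ own → own ≤ B u → own + load k′ u ≤ a + b + # P? * cF
          around own le = ≤-trans (load-bound k′ u own B le B-ok) (≤-reflexive B-sum)

          own-P : P u → cF ≤ B u
          own-P Pu = ≤-trans (≤-reflexive (sym (gate-yes (P? u) Pu))) (m≤n+m _ (⟨ u ≟F y ⟩ * a + ⟨ u ≟F z ⟩ * b))

        -- `K` is coloured in this order: the vertices adjacent to both y and z, then `p`, then
        -- those adjacent to one of y and z, and `o` last. Counted with its own, every vertex before
        -- `o` meets at most κ demands, each at most `cF`, and κ `cF` ≤ L; `o` meets κ + 1 demands
        -- and needs a repeated colour.
        Both : Fin n → Set
        Both t = In K t × E y t × E z t

        both? : ∀ t → Dec (Both t)
        both? t = in? K t ×-dec E? y t ×-dec E? z t

        #both : 2 + # both? ≤ κ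
        #both = ≤-trans (≤-reflexive (cong₂ (λ a b → a + b + # both?) (sym (#-one p)) (sym (#-one o))))
          (≤-trans (+-monoˡ-≤ (# both?) (#-disj (_≟F p) (_≟F o) po? (λ _ → inj₁) (λ _ → inj₂) λ { _ refl e → p≢o e }))
            (#-disj po? both? (in? K) (λ { _ (inj₁ refl) → Kp ; _ (inj₂ refl) → Ko }) (λ _ → proj₁)
              λ { _ (inj₁ refl) (_ , _ , zt) → ¬pz (E-sym zt) ; _ (inj₂ refl) (_ , yt , _) → ¬oy (E-sym yt) }))
          where po? = λ t → (t ≟F p) ⊎-dec (t ≟F o)

        keep? : ∀ t → Dec (¬ In K t ⊎ Both t)
        keep? t = ¬? (in? K t) ⊎-dec both? t

        k₃ : Fin n → ℕ
        k₃ t = gate (keep? t) (k t)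

        k₃-K : ∀ t → In K t → ¬ Both t → k₃ t ≡ 0
        k₃-K t Kt ¬b = gate-no (keep? t) λ { (inj₁ ¬Kt) → ¬Kt Kt ; (inj₂ b) → ¬b b }

        room₃ : ∀ u → Both u → k₃ u + load k₃ u ≤ L
        room₃ u bu@(Ku , _) = ≤-trans (around (k₃ u) (≤-trans (≤-trans (gate≤ (keep? u)) (k-K Ku)) (own-P bu)))
          (≤-trans (≤-reflexive (i cF (# both?))) (≤-trans (*-monoˡ-≤ cF #both) κcF≤L))
          where
          open Around both? k₃ (λ t → gate≤ (keep? t)) k₃-K Ku cF cF (λ _ → k-y) (λ _ → k-z)
          i : ∀ x m → x + x + m * x ≡ (2 + m) * x
          i = solve-∀

        abstract
          saturation₃ : Saturation φ₁ k₃ Both Both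
          saturation₃ = saturate φ₁ k₃ both? φ₁-proper
            (λ t → ≤-trans (≤-reflexive (card₁ t)) (*-monoˡ-≤ (k t) (⟨⟩-mono (¬? (in? K t)) (keep? t) inj₁))) room₃

        module S₃ = Saturation saturation₃

        card₃ : ∀ t → ∣ S₃.ψ t ∣ ≡ k₃ t
        card₃ t = go (both? t)
          where
          go : Dec (Both t) → ∣ S₃.ψ t ∣ ≡ k₃ t
          go (yes b) = S₃.exact t b b
          go (no ¬b) = trans (cong ∣_∣ (S₃.unchanged t ¬b)) (trans (card₁ t) (cong (_* k t) (⟨⟩-cong (¬? (in? K t)) (keep? t) inj₁
            λ { (inj₁ q) → q ; (inj₂ b) → contradiction b ¬b })))

        ψ₃-y : S₃.ψ y ≡ Y
        ψ₃-y = trans (S₃.unchanged y λ b → ¬Ky (proj₁ b)) φ₁-y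
        ψ₃-z : S₃.ψ z ≡ Z
        ψ₃-z = trans (S₃.unchanged z λ b → ¬Kz (proj₁ b)) φ₁-z

        -- The neighbours of `p` coloured so far are y and vertices adjacent to z; none of them uses
        -- a colour of `Z` outside `Y`, and z itself is not adjacent to `p`. These colours are
        -- wanted at `p` so that z and `p`, both adjacent to `o`, block them together.
        preferred : (Z ∖ Y) ⊆ free S₃.ψ p
        preferred i q = free-intro S₃.ψ p i λ t pt ti → clash t pt ti (in? S t)
          where
          iZ : S₃.ψ z i ≡ true
          iZ = trans (cong (λ f → f i) ψ₃-z) (∖-⊆ Z Y i q)
          empty : ∀ t → S₃.ψ t i ≡ true → k₃ t ≡ 0 → ⊥
          empty t ti e = ∣∣-nonempty (S₃.ψ t) (trans (card₃ t) e) i ti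
          on-K : ∀ t → S₃.ψ t i ≡ true → In K t → Dec (Both t) → ⊥
          on-K t ti Kt (no ¬b) = empty t ti (k₃-K t Kt ¬b)
          on-K t ti Kt (yes (_ , _ , zt)) = S₃.proper z t (E⇒Adj zt λ { refl → ¬Kz Kt }) i iZ ti
          on-S : ∀ t → Adj p t → S₃.ψ t i ≡ true → In K t ⊎ (t ≡ y ⊎ t ≡ z) → ⊥
          on-S t pt ti (inj₁ Kt) = on-K t ti Kt (both? t)
          on-S t pt ti (inj₂ (inj₁ refl)) = ∖-∌ Z Y i q (trans (cong (λ f → f i) (sym ψ₃-y)) ti)
          on-S t pt ti (inj₂ (inj₂ refl)) = ¬pz (inj₂ pt)
          clash : ∀ t → Adj p t → S₃.ψ t i ≡ true → Dec (In S t) → ⊥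
          clash t pt ti (no ¬St) = empty t ti (trans (cong (⟨ keep? t ⟩ *_) (k-out ¬St)) (*-zeroʳ ⟨ keep? t ⟩))
          clash t pt ti (yes St) = on-S t pt ti (closed p t Kp St (inj₂ pt))

        k-p : k p ≡ cF
        k-p = cong (C *_) (trans (nominal-in {S} (K⊑S p Kp)) (cong ρ D-p))
        k-o : k o ≡ cF
        k-o = cong (C *_) (trans (nominal-in {S} (K⊑S o Ko)) (cong ρ D-o))

        cF≤free-p : cF ≤ ∣ free S₃.ψ p ∣
        cF≤free-p = +-cancelʳ-≤ (load (λ t → ∣ S₃.ψ t ∣) p) _ _ (≤-trans (≤-trans
            (+-monoʳ-≤ cF (load-mono (λ t → ≤-reflexive (card₃ t)) p))
            (≤-trans (around cF (own-P (inj₂ refl))) (≤-trans (+-monoʳ-≤ (cF + 0) (*-monoˡ-≤ cF count)) (≤-trans (≤-reflexive (i cF (# both?))) (≤-trans (*-monoˡ-≤ cF #both) κcF≤L)))))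
          (free-count S₃.ψ p))
          where
          P? = λ t → both? t ⊎-dec (t ≟F p)
          open Around P? k₃ (λ t → gate≤ (keep? t)) (λ t Kt ¬P → k₃-K t Kt (λ b → ¬P (inj₁ b))) Kp cF 0 (λ _ → k-y) (λ pz → contradiction pz ¬pz)
          count : # P? ≤ # both? + 1
          count = ≤-trans (#-cover both? (_≟F p) P? (λ _ q → q)) (≤-reflexive (cong (# both? +_) (#-one p)))
          i : ∀ x m → x + 0 + (m + 1) * x ≡ (2 + m) * x
          i = solve-∀

        pick-p = between (Z ∖ Y) (free S₃.ψ p) preferred cF
          (≤-trans (∣∣-mono (∖-⊆ Z Y)) (≤-trans (≤-reflexive ∣Z∣) k-z)) cF≤free-p

        X : Colours L
        X = proj₁ pick-p

        φ₃ : Family L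
        φ₃ = recolour S₃.ψ p X

        φ₃-proper : Proper φ₃
        φ₃-proper = recolour-proper S₃.ψ p X S₃.proper λ t a i q → free-⟂ S₃.ψ p t a i (proj₁ (proj₂ (proj₂ pick-p)) i q)

        Rest : Fin n → Set
        Rest t = (In K t × ¬ Both t) × (t ≢ p × t ≢ o)

        rest? : ∀ t → Dec (Rest t)
        rest? t = (in? K t ×-dec ¬? (both? t)) ×-dec (¬? (t ≟F p) ×-dec ¬? (t ≟F o))

        k₄ : Fin n → ℕ
        k₄ t = gate (¬? (t ≟F o)) (k t)

        Ko? : ∀ t → Dec (In K t × t ≢ o)
        Ko? t = in? K t ×-dec ¬? (t ≟F o)

        #Ko : suc (# Ko?) ≡ κ
        #Ko = trans (cong (_+ # Ko?) (sym (#-one o))) (≤-antisym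
          (#-disj (_≟F o) Ko? (in? K) (λ { _ refl → Ko }) (λ _ → proj₁) (λ _ e q → proj₂ q e))
          (#-cover (_≟F o) Ko? (in? K) case))
          where
          case : ∀ t → In K t → t ≡ o ⊎ (In K t × t ≢ o)
          case t Kt with t ≟F o
          ... | yes e = inj₁ e
          ... | no ne = inj₂ (Kt , ne)

        k₄-K : ∀ t → In K t → ¬ (In K t × t ≢ o) → k₄ t ≡ 0
        k₄-K t Kt ¬q = gate-no (¬? (t ≟F o)) λ ne → ¬q (Kt , ne)

        room₄ : ∀ u → Rest u → k₄ u + load k₄ u ≤ L
        room₄ u ((Ku , ¬b) , (_ , u≢o)) = go (E? y u)
          where
          i : ∀ x m → x + 0 + m * x ≡ suc m * x
          i = solve-∀
          finish : cF + 0 + # Ko? * cF ≤ L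
          finish = ≤-trans (≤-reflexive (trans (i cF (# Ko?)) (cong (_* cF) #Ko))) κcF≤L
          own≤ : k₄ u ≤ cF
          own≤ = ≤-trans (gate≤ (¬? (u ≟F o))) (k-K Ku)
          go : Dec (E y u) → k₄ u + load k₄ u ≤ L
          go (yes yu) = ≤-trans (A.around (k₄ u) (≤-trans own≤ (A.own-P (Ku , u≢o)))) finish
            where module A = Around Ko? k₄ (λ t → gate≤ (¬? (t ≟F o))) k₄-K Ku cF 0 (λ _ → k-y) (λ uz → contradiction (Ku , yu , E-sym uz) ¬b)
          go (no ¬yu) = ≤-trans (A.around (k₄ u) (≤-trans own≤ (A.own-P (Ku , u≢o)))) (≤-trans (≤-reflexive (cong (_+ # Ko? * cF) (+-comm 0 cF))) finish)
            where module A = Around Ko? k₄ (λ t → gate≤ (¬? (t ≟F o))) k₄-K Ku 0 cF (λ uy → contradiction (E-sym uy) ¬yu) (λ _ → k-z)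

        ¬Both-o : ¬ Both o
        ¬Both-o b = ¬oy (E-sym (proj₁ (proj₂ b)))

        card-p : ∣ φ₃ p ∣ ≡ k₄ p
        card-p = trans (cong ∣_∣ (recolour-≡ S₃.ψ p X)) (trans (proj₂ (proj₂ (proj₂ pick-p))) (trans (sym k-p) (sym (gate-yes (¬? (p ≟F o)) p≢o))))

        card₃′ : ∀ {t} → t ≢ p → ∣ φ₃ t ∣ ≡ k₃ t
        card₃′ {t} tp = trans (cong ∣_∣ (recolour-≢ S₃.ψ p X tp)) (card₃ t)

        φ₃-bounded : ∀ t → ∣ φ₃ t ∣ ≤ k₄ t
        φ₃-bounded t = go (t ≟F p) (t ≟F o)
          where
          go : Dec (t ≡ p) → Dec (t ≡ o) → ∣ φ₃ t ∣ ≤ k₄ t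
          go (yes refl) _ = ≤-reflexive card-p
          go (no tp) (yes refl) = ≤-trans (≤-reflexive (trans (card₃′ tp) (k₃-K t Ko ¬Both-o))) z≤n
          go (no tp) (no to) = ≤-trans (≤-reflexive (card₃′ tp)) (≤-trans (gate≤ (keep? t)) (≤-reflexive (sym (gate-yes (¬? (t ≟F o)) to))))

        abstract
          saturation₄ : Saturation φ₃ k₄ Rest Rest
          saturation₄ = saturate φ₃ k₄ rest? φ₃-proper φ₃-bounded room₄

        module S₄ = Saturation saturation₄

        card₄ : ∀ t → ∣ S₄.ψ t ∣ ≡ k₄ t
        card₄ t = go (rest? t) (t ≟F p) (t ≟F o)
          where
          go : Dec (Rest t) → Dec (t ≡ p) → Dec (t ≡ o) → ∣ S₄.ψ t ∣ ≡ k₄ t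
          go (yes q) _ _ = S₄.exact t q q
          go (no ¬q) (yes refl) _ = trans (cong ∣_∣ (S₄.unchanged t ¬q)) card-p
          go (no ¬q) (no tp) (yes refl) = trans (cong ∣_∣ (S₄.unchanged t ¬q)) (trans (card₃′ tp) (trans (k₃-K t Ko ¬Both-o) (sym (gate-no (¬? (t ≟F o)) λ ne → ne refl))))
          go (no ¬q) (no tp) (no to) = trans (cong ∣_∣ (S₄.unchanged t ¬q)) (trans (card₃′ tp) (trans (gate-yes (keep? t) keep) (sym (gate-yes (¬? (t ≟F o)) to))))
            where
            keep : ¬ In K t ⊎ Both t
            keep with in? K t | both? t
            ... | no ¬Kt | _ = inj₁ ¬Kt
            ... | yes _ | yes b = inj₂ b
            ... | yes Kt | no ¬b = contradiction ((Kt , ¬b) , (tp , to)) ¬q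

        ψ₄-z : S₄.ψ z ≡ Z
        ψ₄-z = trans (S₄.unchanged z λ q → ¬Kz (proj₁ (proj₁ q))) (trans (recolour-≢ S₃.ψ p X λ { refl → ¬Kz Kp }) ψ₃-z)
        ψ₄-p : S₄.ψ p ≡ X
        ψ₄-p = trans (S₄.unchanged p λ q → proj₁ (proj₂ q) refl) (recolour-≡ S₃.ψ p X)

        -- Since z and `p` share all colours of `Z` outside `Y`, the demands around `o` use at most
        -- κ cF plus the size of the overlap of `Y` and `Z`. That overlap is at most half of cF, and
        -- (κ + 1/2) cF = L.
        cF≤free-o : cF ≤ ∣ free S₄.ψ o ∣
        cF≤free-o = +-cancelʳ-≤ (k z + # Ko? * cF) _ _ (begin
          cF + (k z + # Ko? * cF) ≡⟨ i₁ cF (k z) (# Ko?) ⟩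
          suc (# Ko?) * cF + k z ≡⟨ cong (λ m → m * cF + k z) #Ko ⟩
          κ * cF + k z ≡⟨ cong (κ * cF +_) (trans (sym ∣Z∣) (sym (∣∖∣ Z Y))) ⟩
          κ * cF + (∣ Z ∖ Y ∣ + ∣ Z ∩ Y ∣) ≡⟨ i₂ (κ * cF) ∣ Z ∖ Y ∣ ∣ Z ∩ Y ∣ ⟩
          (κ * cF + ∣ Z ∩ Y ∣) + ∣ Z ∖ Y ∣ ≤⟨ +-mono-≤ total-room (∣∣-mono meet) ⟩
          L + ∣ S₄.ψ z ∩ S₄.ψ p ∣ ≤⟨ free-count₂ S₄.ψ (E⇒Adj oz λ { refl → ¬Kz Ko }) (E⇒Adj (K-clique o p Ko Kp) (λ e → p≢o (sym e))) (λ { refl → ¬Kz Kp }) ⟩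
          ∣ free S₄.ψ o ∣ + load (λ t → ∣ S₄.ψ t ∣) o ≤⟨ +-monoʳ-≤ ∣ free S₄.ψ o ∣ (≤-trans (load-mono (λ t → ≤-reflexive (card₄ t)) o) (A.around 0 z≤n)) ⟩
          ∣ free S₄.ψ o ∣ + (k z + # Ko? * cF) ∎)
          where
          open ≤-Reasoning
          module A = Around Ko? k₄ (λ t → gate≤ (¬? (t ≟F o))) k₄-K Ko 0 (k z) (λ oy → contradiction oy ¬oy) (λ _ → ≤-refl)
          i₁ : ∀ x y m → x + (y + m * x) ≡ suc m * x + y
          i₁ = solve-∀
          i₂ : ∀ a b c → a + (b + c) ≡ (a + c) + b
          i₂ = solve-∀
          meet : (Z ∖ Y) ⊆ (S₄.ψ z ∩ S₄.ψ p)
          meet i q = ∩-intro (S₄.ψ z) (S₄.ψ p) i (trans (cong (λ f → f i) ψ₄-z) (∖-⊆ Z Y i q))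
            (trans (cong (λ f → f i) ψ₄-p) (proj₁ (proj₂ pick-p) i q))
          total-room : κ * cF + ∣ Z ∩ Y ∣ ≤ L
          total-room = *-cancelˡ-≤ 2 (begin
            2 * (κ * cF + ∣ Z ∩ Y ∣) ≡⟨ *-distribˡ-+ 2 (κ * cF) _ ⟩
            2 * (κ * cF) + 2 * ∣ Z ∩ Y ∣ ≤⟨ +-monoʳ-≤ (2 * (κ * cF)) (≤-trans (≤-reflexive (cong (2 *_) (∩-comm Z Y))) small) ⟩
            2 * (κ * cF) + cF ≡⟨ i₃ κ C F ⟩
            C * (suc (2 * κ) * F) ≡⟨ cong (C *_) (ρ-spec κ<n) ⟩
            C * (2 * N) ≡⟨ i₄ C N ⟩
            2 * (C * N) ≡⟨ cong (2 *_) (sym L≡) ⟩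
            2 * L ∎)
            where
            i₃ : ∀ κ C F → 2 * (κ * (C * F)) + C * F ≡ C * (suc (2 * κ) * F)
            i₃ = solve-∀
            i₄ : ∀ C N → C * (2 * N) ≡ 2 * (C * N)
            i₄ = solve-∀

        pick-o = subcolours (free S₄.ψ o) cF cF≤free-o

        reduction : Colourable N (nominal S)
        reduction = record { c = c ; L = L ; L≡ = L≡ ; φ = recolour S₄.ψ o (proj₁ pick-o)
          ; proper = recolour-proper S₄.ψ o (proj₁ pick-o) S₄.proper λ t a i q → free-⟂ S₄.ψ o t a i (proj₁ (proj₂ pick-o) i q)
          ; cnt = count }
          where
          count : ∀ v → ∣ recolour S₄.ψ o (proj₁ pick-o) v ∣ ≡ C * nominal S v
          count v = go (v ≟F o)
            where
            go : Dec (v ≡ o) → ∣ recolour S₄.ψ o (proj₁ pick-o) v ∣ ≡ C * nominal S v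
            go (yes refl) = trans (cong ∣_∣ (recolour-≡ S₄.ψ o (proj₁ pick-o))) (trans (proj₂ (proj₂ pick-o)) (sym k-o))
            go (no ne) = trans (cong ∣_∣ (recolour-≢ S₄.ψ o (proj₁ pick-o) ne)) (trans (card₄ v) (gate-yes (¬? (v ≟F o)) ne))

  choice : ∀ {n} {A : Set} {P : Fin n → Set} → (∀ x → A ⊎ P x) → A ⊎ (∀ x → P x)
  choice {zero} f = inj₂ λ ()
  choice {suc n} f with f zero | choice (λ x → f (suc x))
  ... | inj₁ a | _ = inj₁ a
  ... | inj₂ _ | inj₁ a = inj₁ a
  ... | inj₂ p | inj₂ q = inj₂ λ { zero → p ; (suc x) → q x }

  -- Neighbourhoods that lack one edge, and mates

  module Mates {n : ℕ} (G : SimpleGraph n) (S : Graphs.Sub G) where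

    open Demands G

    -- The closed neighbourhood of u lacks exactly the edge yz.
    record Lacks (u y z : Fin n) : Set where
      constructor lacks
      field
        Su : In S u
        Sy : In S y
        Sz : In S z
        uy : E u y
        uz : E u z
        ¬yz : ¬ E y z
        only : ∀ s t → In S s → In S t → E u s → E u t → ¬ E s t → (s ≡ y × t ≡ z) ⊎ (s ≡ z × t ≡ y)
    open Lacks

    Lacks? : ∀ u y z → Dec (Lacks u y z)
    Lacks? u y z with in? S u | in? S y | in? S z | E? u y | E? u z | ¬? (E? y z)
      | all? (λ s → all? λ t → in? S s →-dec in? S t →-dec E? u s →-dec E? u t →-dec ¬? (E? s t) →-dec
          (((s ≟F y) ×-dec (t ≟F z)) ⊎-dec ((s ≟F z) ×-dec (t ≟F y))))
    ... | yes a | yes b | yes c | yes d | yes e | yes f | yes g = yes (lacks a b c d e f g)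
    ... | no ¬a | _ | _ | _ | _ | _ | _ = no λ b → ¬a (Su b)
    ... | _ | no ¬a | _ | _ | _ | _ | _ = no λ b → ¬a (Sy b)
    ... | _ | _ | no ¬a | _ | _ | _ | _ = no λ b → ¬a (Sz b)
    ... | _ | _ | _ | no ¬a | _ | _ | _ = no λ b → ¬a (uy b)
    ... | _ | _ | _ | _ | no ¬a | _ | _ = no λ b → ¬a (uz b)
    ... | _ | _ | _ | _ | _ | no ¬a | _ = no λ b → ¬a (¬yz b)
    ... | _ | _ | _ | _ | _ | _ | no ¬a = no λ b → ¬a (only b)

    Lacks-sym : ∀ {u y z} → Lacks u y z → Lacks u z y
    Lacks-sym b = lacks (Su b) (Sz b) (Sy b) (uz b) (uy b) (λ e → ¬yz b (E-sym e))
      λ s t Ss St us ut ¬st → Sum.swap (only b s t Ss St us ut ¬st)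

    Twin : Fin n → Fin n → Set
    Twin u t = In S t × (∀ w → In S w → (E u w → E t w) × (E t w → E u w))

    twin? : ∀ u t → Dec (Twin u t)
    twin? u t = in? S t ×-dec all? λ w → in? S w →-dec ((E? u w →-dec E? t w) ×-dec (E? t w →-dec E? u w))

    twins : Fin n → ℕ
    twins u = # (twin? u)

    -- When this fails, y has the degree that `simplicial-gain-large` asks for at u once the other
    -- end of the missing edge is deleted alone.
    Tight : Fin n → Fin n → Set
    Tight u y = 2 + D S y ≤ twins u + D S u

    dominates : ∀ {u y z t} → Lacks u y z → In S t → E u t → t ≢ y → t ≢ z → ∀ w → In S w → E u w → E t w
    dominates {t = t} b St ut t≢y t≢z w Sw uw = decidable-stable (E? t w) λ ¬tw → go (only b t w St Sw ut uw ¬tw)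
      where
      go : ¬ ((t ≡ _ × w ≡ _) ⊎ (t ≡ _ × w ≡ _))
      go (inj₁ (e , _)) = t≢y e
      go (inj₂ (e , _)) = t≢z e

    ends≢ : ∀ {u y z} → Lacks u y z → y ≢ z
    ends≢ b refl = ¬yz b E-refl

    near-end : ∀ {u y z t} → Lacks u y z → In S t → E u t → t ≢ z → E y t
    near-end {y = y} {t = t} b St ut t≢z with t ≟F y
    ... | yes refl = E-refl
    ... | no t≢y = E-sym (dominates b St ut t≢y t≢z y (Sy b) (uy b))

    -- The closed neighbourhood of u without z is contained in that of y, and `B` lies in the rest
    -- of it.
    end-degree : ∀ {u y z} → Lacks u y z → {B : Fin n → Set} (B? : ∀ t → Dec (B t)) → (∀ t → B t → In S t × E y t) →
      (∀ t → B t → ¬ E u t) → # B? + D S u ≤ suc (D S y)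
    end-degree {u} {y} {z} b B? B⊆ B-far = begin
      # B? + D S u ≤⟨ +-monoʳ-≤ (# B?) (#-cover (_≟F z) near≢z? (near? S u) case) ⟩
      # B? + (# (_≟F z) + # near≢z?) ≡⟨ cong (λ x → # B? + (x + # near≢z?)) (#-one z) ⟩
      # B? + suc (# near≢z?) ≡⟨ +-suc _ _ ⟩
      suc (# B? + # near≢z?) ≤⟨ s≤s (#-disj B? near≢z? (near? S y) B⊆ (λ t ((St , ut) , t≢z) → St , near-end b St ut t≢z)
        (λ t Bt ((_ , ut) , _) → B-far t Bt ut)) ⟩
      suc (D S y) ∎
      where
      open ≤-Reasoning
      near≢z? = λ t → near? S u t ×-dec ¬? (t ≟F z)
      case : ∀ t → In S t × E u t → t ≡ z ⊎ ((In S t × E u t) × t ≢ z)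
      case t q with t ≟F z
      ... | yes e = inj₁ e
      ... | no ne = inj₂ (q , ne)

    -- If no twin of u₁ is near u₂, the twins lie near y but not near u₂, and `end-degree`
    -- contradicts tightness. A twin t near u₂ is adjacent to y and z₁, so it is no end at u₂ and
    -- dominates u₂. Thus u₁ dominates u₂, the degrees force equal closed neighbourhoods, and y z₁
    -- is the edge missing at u₂.
    end-unique : ∀ {u₁ u₂ y z₁ z₂} → Lacks u₁ y z₁ → Tight u₁ y → Lacks u₂ y z₂ → D S u₁ ≤ D S u₂ → z₁ ≡ z₂
    end-unique {u₁} {u₂} {y} {z₁} {z₂} b₁ tight b₂ le with any? (λ t → twin? u₁ t ×-dec E? u₂ t)
    ... | no ¬t = contradiction (begin
      2 + D S y ≤⟨ tight ⟩
      twins u₁ + D S u₁ ≤⟨ +-monoʳ-≤ (twins u₁) le ⟩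
      twins u₁ + D S u₂ ≤⟨ end-degree b₂ (twin? u₁) (λ t (St , tw) → St , E-sym (proj₁ (tw y (Sy b₁)) (uy b₁))) (λ t tw u₂t → ¬t (t , tw , u₂t)) ⟩
      suc (D S y) ∎) (<⇒≱ (n<1+n (suc (D S y))))
      where open ≤-Reasoning
    ... | yes (t , (St , tw) , u₂t) = go (only b₂ y z₁ (Sy b₁) (Sz b₁) (uy b₂) u₂z₁ (¬yz b₁))
      where
      ty : E t y
      ty = proj₁ (tw y (Sy b₁)) (uy b₁)
      tz₁ : E t z₁
      tz₁ = proj₁ (tw z₁ (Sz b₁)) (uz b₁)
      sub : ∀ w → In S w × E u₂ w → In S w × E u₁ w
      sub w (Sw , u₂w) = Sw , proj₂ (tw w Sw) (dominates b₂ St u₂t (λ { refl → ¬yz b₁ tz₁ }) (λ { refl → ¬yz b₂ (E-sym ty) }) w Sw u₂w)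
      u₂z₁ : E u₂ z₁
      u₂z₁ = proj₂ (#-full (near? S u₂) (near? S u₁) sub le z₁ (Sz b₁ , uz b₁))
      go : (y ≡ y × z₁ ≡ z₂) ⊎ (y ≡ z₂ × z₁ ≡ y) → z₁ ≡ z₂
      go (inj₁ (_ , e)) = e
      go (inj₂ (e , _)) = contradiction e (ends≢ b₂)

    Mate : Fin n → Fin n → Set
    Mate y z = ∃ λ u → Lacks u y z × Tight u y × Tight u z

    Mate? : ∀ y z → Dec (Mate y z)
    Mate? y z = any? λ u → Lacks? u y z ×-dec (_ ≤? _) ×-dec (_ ≤? _)

    Mate-sym : ∀ {y z} → Mate y z → Mate z y
    Mate-sym (u , b , ty , tz) = u , Lacks-sym b , tz , ty

    Mate-unique : ∀ {y z₁ z₂} → Mate y z₁ → Mate y z₂ → z₁ ≡ z₂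
    Mate-unique (u₁ , b₁ , t₁ , _) (u₂ , b₂ , t₂ , _) with ≤-total (D S u₁) (D S u₂)
    ... | inj₁ le = end-unique b₁ t₁ b₂ le
    ... | inj₂ le = sym (end-unique b₂ t₂ b₁ le)

    abstract
      partner : Fin n → Fin n
      partner y with any? (Mate? y)
      ... | yes (z , _) = z
      ... | no _ = y

      partner-mate : ∀ {y z} → Mate y z → partner y ≡ z
      partner-mate {y} {z} m with any? (Mate? y)
      ... | yes (z′ , m′) = Mate-unique m′ m
      ... | no ¬m = contradiction (z , m) ¬m

      partner-cases : ∀ y → Mate y (partner y) ⊎ partner y ≡ y
      partner-cases y with any? (Mate? y)
      ... | yes (z , m) = inj₁ m
      ... | no _ = inj₂ refl

    partner-invol : ∀ x → partner (partner x) ≡ x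
    partner-invol x with partner-cases x
    ... | inj₁ m = partner-mate (Mate-sym m)
    ... | inj₂ e = trans (cong partner e) e

    partner-In : ∀ x → In S x → In S (partner x)
    partner-In x Sx with partner-cases x
    ... | inj₁ (_ , b , _) = Sz b
    ... | inj₂ e = subst (In S) (sym e) Sx

    partner-Mate : ∀ x → partner x ≢ x → Mate x (partner x)
    partner-Mate x ne with partner-cases x
    ... | inj₁ m = m
    ... | inj₂ e = contradiction e ne

    partner-apart : ∀ x → partner x ≢ x → ¬ E x (partner x)
    partner-apart x ne = ¬yz (proj₁ (proj₂ (partner-Mate x ne)))

    open Averaging.Matching G S partner partner-invol partner-In partner-apart public

  -- The averaging inequality at a vertex

  module Step {n : ℕ} (G : SimpleGraph n) (S : Graphs.Sub G) (ns : Graphs.NonSimplicial G S) (IH : Graphs.Hypothesis G S) where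

    open Demands G
    open Mates G S
    open Lacks
    open Components G

    Goal : Set
    Goal = Colourable N (nominal S)

    same-group : ∀ {x y w} → Mem x y → Mem x w → Mem y w
    same-group (inj₁ refl) m = m
    same-group {x} (inj₂ refl) (inj₁ refl) = inj₂ (sym (partner-invol x))
    same-group (inj₂ refl) (inj₂ e) = inj₁ e

    cut-⊑ : ∀ {x y} → Mem x y → cut x ⊑ cut y
    cut-⊑ m t (St , ¬m) = St , λ m′ → ¬m (same-group (Mem-sym m) m′)

    -- After the deletion of the mates y and y′ the clique v ∈ K is a component.
    component : ∀ {v x y z} → In S v → ¬ Mem x v → Simplicial (cut x) v → (∀ t → In (cut x) t → E v t → Simplicial (cut x) t) →
      In S y → In S z → E v y → E v z → ¬ E y z → Mem x y → ¬ E v (partner y) → partner y ≢ y → Goal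
    component {v} {x} {y} {z} Sv ¬mv sv all Sy′ Sz′ vy vz ¬yz′ my ¬vy′ ne with partner-Mate y ne
    ... | u , b , tight-y , tight-y′ = R.reduction (cond at-y y-big) (cond at-y y′-big) (cond at-y′ y-big) (cond at-y′ y′-big)
      where
      X = cut x
      y′ = partner y
      K : Sub
      K = record { In = λ t → In X t × E v t ; in? = near? X v }
      my′ : Mem x y′
      my′ = same-group (Mem-sym my) (inj₂ refl)
      in-X : ∀ {w} → In S w → w ≢ y → w ≢ y′ → In X w
      in-X Sw wy wy′ = Sw , λ m → go (same-group my m)
        where
        go : ¬ Mem y _
        go (inj₁ e) = wy e
        go (inj₂ e) = wy′ e
      z≢y : z ≢ y
      z≢y refl = ¬yz′ E-refl
      z≢y′ : z ≢ y′
      z≢y′ refl = ¬vy′ vz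
      Kz : In K z
      Kz = in-X Sz′ z≢y z≢y′ , vz
      clique : Clique K
      clique s t (Xs , vs) (Xt , vt) = sv s t Xs Xt vs vt
      closed : ∀ t w → In K t → In S w → E t w → In K w ⊎ (w ≡ y ⊎ w ≡ y′)
      closed t w (Xt , vt) Sw tw with w ≟F y | w ≟F y′
      ... | yes e | _ = inj₂ (inj₁ e)
      ... | no _ | yes e = inj₂ (inj₂ e)
      ... | no wy | no wy′ = inj₁ (in-X Sw wy wy′ , all t Xt vt v w (Sv , ¬mv) (in-X Sw wy wy′) (E-sym vt) tw)
      -- z is nonsimplicial in `S`, so it has a neighbour outside the clique `K`; this is y or y′,
      -- and y is excluded.
      zy′ : E z y′
      zy′ with ¬Simplicial S z (ns z Sz′)
      ... | s , t , Ss , St , zs , zt , ¬st with closed z s Kz Ss zs | closed z t Kz St zt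
      ...   | inj₂ (inj₁ refl) | _ = contradiction (E-sym zs) ¬yz′
      ...   | inj₂ (inj₂ refl) | _ = zs
      ...   | inj₁ _ | inj₂ (inj₁ refl) = contradiction (E-sym zt) ¬yz′
      ...   | inj₁ _ | inj₂ (inj₂ refl) = zt
      ...   | inj₁ Ks | inj₁ Kt = contradiction (clique s t Ks Kt) ¬st
      attachment : Attached S K y y′ v z
      attachment = record { K⊑S = λ _ q → proj₁ (proj₁ q) ; K-clique = clique
        ; Sy = Sy′ ; Sz = Sz b ; ¬yz = ¬yz b ; ¬Ky = λ q → proj₂ (proj₁ q) my ; ¬Kz = λ q → proj₂ (proj₁ q) my′ ; closed = closed
        ; Kp = (Sv , ¬mv) , E-refl ; py = vy ; ¬pz = ¬vy′ ; Ko = Kz ; oz = zy′ ; ¬oy = λ zy → ¬yz′ (E-sym zy) }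
      module R = Reduction S ns IH K attachment
      u≢y : u ≢ y
      u≢y refl = ¬yz b (uz b)
      u≢y′ : u ≢ y′
      u≢y′ refl = ¬yz b (E-sym (uy b))
      -- A vertex of `K` near u would put u into `K`. Then z would be near u as well, and y z would
      -- be a second missing edge there.
      far : ∀ t → In S t → E u t → ¬ In K t
      far t St ut Kt = go (closed t u Kt (Su b) (dominates b St ut t≢y t≢y′ u (Su b) E-refl))
        where
        t≢y : t ≢ y
        t≢y refl = proj₂ (proj₁ Kt) my
        t≢y′ : t ≢ y′
        t≢y′ refl = proj₂ (proj₁ Kt) my′
        go : ¬ (In K u ⊎ (u ≡ y ⊎ u ≡ y′))
        go (inj₂ (inj₁ e)) = u≢y e
        go (inj₂ (inj₂ e)) = u≢y′ e
        go (inj₁ Ku) with only b z y Sz′ Sy′ (clique u z Ku Kz) (uy b) (λ zy → ¬yz′ (E-sym zy))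
        ... | inj₁ (e , _) = z≢y e
        ... | inj₂ (e , _) = z≢y′ e
      big : ∀ {s s′} → Lacks u s s′ → D S u ≤ suc (D R.S′ s)
      big {s} {s′} b′ = ≤-trans (#-cover (_≟F s′) (near? R.S′ s) (near? S u) case) (≤-reflexive (cong (_+ D R.S′ s) (#-one s′)))
        where
        case : ∀ t → In S t × E u t → t ≡ s′ ⊎ (In R.S′ t × E s t)
        case t (St , ut) with t ≟F s′
        ... | yes e = inj₁ e
        ... | no ne = inj₂ ((St , far t St ut) , near-end b′ St ut ne)
      -- `twins u` separates the two sides in the conditions of the reduction: by tightness it
      -- exceeds the number of neighbours of y or y′ in `K`, and it is below their closed degrees
      -- outside `K`, because y and y′ are near u without being twins of it.
      twins≤ : 2 + twins u ≤ D S u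
      twins≤ = ≤-trans (≤-reflexive (cong₂ (λ p q → p + q + twins u) (sym (#-one y)) (sym (#-one y′))))
        (≤-trans (+-monoˡ-≤ (twins u) (#-disj (_≟F y) (_≟F y′) yy′? (λ _ → inj₁) (λ _ → inj₂) λ { _ refl e → ends≢ b e }))
          (#-disj yy′? (twin? u) (near? S u) (λ { _ (inj₁ refl) → Sy b , uy b ; _ (inj₂ refl) → Sz b , uz b })
            (λ t (St , tw) → St , E-sym (proj₁ (tw u (Su b)) E-refl))
            λ { _ (inj₁ refl) (_ , tw) → ¬yz b (proj₁ (tw y′ (Sz b)) (uz b)) ; _ (inj₂ refl) (_ , tw) → ¬yz b (E-sym (proj₁ (tw y (Sy b)) (uy b))) }))
        where yy′? = λ t → (t ≟F y) ⊎-dec (t ≟F y′)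
      y-big : suc (twins u) ≤ D R.S′ y
      y-big = ≤-pred (≤-trans twins≤ (big b))
      y′-big : suc (twins u) ≤ D R.S′ y′
      y′-big = ≤-pred (≤-trans twins≤ (big (Lacks-sym b)))
      at-small : ∀ {s s′} → Lacks u s s′ → Tight u s → suc (R.at s) ≤ twins u
      at-small {s} b′ tight = +-cancelʳ-≤ (suc (D R.S′ s)) _ _ (begin
        suc (R.at s) + suc (D R.S′ s) ≡⟨ i (R.at s) (D R.S′ s) ⟩
        2 + (D R.S′ s + R.at s) ≡⟨ cong (2 +_) (sym (R.D-S′ s)) ⟩
        2 + D S s ≤⟨ tight ⟩
        twins u + D S u ≤⟨ +-monoʳ-≤ (twins u) (big b′) ⟩
        twins u + suc (D R.S′ s) ∎)
        where
        open ≤-Reasoning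
        i : ∀ a d → suc a + suc d ≡ 2 + (d + a)
        i = solve-∀
      at-y = at-small b tight-y
      at-y′ = at-small (Lacks-sym b) tight-y′
      cond : ∀ {a s} → suc a ≤ twins u → suc (twins u) ≤ D R.S′ s → 2 + a ≤ D R.S′ s
      cond le le′ = ≤-trans (s≤s le) le′

    module At {v : Fin n} (Sv : In S v) {δ : ℕ} (D≡ : D S v ≡ 3 + δ) where

      r = ρ (D S v)

      Bound : Set
      Bound = ∑ w * r ≤ ∑ (λ x → w x * demand (cut x) v)

      missing-hit : ∀ {x y z} → Simplicial (cut x) v → In S y → In S z → E v y → E v z → ¬ E y z → Mem x y ⊎ Mem x z
      missing-hit {x} {y} {z} sv Sy Sz vy vz ¬yz with mem? x y | mem? x z
      ... | yes m | _ = inj₁ m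
      ... | no _ | yes m = inj₂ m
      ... | no ¬my | no ¬mz = contradiction (sv y z (Sy , ¬my) (Sz , ¬mz) vy vz) ¬yz

      pair≢ : ∀ {y z} → E v z → ¬ E y z → y ≢ v
      pair≢ vz ¬yz refl = ¬yz vz

      hits-pos : ∀ {x y} → In S y → E v y → y ≢ v → Mem x y → 1 ≤ hits v x
      hits-pos {x} {y} Sy vy y≢v m = ≤-trans (≤-reflexive (sym (cong₂ _*_ (⟨⟩-yes (nbr? v y) ((Sy , vy) , y≢v)) (⟨⟩-yes (mem? x y) m)))) (term≤∑ _ y)

      hits-two : ∀ {x y y′} → y ≢ y′ → In S y → E v y → y ≢ v → Mem x y → In S y′ → E v y′ → y′ ≢ v → Mem x y′ → 2 ≤ hits v x
      hits-two {x} {y} {y′} ne Sy vy y≢v m Sy′ vy′ y′≢v m′ = ≤-trans (≤-reflexive (sym (cong₂ _+_ (#-one y) (#-one y′))))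
        (≤-trans (≤-reflexive (sym (∑-+ _ _))) (∑-mono λ t → pt t (t ≟F y) (t ≟F y′)))
        where
        full : ∀ {t} → In S t → E v t → t ≢ v → Mem x t → 1 ≤ ⟨ nbr? v t ⟩ * ⟨ mem? x t ⟩
        full {t} St vt t≢v mt = ≤-reflexive (sym (cong₂ _*_ (⟨⟩-yes (nbr? v t) ((St , vt) , t≢v)) (⟨⟩-yes (mem? x t) mt)))
        pt : ∀ t (e? : Dec (t ≡ y)) (e′? : Dec (t ≡ y′)) → ⟨ e? ⟩ + ⟨ e′? ⟩ ≤ ⟨ nbr? v t ⟩ * ⟨ mem? x t ⟩
        pt t (yes refl) (yes e) = contradiction e ne
        pt t (yes refl) (no _) = full Sy vy y≢v m
        pt t (no _) (yes refl) = full Sy′ vy′ y′≢v m′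
        pt t (no _) (no _) = z≤n

      -- Suppose that all neighbours of v left are simplicial. If y was deleted alone, z has lost no
      -- neighbour and would be simplicial in `S`. If it was deleted with a mate, that mate is not
      -- near v, as there is only one hit, and the closed neighbourhood of v is a component to which
      -- the reduction applies.
      gain-or-goal′ : ∀ {x y z} → ¬ Mem x v → Simplicial (cut x) v → In S y → In S z → E v y → E v z → ¬ E y z →
        Mem x y → hits v x ≡ 1 → Goal ⊎ (3 + 2 * δ) * r ≤ (2 + 2 * δ) * demand (cut x) v
      gain-or-goal′ {x} {y} {z} ¬mv sv Sy Sz vy vz ¬yz my h≡ with any? (other? (cut x) v)
      ... | yes (t , o) = inj₂ (simplicial-gain₁ Sv D≡ ¬mv sv h≡ (#-pos (other? (cut x) v) t o))
      ... | no ¬o with partner y ≟F y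
      ...   | no ne = inj₁ (component Sv ¬mv sv all Sy Sz vy vz ¬yz my ¬vy′ ne)
        where
        all : ∀ t → In (cut x) t → E v t → Simplicial (cut x) t
        all t Xt vt = decidable-stable (Simplicial? (cut x) t) λ ¬s → ¬o (t , (Xt , vt) , ¬s)
        my′ : Mem x (partner y)
        my′ = same-group (Mem-sym my) (inj₂ refl)
        ¬vy′ : ¬ E v (partner y)
        ¬vy′ vy′ = contradiction (≤-trans (hits-two (λ e → ne (sym e)) Sy vy (pair≢ vz ¬yz) my (partner-In y Sy) vy′ (λ e → ¬mv (subst (Mem x) e my′)) my′) (≤-reflexive h≡)) λ { (s≤s ()) }
      ...   | yes e = contradiction simp (ns z Sz)
        where
        in-X : ∀ {t} → In S t → E z t → In (cut x) t
        in-X {t} St zt = St , λ m → go (same-group my m)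
          where
          absurd : t ≢ y
          absurd refl = ¬yz (E-sym zt)
          go : ¬ Mem y t
          go (inj₁ p) = absurd p
          go (inj₂ p) = absurd (trans p e)
        simp : Simplicial S z
        simp s t Ss St zs zt = decidable-stable (E? s t) λ ¬st →
          ¬o (z , (in-X Sz E-refl , vz) , λ sz → ¬st (sz s t (in-X Ss zs) (in-X St zt) zs zt))

      gain-or-goal : ∀ {x y z} → ¬ Mem x v → Simplicial (cut x) v → In S y → In S z → E v y → E v z → ¬ E y z →
        hits v x ≡ 1 → Goal ⊎ (3 + 2 * δ) * r ≤ (2 + 2 * δ) * demand (cut x) v
      gain-or-goal ¬mv sv Sy Sz vy vz ¬yz h≡ with missing-hit sv Sy Sz vy vz ¬yz
      ... | inj₁ my = gain-or-goal′ ¬mv sv Sy Sz vy vz ¬yz my h≡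
      ... | inj₂ mz = gain-or-goal′ ¬mv sv Sz Sy vz vy (λ zy → ¬yz (E-sym zy)) mz h≡

      -- The deletions that make v simplicial all contain h, so they have total weight 2. Each has a
      -- deficit of at most r, which is just the budget.
      one-hit : ∀ {y z h} → In S y → In S z → E v y → E v z → ¬ E y z → In S h →
        (∀ x → ¬ Mem x v → Simplicial (cut x) v → Mem x h) → Goal ⊎ Bound
      one-hit {y} {z} {h} Sy Sz vy vz ¬yz Sh hit = finish (choice per)
        where
        q = 3 + 2 * δ
        P : Fin n → Set
        P x = ¬ Mem x v → 1 * (q * r + 2 * r * hits v x) ≤ 1 * (q * demand (cut x) v) + ⟨ mem? x h ⟩ * r
        from : ∀ {x} → Mem x h → q * r + 2 * r * hits v x ≤ q * demand (cut x) v + r → P x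
        from {x} m le _ = ≤-trans (≤-reflexive (*-identityˡ _)) (≤-trans le (≤-reflexive (cong₂ _+_ (sym (*-identityˡ _))
          (sym (trans (cong (_* r) (⟨⟩-yes (mem? x h) m)) (*-identityˡ r))))))
        per : ∀ x → Goal ⊎ P x
        per x with mem? x v
        ... | yes m = inj₂ λ ¬m → contradiction m ¬m
        ... | no ¬mv with Simplicial? (cut x) v
        ...   | no ¬s = inj₂ λ _ → ≤-trans (*-monoʳ-≤ 1 (nonsimplicial-gain Sv D≡ ¬mv ¬s)) (m≤m+n _ _)
        ...   | yes sv = go (hits v x) refl (hits≤2 Sv x)
          where
          m = hit x ¬mv sv
          1≤hits : 1 ≤ hits v x
          1≤hits with missing-hit sv Sy Sz vy vz ¬yz
          ... | inj₁ my = hits-pos Sy vy (pair≢ vz ¬yz) my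
          ... | inj₂ mz = hits-pos Sz vz (pair≢ vy (λ zy → ¬yz (E-sym zy))) mz
          go : ∀ j → hits v x ≡ j → j ≤ 2 → Goal ⊎ P x
          go zero h≡ _ = contradiction (≤-trans 1≤hits (≤-reflexive h≡)) λ ()
          go (suc zero) h≡ _ with gain-or-goal ¬mv sv Sy Sz vy vz ¬yz h≡
          ... | inj₁ g = inj₁ g
          ... | inj₂ le = inj₂ (from m (≤-trans (≤-reflexive (cong (λ j → q * r + j) (trans (cong (2 * r *_) h≡) (*-identityʳ (2 * r))))) (gain₁′ {δ} {demand (cut x) v} {r} le)))
          go (suc (suc zero)) h≡ _ = inj₂ (from m (≤-trans (≤-reflexive (cong (λ j → q * r + j) (trans (cong (2 * r *_) h≡) (i r)))) (simplicial-gain₂ Sv D≡ ¬mv sv h≡)))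
            where
            i : ∀ r → 2 * r * 2 ≡ 4 * r
            i = solve-∀
          go (suc (suc (suc _))) _ (s≤s (s≤s ()))
        finish : Goal ⊎ (∀ x → P x) → Goal ⊎ Bound
        finish (inj₁ g) = inj₁ g
        finish (inj₂ p) = inj₂ (average Sv D≡ 0 (λ x → ⟨ mem? x h ⟩ * r) (λ x _ ¬m → p x ¬m)
          (≤-reflexive (trans (∑w-mem′ r Sh) (cong (2 *_) (sym (*-identityˡ r))))))

      module Special {y z : Fin n} (b : Lacks v y z) (not-mates : partner y ≢ z)
        (near-group-y : ∀ {t} → In S t → E v t → Mem y t → t ≡ y) (near-group-z : ∀ {t} → In S t → E v t → Mem z t → t ≡ z) where

        ¬Mem-v : ∀ {x s s′} → Lacks v s s′ → Mem x s → ¬ Mem x v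
        ¬Mem-v {x} {s} {s′} b′ ms mv with same-group ms mv
        ... | inj₁ refl = ¬yz b′ (uz b′)
        ... | inj₂ e = partner-apart s (λ p → ¬yz b′ (subst (λ w → E w s′) (trans e p) (uz b′))) (E-sym (subst (λ w → E w s) e (uy b′)))

        hits≡1 : ∀ {x s s′} → Lacks v s s′ → Mem x s → (∀ {t} → In S t → E v t → Mem s t → t ≡ s) → hits v x ≡ 1
        hits≡1 {x} {s} b′ ms near = ≤-antisym
          (≤-trans (∑-mono λ t → pt t (nbr? v t) (mem? x t)) (≤-reflexive (#-one s)))
          (hits-pos (Sy b′) (uy b′) (pair≢ (uz b′) (¬yz b′)) ms)
          where
          pt : ∀ t (n? : Dec ((In S t × E v t) × t ≢ v)) (m? : Dec (Mem x t)) → ⟨ n? ⟩ * ⟨ m? ⟩ ≤ ⟨ t ≟F s ⟩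
          pt t (no _) _ = z≤n
          pt t (yes _) (no _) = z≤n
          pt t (yes ((St , vt) , _)) (yes mt) = ≤-reflexive (sym (⟨⟩-yes (t ≟F s) (near St vt (same-group ms mt))))

        -- What `simplicial-gain-large` needs, with s′ as the vertex of large degree, when the group
        -- of s is deleted.
        Good : Fin n → Fin n → Set
        Good s s′ = ∀ x → Mem x s → Simplicial (cut x) v → ¬ Simplicial (cut x) s′ × simps (cut x) v + D (cut x) v ≤ D (cut x) s′

        module Groups {s s′ : Fin n} (b′ : Lacks v s s′) (not : partner s ≢ s′) {x} (ms : Mem x s)
          (near-s : ∀ {t} → In S t → E v t → Mem s t → t ≡ s) where

          X = cut x

          in-X : ∀ {t} → In S t → E v t → t ≢ s → In X t
          in-X St vt ne = St , λ m → ne (near-s St vt (same-group ms m))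

          Xs′ : In X s′
          Xs′ = in-X (Sz b′) (uz b′) λ e → ends≢ b′ (sym e)

          X≢s : ∀ {t} → In X t → t ≢ s
          X≢s (_ , ¬m) refl = ¬m ms

          D-v : suc (D X v) ≡ D S v
          D-v = trans (+-comm 1 _) (trans (cong (D X v +_) (sym (hits≡1 b′ ms near-s))) (D-cut Sv (¬Mem-v b′ ms)))

          good-D : ∀ {c} → simps X v + D S v ≤ suc c → simps X v + D X v ≤ c
          good-D {c} le = ≤-pred (≤-trans (≤-reflexive (trans (sym (+-suc (simps X v) (D X v))) (cong (simps X v +_) D-v))) le)

          near-s′ : ∀ {t} → In X t → E v t → E t s′
          near-s′ {t} Xt vt = E-sym (near-end (Lacks-sym b′) (proj₁ Xt) vt (X≢s Xt))

          single-D : partner s ≡ s → ∀ t → In S t × E s′ t → In X t × E s′ t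
          single-D e t (St , s′t) = (St , λ m → go (same-group ms m)) , s′t
            where
            absurd : t ≢ s
            absurd refl = ¬yz b′ (E-sym s′t)
            go : ¬ Mem s t
            go (inj₁ p) = absurd p
            go (inj₂ p) = absurd (trans p e)

          -- s is deleted alone and is not adjacent to s′, so s′ keeps its neighbourhood and stays
          -- nonsimplicial. A vertex near v that is simplicial in `X` is then a twin of v in `S`:
          -- the only vertex of `S` that is not in `X` is s, which both see.
          unmated : partner s ≡ s → ¬ (2 + D S s′ ≤ twins v + D S v) → Simplicial X v →
            ¬ Simplicial X s′ × simps X v + D X v ≤ D X s′
          unmated e loose sv = ¬simp , good-D (≤-trans (+-monoˡ-≤ (D S v) simps≤) (≤-trans (≤-pred (≰⇒> loose))
            (s≤s (#-mono (near? S s′) (near? X s′) (single-D e)))))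
            where
            ¬simp : ¬ Simplicial X s′
            ¬simp ss = ns s′ (Sz b′) λ u w Su Sw s′u s′w → ss u w (proj₁ (single-D e u (Su , s′u))) (proj₁ (single-D e w (Sw , s′w))) s′u s′w
            simps≤ : simps X v ≤ twins v
            simps≤ = #-mono (simp? X v) (twin? v) λ t ((Xt , vt) , st) → proj₁ Xt , λ w Sw →
              (λ vw → dominates b′ (proj₁ Xt) vt (X≢s Xt) (λ { refl → ¬simp st }) w Sw vw) ,
              (λ tw → back t Xt vt st w Sw tw (w ≟F s))
              where
              back : ∀ t → In X t → E v t → Simplicial X t → ∀ w → In S w → E t w → Dec (w ≡ s) → E v w
              back t Xt vt st w Sw tw (yes refl) = uy b′
              back t Xt vt st w Sw tw (no ne) = st v w (Sv , ¬Mem-v b′ ms) (Sw , λ m → go (same-group ms m)) (E-sym vt) tw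
                where
                go : ¬ Mem s w
                go (inj₁ p) = ne p
                go (inj₂ p) = ne (trans p e)

          -- Let u witness that s′ and s″ are mates. As s″ is not s, `end-unique` gives u a larger
          -- degree than v. A vertex other than s′ that is near v and simplicial in `X` is not near
          -- u, since it would bring s″ near v and s′ s″ would be a second missing edge.
          -- `end-degree` at u then makes the degree of s′ large; of it only the mate of s can be
          -- lost.
          mated : partner s′ ≢ s′ → Simplicial X v → ¬ Simplicial X s′ × simps X v + D X v ≤ D X s′
          mated ne sv with partner-Mate s′ ne
          ... | u , b″ , tight , _ = ¬simp , good-D (≤-pred (begin
              suc (simps X v + D S v) ≡⟨ sym (+-suc (simps X v) (D S v)) ⟩
              simps X v + suc (D S v) ≤⟨ +-monoʳ-≤ (simps X v) deg-u ⟩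
              simps X v + D S u ≤⟨ end-degree b″ (simp? X v) (λ t ((Xt , vt) , _) → proj₁ Xt , E-sym (near-s′ Xt vt))
                (λ t ((Xt , vt) , st) ut → far Xt vt st (λ { refl → ¬simp st }) ut) ⟩
              suc (D S s′) ≤⟨ s≤s D-s′ ⟩
              suc (suc (D X s′)) ∎))
            where
            open ≤-Reasoning
            s″ = partner s′
            s″≢s : s″ ≢ s
            s″≢s e = not (trans (cong partner (sym e)) (partner-invol s′))
            Xs″ : In X s″
            Xs″ = Sz b″ , λ m → go (same-group ms m)
              where
              go : ¬ Mem s s″
              go (inj₁ e) = s″≢s e
              go (inj₂ e) = ends≢ b′ (trans (sym (partner-invol s)) (trans (cong partner (sym e)) (partner-invol s′)))
            deg-u : suc (D S v) ≤ D S u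
            deg-u = ≰⇒> λ le → s″≢s (end-unique b″ tight (Lacks-sym b′) le)
            far : ∀ {t} → In X t → E v t → Simplicial X t → t ≢ s′ → ¬ E u t
            far {t} Xt vt st t≢s′ ut = go (only b′ s′ s″ (Sz b′) (Sz b″) (uz b′) vs″ (¬yz b″))
              where
              t≢s″ : t ≢ s″
              t≢s″ refl = ¬yz b″ (E-sym (near-s′ Xt vt))
              vs″ : E v s″
              vs″ = st v s″ (Sv , ¬Mem-v b′ ms) Xs″ (E-sym vt) (dominates b″ (proj₁ Xt) ut t≢s′ t≢s″ s″ (Sz b″) (uz b″))
              go : ¬ ((s′ ≡ s × s″ ≡ s′) ⊎ (s′ ≡ s′ × s″ ≡ s))
              go (inj₁ (e , _)) = ends≢ b′ (sym e)
              go (inj₂ (_ , e)) = s″≢s e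
            D-s′ : D S s′ ≤ suc (D X s′)
            D-s′ = ≤-trans (#-cover (_≟F partner s) (near? X s′) (near? S s′) case) (≤-reflexive (cong (_+ D X s′) (#-one (partner s))))
              where
              case : ∀ t → In S t × E s′ t → t ≡ partner s ⊎ (In X t × E s′ t)
              case t (St , s′t) with t ≟F partner s
              ... | yes e = inj₁ e
              ... | no ne′ = inj₂ ((St , λ m → go (same-group ms m)) , s′t)
                where
                go : ¬ Mem s t
                go (inj₁ refl) = ¬yz b′ (E-sym s′t)
                go (inj₂ e) = ne′ e
            v≢s′ : v ≢ s′
            v≢s′ refl = ¬yz b′ (E-sym (uy b′))
            ¬simp : ¬ Simplicial X s′
            ¬simp ss = contradiction (begin
              suc (D S v) ≤⟨ deg-u ⟩
              D S u ≤⟨ ≤-pred (≤-trans (≤-reflexive (cong (_+ D S u) (sym (#-one v)))) (end-degree b″ (_≟F v) (λ { _ refl → Sv , E-sym (uz b′) })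
                (λ { _ refl → far (Sv , ¬Mem-v b′ ms) E-refl sv v≢s′ }))) ⟩
              D S s′ ≤⟨ D-s′ ⟩
              suc (D X s′) ≤⟨ s≤s (#-mono (near? X s′) (near? X v) λ t (Xt , s′t) → Xt , ss v t (Sv , ¬Mem-v b′ ms) Xt (E-sym (uz b′)) s′t) ⟩
              suc (D X v) ≡⟨ D-v ⟩
              D S v ∎) (<⇒≱ (n<1+n (D S v)))

        -- Two groups can make v simplicial. In units of r/(2 + 2δ), that of s costs 1, by `Good`,
        -- and that of s′ costs 1 + 2δ, by `gain-or-goal`; together they use up the budget.
        special : ∀ {s s′} → Lacks v s s′ → (∀ {t} → In S t → E v t → Mem s t → t ≡ s) → (∀ {t} → In S t → E v t → Mem s′ t → t ≡ s′) →
          Good s s′ → Goal ⊎ Bound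
        special {s} {s′} b′ near-s near-s′ good = finish (choice per)
          where
          q = 3 + 2 * δ
          l = 2 + 2 * δ
          e : Fin n → ℕ
          e x = ⟨ mem? x s ⟩ * r + ⟨ mem? x s′ ⟩ * ((1 + 2 * δ) * r)
          P : Fin n → Set
          P x = ¬ Mem x v → l * (q * r + 2 * r * hits v x) ≤ l * (q * demand (cut x) v) + e x
          i₁ : ∀ δ r → (2 + 2 * δ) * ((3 + 2 * δ) * r + 2 * r * 1) ≡ (9 + 14 * δ + 4 * (δ * δ)) * r + r
          i₁ = solve-∀
          i₂ : ∀ δ r → (2 + 2 * δ) * ((3 + 2 * δ) * r + 2 * r * 1) ≡ (3 + 2 * δ) * ((3 + 2 * δ) * r) + (1 + 2 * δ) * r
          i₂ = solve-∀
          i₃ : ∀ δ m → (3 + 2 * δ) * ((2 + 2 * δ) * m) ≡ (2 + 2 * δ) * ((3 + 2 * δ) * m)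
          i₃ = solve-∀
          per : ∀ x → Goal ⊎ P x
          per x with mem? x v
          ... | yes m = inj₂ λ ¬m → contradiction m ¬m
          ... | no ¬mv with Simplicial? (cut x) v
          ...   | no ¬s = inj₂ λ _ → ≤-trans (*-monoʳ-≤ l (nonsimplicial-gain Sv D≡ ¬mv ¬s)) (m≤m+n _ (e x))
          ...   | yes sv with missing-hit sv (Sy b′) (Sz b′) (uy b′) (uz b′) (¬yz b′)
          ...     | inj₁ ms = inj₂ λ _ → begin
            l * (q * r + 2 * r * hits v x) ≡⟨ cong (λ j → l * (q * r + 2 * r * j)) h≡ ⟩
            l * (q * r + 2 * r * 1) ≡⟨ i₁ δ r ⟩
            (9 + 14 * δ + 4 * (δ * δ)) * r + r ≤⟨ +-mono-≤ (simplicial-gain-large Sv D≡ ¬mv sv h≡ Xs′ (uz b′) (proj₁ g) (proj₂ g))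
              (≤-trans (≤-reflexive (sym (trans (cong (_* r) (⟨⟩-yes (mem? x s) ms)) (*-identityˡ r)))) (m≤m+n _ _)) ⟩
            l * (q * demand (cut x) v) + e x ∎
            where
            open ≤-Reasoning
            h≡ = hits≡1 b′ ms near-s
            g = good x ms sv
            Xs′ : In (cut x) s′
            Xs′ = Sz b′ , λ m → ends≢ b′ (sym (near-s (Sz b′) (uz b′) (same-group ms m)))
          ...     | inj₂ ms′ with gain-or-goal ¬mv sv (Sy b′) (Sz b′) (uy b′) (uz b′) (¬yz b′) (hits≡1 (Lacks-sym b′) ms′ near-s′)
          ...       | inj₁ goal = inj₁ goal
          ...       | inj₂ le = inj₂ λ _ → begin
            l * (q * r + 2 * r * hits v x) ≡⟨ cong (λ j → l * (q * r + 2 * r * j)) (hits≡1 (Lacks-sym b′) ms′ near-s′) ⟩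
            l * (q * r + 2 * r * 1) ≡⟨ i₂ δ r ⟩
            q * (q * r) + (1 + 2 * δ) * r ≤⟨ +-mono-≤ (≤-trans (*-monoʳ-≤ q le) (≤-reflexive (i₃ δ (demand (cut x) v))))
              (≤-trans (≤-reflexive (sym (trans (cong (_* ((1 + 2 * δ) * r)) (⟨⟩-yes (mem? x s′) ms′)) (*-identityˡ _)))) (m≤n+m _ (⟨ mem? x s ⟩ * r))) ⟩
            l * (q * demand (cut x) v) + e x ∎
            where open ≤-Reasoning
          finish : Goal ⊎ (∀ x → P x) → Goal ⊎ Bound
          finish (inj₁ g) = inj₁ g
          finish (inj₂ p) = inj₂ (average Sv D≡ (1 + 2 * δ) e (λ x _ ¬m → p x ¬m) (≤-reflexive
            (trans (∑-cong (λ x → *-distribˡ-+ (w x) _ _)) (trans (∑-+ _ _) (trans (cong₂ _+_ (∑w-mem′ r (Sy b′)) (∑w-mem′ ((1 + 2 * δ) * r) (Sz b′))) (i δ r))))))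
            where
            i : ∀ δ r → 2 * r + 2 * ((1 + 2 * δ) * r) ≡ 2 * ((2 + 2 * δ) * r)
            i = solve-∀

        -- A mated end is taken as s′. If neither end is mated, an end that is not tight serves as
        -- s′; if both were tight, y and z would be mates.
        result : Goal ⊎ Bound
        result with partner z ≟F z | partner y ≟F y
        ... | no ne | _ = special b near-group-y near-group-z λ x ms sv → Groups.mated b not-mates ms near-group-y ne sv
        ... | yes _ | no ne = special (Lacks-sym b) near-group-z near-group-y λ x ms sv → Groups.mated (Lacks-sym b) not′ ms near-group-z ne sv
          where
          not′ : partner z ≢ y
          not′ e = not-mates (trans (cong partner (sym e)) (partner-invol z))
        ... | yes ez | yes ey with 2 + D S z ≤? twins v + D S v
        ...   | no loose = special b near-group-y near-group-z λ x ms sv → Groups.unmated b not-mates ms near-group-y ey loose sv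
        ...   | yes tight-z with 2 + D S y ≤? twins v + D S v
        ...     | no loose = special (Lacks-sym b) near-group-z near-group-y λ x ms sv → Groups.unmated (Lacks-sym b) not′ ms near-group-z ez loose sv
          where
          not′ : partner z ≢ y
          not′ e = not-mates (trans (cong partner (sym e)) (partner-invol z))
        ...     | yes tight-y = contradiction (partner-mate (v , b , tight-y , tight-z)) not-mates

      -- If y and z form one group, or if the group of one of them does not make v simplicial, then
      -- all groups that do so contain a common vertex. Otherwise every nonadjacent pair near v
      -- meets both groups, so the edge yz is the only one missing.
      pair-case : ∀ {y z} → In S y → In S z → E v y → E v z → ¬ E y z → Goal ⊎ Bound
      pair-case {y} {z} Sy Sz vy vz ¬yz with partner y ≟F z | Simplicial? (cut y) v | Simplicial? (cut z) v
      ... | yes e | _ | _ = one-hit Sy Sz vy vz ¬yz Sy λ x ¬mv sv → go (missing-hit sv Sy Sz vy vz ¬yz)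
        where
        go : ∀ {x} → Mem x y ⊎ Mem x z → Mem x y
        go (inj₁ m) = m
        go (inj₂ m) = same-group (Mem-sym m) (inj₂ (trans (sym (partner-invol y)) (cong partner e)))
      ... | no _ | no ¬sy | _ = one-hit Sy Sz vy vz ¬yz Sz λ x ¬mv sv → go sv (missing-hit sv Sy Sz vy vz ¬yz)
        where
        go : ∀ {x} → Simplicial (cut x) v → Mem x y ⊎ Mem x z → Mem x z
        go {x} sv (inj₁ m) = contradiction (Simplicial-⊑ {cut y} {cut x} (cut-⊑ (Mem-sym m)) sv) ¬sy
        go sv (inj₂ m) = m
      ... | no _ | yes _ | no ¬sz = one-hit Sy Sz vy vz ¬yz Sy λ x ¬mv sv → go sv (missing-hit sv Sy Sz vy vz ¬yz)
        where
        go : ∀ {x} → Simplicial (cut x) v → Mem x y ⊎ Mem x z → Mem x y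
        go sv (inj₁ m) = m
        go {x} sv (inj₂ m) = contradiction (Simplicial-⊑ {cut z} {cut x} (cut-⊑ (Mem-sym m)) sv) ¬sz
      ... | no ne | yes sy | yes sz = Special.result (lacks Sv Sy Sz vy vz ¬yz only′) ne near-y near-z
        where
        apart : ∀ {t} → Mem y t → Mem z t → ⊥
        apart my mz with same-group (Mem-sym my) (Mem-sym mz)
        ... | inj₁ refl = ¬yz E-refl
        ... | inj₂ e = ne (sym e)
        near-y : ∀ {t} → In S t → E v t → Mem y t → t ≡ y
        near-y St vt (inj₁ e) = e
        near-y {t} St vt (inj₂ e) with t ≟F y
        ... | yes e′ = e′
        ... | no t≢y with missing-hit sz Sy St vy vt (λ yt → partner-apart y (λ p → t≢y (trans e p)) (subst (E y) e yt))
        ...   | inj₁ m = ⊥-elim (apart (inj₁ refl) m)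
        ...   | inj₂ m = ⊥-elim (apart (inj₂ e) m)
        near-z : ∀ {t} → In S t → E v t → Mem z t → t ≡ z
        near-z St vt (inj₁ e) = e
        near-z {t} St vt (inj₂ e) with t ≟F z
        ... | yes e′ = e′
        ... | no t≢z with missing-hit sy Sz St vz vt (λ zt → partner-apart z (λ p → t≢z (trans e p)) (subst (E z) e zt))
        ...   | inj₁ m = ⊥-elim (apart m (inj₁ refl))
        ...   | inj₂ m = ⊥-elim (apart m (inj₂ e))
        only′ : ∀ s t → In S s → In S t → E v s → E v t → ¬ E s t → (s ≡ y × t ≡ z) ⊎ (s ≡ z × t ≡ y)
        only′ s t Ss St vs vt ¬st with missing-hit sy Ss St vs vt ¬st | missing-hit sz Ss St vs vt ¬st
        ... | inj₁ ms | inj₁ ms′ = ⊥-elim (apart ms ms′)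
        ... | inj₁ ms | inj₂ mt = inj₁ (near-y Ss vs ms , near-z St vt mt)
        ... | inj₂ mt | inj₁ ms = inj₂ (near-z Ss vs ms , near-y St vt mt)
        ... | inj₂ mt | inj₂ mt′ = ⊥-elim (apart mt mt′)

    vertex : ∀ v → In S v → Goal ⊎ (∑ w * ρ (D S v) ≤ ∑ (λ x → w x * demand (cut x) v))
    vertex v Sv with nonsimplicial-D Sv (ns v Sv) | ¬Simplicial S v (ns v Sv)
    ... | δ , D≡ | y , z , Sy , Sz , vy , vz , ¬yz = At.pair-case Sv D≡ Sy Sz vy vz ¬yz

    core : ∀ v₀ → In S v₀ → Goal
    core v₀ Sv₀ = finish (choice per)
      where
      P : Fin n → Set
      P v = In S v → ∑ w * ρ (D S v) ≤ ∑ (λ x → w x * demand (cut x) v)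
      per : ∀ v → Goal ⊎ P v
      per v with in? S v
      ... | no ¬Sv = inj₂ λ Sv → contradiction Sv ¬Sv
      ... | yes Sv with vertex v Sv
      ...   | inj₁ g = inj₁ g
      ...   | inj₂ p = inj₂ λ _ → p
      finish : Goal ⊎ (∀ v → P v) → Goal
      finish (inj₁ g) = g
      finish (inj₂ p) = from-average v₀ Sv₀ IH p

  module Conclusion {n : ℕ} (G : SimpleGraph n) where
    open Demands G
    colourable : ∀ S {M h} → Valid S M h → Colourable M h
    colourable S val = main-induction (λ S v Sv ns IH → Step.core G S ns IH v Sv) (size S) S ≤-refl val

open Integral

open import Data.Nat using (ℕ; zero; suc; z≤n) renaming (_+_ to _ℕ+_; _*_ to _ℕ*_; _≤_ to _ℕ≤_)
import Data.Nat as ℕ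
import Data.Nat.Properties as ℕ
open import Data.Nat.Tactic.RingSolver using (solve-∀)
import Data.Nat.ListAction as ℕ
open import Data.Integer using (+_; -[1+_])
import Data.Integer as ℤ
import Data.Integer.Properties as ℤ
open import Data.Rational using (ℚ; mkℚ; 0ℚ; 1ℚ; ½; _+_; _-_; _*_; _≤_; _/_; -_; toℚᵘ; *≤*; NonNegative; Positive; nonNegative)
import Data.Rational as ℚ
open import Data.Rational.Properties
import Data.Rational.Unnormalised as ℚᵘ
import Data.Rational.Unnormalised.Properties as ℚᵘ
open import Data.Rational.Solver using (module +-*-Solver)
open import Data.Fin using (Fin; zero; suc; toℕ)
open import Data.Fin.Properties using (toℕ<n; toℕ-injective)
open import Data.Bool using (true; false; if_then_else_)
open import Data.Bool.Properties using () renaming (_≟_ to _≟B_)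
open import Data.List using (List; map; filter; tabulate; allFin)
import Data.List.Relation.Unary.All as All
import Data.List.Relation.Unary.All.Properties as All
import Data.List.Relation.Unary.AllPairs.Properties as AllPairs
import Data.Vec as Vec
import Data.Vec.Properties as Vec
open import Data.Product using (Σ; ∃; _,_; proj₁; proj₂)
open import Data.Sum using (inj₁; inj₂)
open import Data.Unit using (⊤; tt)
open import Relation.Nullary using (yes; no; does; contradiction)
open import Relation.Binary.PropositionalEquality using (_≡_; _≢_; refl; sym; trans; cong; cong₂; subst; module ≡-Reasoning)
open import Relation.Binary.Definitions using (tri<; tri≈; tri>)

-- From integral demands to rational intervals

abstract
  ι : ℕ → ℚ
  ι m = + m / 1

  ι-def : ∀ m → ι m ≡ + m / 1
  ι-def m = refl

  ι-zero : ι 0 ≡ 0ℚ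
  ι-zero = refl

  ι-one : ι 1 ≡ 1ℚ
  ι-one = refl

  toℚᵘ-ι : ∀ m → toℚᵘ (ι m) ℚᵘ.≃ ℚᵘ.mkℚᵘ (+ m) 0
  toℚᵘ-ι m = toℚᵘ-fromℚᵘ (ℚᵘ.mkℚᵘ (+ m) 0)

  ι-pos : ∀ m → Positive (ι (suc m))
  ι-pos m = normalize-pos (suc m) 1

ι-+ : ∀ a b → ι (a ℕ+ b) ≡ ι a + ι b
ι-+ a b = toℚᵘ-injective (ℚᵘ.≃-trans (toℚᵘ-ι (a ℕ+ b)) (ℚᵘ.≃-sym (ℚᵘ.≃-trans (toℚᵘ-homo-+ (ι a) (ι b))
  (ℚᵘ.≃-trans (ℚᵘ.+-cong (toℚᵘ-ι a) (toℚᵘ-ι b)) (ℚᵘ.*≡* (cong (ℤ._* + 1) (cong₂ ℤ._+_ (ℤ.*-identityʳ (+ a)) (ℤ.*-identityʳ (+ b)))))))))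

ι-* : ∀ a b → ι (a ℕ* b) ≡ ι a * ι b
ι-* a b = toℚᵘ-injective (ℚᵘ.≃-trans (toℚᵘ-ι (a ℕ* b)) (ℚᵘ.≃-sym (ℚᵘ.≃-trans (toℚᵘ-homo-* (ι a) (ι b))
  (ℚᵘ.≃-trans (ℚᵘ.*-cong (toℚᵘ-ι a) (toℚᵘ-ι b)) (ℚᵘ.*≡* (cong (ℤ._* + 1) (sym (ℤ.pos-* a b))))))))

ι-mono : ∀ {a b} → a ℕ≤ b → ι a ≤ ι b
ι-mono {a} {b} le = toℚᵘ-cancel-≤ (ℚᵘ.≤-respˡ-≃ (ℚᵘ.≃-sym (toℚᵘ-ι a)) (ℚᵘ.≤-respʳ-≃ (ℚᵘ.≃-sym (toℚᵘ-ι b))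
  (ℚᵘ.*≤* (ℤ.*-monoʳ-≤-nonNeg (+ 1) (ℤ.+≤+ le)))))

ι-cancel : ∀ {a b} → ι a ≤ ι b → a ℕ≤ b
ι-cancel {a} {b} le with ℚᵘ.≤-respˡ-≃ (toℚᵘ-ι a) (ℚᵘ.≤-respʳ-≃ (toℚᵘ-ι b) (toℚᵘ-mono-≤ le))
... | ℚᵘ.*≤* p = ℤ.drop‿+≤+ (ℤ.*-cancelʳ-≤-pos (+ a) (+ b) (+ 1) p)

ι-nonNeg : ∀ m → NonNegative (ι m)
ι-nonNeg m = nonNegative (≤-trans (≤-reflexive (sym ι-zero)) (ι-mono {0} {m} z≤n))

clear-denominator : ∀ q → 0ℚ ≤ q → ∃ λ a → ∃ λ d → q * ι (suc d) ≡ ι a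
clear-denominator (mkℚ -[1+ a ] d c) (*≤* ())
clear-denominator q@(mkℚ (+ a) d c) _ = a , d , toℚᵘ-injective (ℚᵘ.≃-trans (toℚᵘ-homo-* q (ι (suc d)))
  (ℚᵘ.≃-trans (ℚᵘ.*-cong (ℚᵘ.≃-refl {toℚᵘ q}) (toℚᵘ-ι (suc d))) (ℚᵘ.≃-trans (ℚᵘ.*≡* eq) (ℚᵘ.≃-sym (toℚᵘ-ι a)))))
  where
  eq : (+ a ℤ.* + suc d) ℤ.* + 1 ≡ + a ℤ.* + (suc d ℕ* 1)
  eq = trans (ℤ.*-identityʳ _) (cong (λ x → + a ℤ.* + x) (sym (ℕ.*-identityʳ (suc d))))

common-denominator : ∀ {k} (f : Fin k → ℚ) → (∀ v → 0ℚ ≤ f v) →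
  ∃ λ M → ∃ λ (h : Fin k → ℕ) → ∀ v → f v * ι (suc M) ≡ ι (h v)
common-denominator {zero} f nn = 0 , (λ ()) , λ ()
common-denominator {suc k} f nn with clear-denominator (f zero) (nn zero) | common-denominator (λ v → f (suc v)) (λ v → nn (suc v))
... | a , d , e | M , h , es = M ℕ+ d ℕ* suc M , h′ , eq
  where
  h′ : Fin (suc k) → ℕ
  h′ zero = a ℕ* suc M
  h′ (suc v) = suc d ℕ* h v
  eq : ∀ v → f v * ι (suc (M ℕ+ d ℕ* suc M)) ≡ ι (h′ v)
  eq zero = begin
    f zero * ι (suc d ℕ* suc M) ≡⟨ cong (f zero *_) (ι-* (suc d) (suc M)) ⟩
    f zero * (ι (suc d) * ι (suc M)) ≡⟨ sym (*-assoc (f zero) _ _) ⟩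
    f zero * ι (suc d) * ι (suc M) ≡⟨ cong (_* ι (suc M)) e ⟩
    ι a * ι (suc M) ≡⟨ sym (ι-* a (suc M)) ⟩
    ι (a ℕ* suc M) ∎
    where open ≡-Reasoning
  eq (suc v) = begin
    f (suc v) * ι (suc d ℕ* suc M) ≡⟨ cong (f (suc v) *_) (trans (ι-* (suc d) (suc M)) (*-comm (ι (suc d)) _)) ⟩
    f (suc v) * (ι (suc M) * ι (suc d)) ≡⟨ sym (*-assoc (f (suc v)) _ _) ⟩
    f (suc v) * ι (suc M) * ι (suc d) ≡⟨ cong (_* ι (suc d)) (es v) ⟩
    ι (h v) * ι (suc d) ≡⟨ trans (*-comm (ι (h v)) _) (sym (ι-* (suc d) (h v))) ⟩
    ι (suc d ℕ* h v) ∎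
    where open ≡-Reasoning

sum-allFin : ∀ {n} (g : Fin n → ℕ) → ℕ.sum (map g (allFin n)) ≡ ∑ g
sum-allFin {n} g = go n (λ i → i)
  where
  go : ∀ k (e : Fin k → Fin n) → ℕ.sum (map g (tabulate e)) ≡ ∑ (λ i → g (e i))
  go zero e = sym (∑-nil _)
  go (suc k) e = trans (cong (g (e zero) ℕ+_) (go k (λ i → e (suc i)))) (sym (∑-suc _))

sumℚ-allFin : ∀ {n} (g : Fin n → ℚ) (t : Fin n → ℕ) c → (∀ i → g i * c ≡ ι (t i)) → sumℚ (map g (allFin n)) * c ≡ ι (∑ t)
sumℚ-allFin {n} g t c eq = go n (λ i → i)
  where
  go : ∀ k (e : Fin k → Fin n) → sumℚ (map g (tabulate e)) * c ≡ ι (∑ (λ i → t (e i)))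
  go zero e = trans (*-zeroˡ c) (trans (sym ι-zero) (cong ι (sym (∑-nil _))))
  go (suc k) e = trans (*-distribʳ-+ c (g (e zero)) _) (trans (cong₂ _+_ (eq (e zero)) (go k (λ i → e (suc i))))
    (trans (sym (ι-+ (t (e zero)) _)) (cong ι (sym (∑-suc _)))))

-- Colours as intervals of length 1/L

module Cells (l : ℕ) where

  L = suc l

  u : ℚ
  u = ℚ.1/_ (ι L) {{pos⇒nonZero (ι L) {{ι-pos l}}}}

  u-inv : u * ι L ≡ 1ℚ
  u-inv = *-inverseˡ (ι L) {{pos⇒nonZero (ι L) {{ι-pos l}}}}

  u-nonNeg : NonNegative u
  u-nonNeg = pos⇒nonNeg u {{1/pos⇒pos (ι L) {{ι-pos l}}}}

  pt : ℕ → ℚ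
  pt a = ι a * u

  pt-mono : ∀ {a b} → a ℕ≤ b → pt a ≤ pt b
  pt-mono le = *-monoʳ-≤-nonNeg u {{u-nonNeg}} (ι-mono le)

  cell : Fin L → Interval
  cell i = record { lo = pt (toℕ i) ; hi = pt (suc (toℕ i))
    ; 0≤lo = ≤-trans (≤-reflexive (sym (trans (cong (_* u) ι-zero) (*-zeroˡ u)))) (pt-mono {0} {toℕ i} z≤n)
    ; lo≤hi = pt-mono (ℕ.n≤1+n (toℕ i))
    ; hi≤1 = ≤-trans (pt-mono (toℕ<n i)) (≤-reflexive (trans (*-comm (ι L) u) u-inv)) }

  len-cell : ∀ i → len (cell i) * ι L ≡ ι 1
  len-cell i = begin
    (ι (1 ℕ+ toℕ i) * u - ι (toℕ i) * u) * ι L ≡⟨ cong (λ x → (x * u - ι (toℕ i) * u) * ι L) (ι-+ 1 (toℕ i)) ⟩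
    ((ι 1 + ι (toℕ i)) * u - ι (toℕ i) * u) * ι L ≡⟨ solve 4 (λ a b c d → ((a :+ b) :* c :- b :* c) :* d := a :* (c :* d)) refl (ι 1) (ι (toℕ i)) u (ι L) ⟩
    ι 1 * (u * ι L) ≡⟨ trans (cong (ι 1 *_) u-inv) (*-identityʳ (ι 1)) ⟩
    ι 1 ∎
    where
    open ≡-Reasoning
    open +-*-Solver

  cells-disjoint : ∀ {i j} → i ≢ j → DisjointI (cell i) (cell j)
  cells-disjoint {i} {j} ne with ℕ.<-cmp (toℕ i) (toℕ j)
  ... | tri< lt _ _ = inj₁ (pt-mono lt)
  ... | tri≈ _ e _ = contradiction (toℕ-injective e) ne
  ... | tri> _ _ gt = inj₂ (pt-mono gt)

  chosen : Colours L → List (Fin L)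
  chosen X = filter (λ i → X i ≟B true) (allFin L)

  region : Colours L → PSet
  region X = record { ivs = map cell (chosen X)
    ; disjoint = AllPairs.map⁺ (AllPairs.filter⁺ (λ i → X i ≟B true)
        (AllPairs.tabulate⁺-< {f = λ i → i} λ lt → inj₁ (pt-mono lt))) }

  region-disjoint : ∀ {X Y} → X ⟂ Y → DisjointSets (region X) (region Y)
  region-disjoint {X} {Y} d = All.map⁺ (All.map (λ {i} xi → All.map⁺ (All.map (λ {j} yj → cells-disjoint λ { refl → d i xi yj })
    (All.all-filter (λ i → Y i ≟B true) (allFin L)))) (All.all-filter (λ i → X i ≟B true) (allFin L)))

  μ-region : ∀ X → μ (region X) * ι L ≡ ι ∣ X ∣
  μ-region X = go L (λ i → i)
    where
    go : ∀ k (e : Fin k → Fin L) → sumℚ (map len (map cell (filter (λ i → X i ≟B true) (tabulate e)))) * ι L ≡ ι (∑ (λ i → β (X (e i))))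
    go zero e = trans (*-zeroˡ (ι L)) (trans (sym ι-zero) (cong ι (sym (∑-nil _))))
    go (suc k) e with X (e zero) in eq
    ... | true = trans (*-distribʳ-+ (ι L) (len (cell (e zero))) _) (trans (cong₂ _+_ (len-cell (e zero)) (go k (λ i → e (suc i))))
      (trans (sym (ι-+ 1 (∑ (λ i → β (X (e (suc i))))))) (cong ι (sym (trans (∑-suc _) (cong (λ b → β b ℕ+ ∑ (λ i → β (X (e (suc i))))) eq))))))
    ... | false = trans (go k (λ i → e (suc i))) (cong ι (sym (trans (∑-suc _) (cong (λ b → β b ℕ+ ∑ (λ i → β (X (e (suc i))))) eq))))

-- The given demand function as a valid integral demand

module _ {n : ℕ} (G : SimpleGraph n) where

  open Demands G

  everything : Sub
  everything = record { In = λ _ → ⊤ ; in? = λ _ → yes tt }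

  D-everything : ∀ v → D everything v ≡ suc (degree G v)
  D-everything v = trans (ℕ.≤-antisym
      (#-cover (λ t → t ≟F v) (Adj? v) (near? everything v) λ { t (_ , inj₁ e) → inj₁ (sym e) ; t (_ , inj₂ a) → inj₂ a })
      (#-disj (λ t → t ≟F v) (Adj? v) (near? everything v) (λ { _ refl → tt , E-refl }) (λ _ a → tt , inj₂ a) λ { _ refl a → Adj-irr a }))
    (cong₂ _ℕ+_ (#-one v) (trans (∑-cong (λ t → ind (adj G v t) refl)) (sym (sum-allFin _))))
    where
    open import Data.Fin.Properties using () renaming (_≟_ to _≟F_)
    ind : ∀ {t} b → adj G v t ≡ b → ⟨ Adj? v t ⟩ ≡ (if adj G v t then 1 else 0)
    ind {t} true e = trans (⟨⟩-yes (Adj? v t) e) (cong (if_then 1 else 0) (sym e))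
    ind {t} false e = trans (⟨⟩-no (Adj? v t) λ a → contradiction (trans (sym a) e) λ ()) (cong (if_then 1 else 0) (sym e))

  half-bound : ∀ {ε f d} → ε ≤ ½ → 0ℚ ≤ f → f * (ι d + 1ℚ - ε) ≤ 1ℚ → f * (ι d + ½) ≤ 1ℚ
  half-bound {ε} {f} {d} ε≤ 0≤f bd = ≤-trans (*-monoˡ-≤-nonNeg f {{nonNegative 0≤f}} (≤-trans (≤-reflexive (half (ι d)))
      (+-monoʳ-≤ (ι d + 1ℚ) (neg-antimono-≤ ε≤)))) bd
    where
    half : ∀ x → x + ½ ≡ x + 1ℚ - ½
    half x = trans (cong (λ y → x + y) {½} {1ℚ - ½} refl) (sym (+-assoc x 1ℚ (- ½)))

  module _ (ε : ℚ) (ε≤½ : ε ≤ ½) (f : Fin n → ℚ) (dem : IsDemand f)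
    (bound : ∀ v → f v * ((+ degree G v) / 1 + 1ℚ - ε) ≤ 1ℚ) (cliques-ok : ∀ K → IsClique G K → sumOver K f ≤ 1ℚ) where

    private
      common = common-denominator f (λ v → proj₁ (dem v))
      m₀ M : ℕ
      m₀ = proj₁ common
      M = suc m₀
      h : Fin n → ℕ
      h = proj₁ (proj₂ common)
      h-spec : ∀ v → f v * ι M ≡ ι (h v)
      h-spec = proj₂ (proj₂ common)

    demand-bound : ∀ v → 2 ℕ* (D everything v ℕ* h v) ℕ≤ 2 ℕ* M ℕ+ h v
    demand-bound v = ℕ.≤-trans (ℕ.≤-reflexive (trans (cong (λ x → 2 ℕ* (x ℕ* h v)) (D-everything v)) (i d (h v))))
      (ℕ.+-monoˡ-≤ (h v) (ι-cancel (begin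
        ι ((2 ℕ* d ℕ+ 1) ℕ* h v) ≡⟨ trans (ι-* (2 ℕ* d ℕ+ 1) (h v)) (cong₂ _*_ (trans (ι-+ (2 ℕ* d) 1) (cong (_+ ι 1) (ι-* 2 d))) (sym (h-spec v))) ⟩
        (ι 2 * ι d + ι 1) * (f v * ι M) ≡⟨ rearrange (ι d) (f v) (ι M) ⟩
        f v * (ι d + ½) * (ι 2 * ι M) ≤⟨ *-monoʳ-≤-nonNeg (ι 2 * ι M) {{subst NonNegative (ι-* 2 M) (ι-nonNeg (2 ℕ* M))}} (half-bound {d = d} ε≤½ (proj₁ (dem v)) (subst (λ x → f v * (x + 1ℚ - ε) ≤ 1ℚ) (sym (ι-def d)) (bound v))) ⟩
        1ℚ * (ι 2 * ι M) ≡⟨ trans (*-identityˡ (ι 2 * ι M)) (sym (ι-* 2 M)) ⟩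
        ι (2 ℕ* M) ∎)))
      where
      open ≤-Reasoning
      d = degree G v
      i : ∀ d x → 2 ℕ* (suc d ℕ* x) ≡ (2 ℕ* d ℕ+ 1) ℕ* x ℕ+ x
      i = solve-∀
      rearrange : ∀ x y z → (ι 2 * x + ι 1) * (y * z) ≡ y * (x + ½) * (ι 2 * z)
      rearrange x y z rewrite ι-+ 1 1 | ι-one =
        solve 3 (λ x y z → ((con 1ℚ :+ con 1ℚ) :* x :+ con 1ℚ) :* (y :* z) := y :* (x :+ con ½) :* ((con 1ℚ :+ con 1ℚ) :* z)) refl x y z
        where open +-*-Solver

    clique-bound : ∀ K → Clique K → total K h ℕ≤ M
    clique-bound K cl = ι-cancel (begin
      ι (total K h) ≡⟨ sym (sumℚ-allFin _ (λ v → ⟨ in? K v ⟩ ℕ* h v) (ι M) weight) ⟩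
      sumOver set f * ι M ≤⟨ *-monoʳ-≤-nonNeg (ι M) {{ι-nonNeg M}} (cliques-ok set isClique) ⟩
      1ℚ * ι M ≡⟨ *-identityˡ (ι M) ⟩
      ι M ∎)
      where
      open ≤-Reasoning
      set : VSet n
      set = Vec.tabulate (λ v → does (in? K v))
      look : ∀ v → Vec.lookup set v ≡ does (in? K v)
      look = Vec.lookup∘tabulate _
      member : ∀ v → v ∈V set → In K v
      member v m with in? K v | trans (sym (look v)) m
      ... | yes Kv | _ = Kv
      ... | no _ | ()
      isClique : IsClique G set
      isClique a b ma mb ne with cl a b (member a ma) (member b mb)
      ... | inj₁ e = contradiction e ne
      ... | inj₂ adjacent = adjacent
      weight : ∀ v → (if Vec.lookup set v then f v else 0ℚ) * ι M ≡ ι (⟨ in? K v ⟩ ℕ* h v)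
      weight v rewrite look v with in? K v
      ... | yes _ = trans (h-spec v) (cong ι (sym (ℕ.+-identityʳ (h v))))
      ... | no _ = trans (*-zeroˡ (ι M)) (sym ι-zero)

    valid : Valid everything M h
    valid = record { outside = λ v ¬tt → contradiction tt ¬tt ; nonsimplicial = λ v _ _ → demand-bound v ; cliques = λ K _ → clique-bound K }

    regions : ∀ c (φ : Family (suc c ℕ* M)) → Proper φ → (∀ v → ∣ φ v ∣ ≡ suc c ℕ* h v) → Σ (Fin n → PSet) (IsFColoring G f)
    regions c φ proper cnt = (λ v → region (φ v)) , (λ u v a → region-disjoint (proper u v a)) , large
      where
      -- The successor of this number is `suc c ℕ* M` by computation, so the cells are exactly the
      -- colours of `φ`.
      open Cells (m₀ ℕ+ c ℕ* M)
      large : ∀ v → f v ≤ μ (region (φ v))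
      large v = *-cancelʳ-≤-pos (ι (suc c ℕ* M)) {{ι-pos (m₀ ℕ+ c ℕ* M)}} (≤-reflexive (begin-equality
        f v * ι (suc c ℕ* M) ≡⟨ cong (f v *_) (trans (ι-* (suc c) M) (*-comm (ι (suc c)) (ι M))) ⟩
        f v * (ι M * ι (suc c)) ≡⟨ trans (sym (*-assoc (f v) (ι M) (ι (suc c)))) (cong (_* ι (suc c)) (h-spec v)) ⟩
        ι (h v) * ι (suc c) ≡⟨ trans (*-comm (ι (h v)) (ι (suc c))) (sym (ι-* (suc c) (h v))) ⟩
        ι (suc c ℕ* h v) ≡⟨ cong ι (sym (cnt v)) ⟩
        ι ∣ φ v ∣ ≡⟨ sym (μ-region (φ v)) ⟩
        μ (region (φ v)) * ι (suc c ℕ* M) ∎))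
        where open ≤-Reasoning

    f-colouring : Σ (Fin n → PSet) (IsFColoring G f)
    f-colouring with Conclusion.colourable G everything valid
    ... | record { c = c ; L≡ = refl ; φ = φ ; proper = proper ; cnt = cnt } = regions c φ proper cnt

theorem1p3 : (ε : ℚ) → ε ≤ (+ 1) / 2 →
    (n : ℕ) (G : SimpleGraph n) (f : Fin n → ℚ) → IsDemand f →
    (∀ v → f v * ((+ degree G v) / 1 + 1ℚ - ε) ≤ 1ℚ) →
    (∀ K → IsClique G K → sumOver K f ≤ 1ℚ) →
    Σ (Fin n → PSet) (λ φ → IsFColoring G f φ)
theorem1p3 ε ε≤ n G f dem bound cliques-ok = f-colouring G ε ε≤ f dem bound cliques-ok
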